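{- Let $g\in\mathbb{Q}\setminus\{ -1,0,1\}$, write $g=\pm g_0^h$ with $g_0>0$ not an exact power of a rational number and $h$ as large as possible, let $d$ be a positive integer and let $D$ be a fundamental discriminant. Put $\gamma=\max\{0,\nu_2(D/(dh))\}$ and $$S_3(D):=\sum_{\substack{v\mid d^{\infty},\ \alpha\mid d\\ [2^{\nu_2(hd/\alpha)+1},D]\mid dv}}{\mu(\alpha)(\alpha v,h)\over \varphi(dv)\,\alpha v}.$$ Then $$S_3(D)=\begin{cases}4^{ -\gamma}S(d,h) & \text{if } 2\mid d,\ D\mid 4d \text{ and } \gamma\ge 1;\\ -{S(d,h)/2} & \text{if } 2\mid d,\ D\mid 4d \text{ and } \gamma=0;\\ 0 & \text{otherwise,}\end{cases}$$ where $S(d,h)={1\over d\,(h,d^{\infty})}\prod_{p\mid d}{p^2\over p^2-1}$.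
   Context: $v\mid d^{\infty}$ means $v$ is a positive integer all of whose prime factors divide $d$; $(h,d^{\infty})=\prod_{p\mid d}p^{\nu_p(h)}$; $[a,b]$ is the lcm, $(a,b)$ the gcd; $\nu_2$ is the 2-adic valuation (extended to rationals); $\mu$ is the Möbius function, $\varphi$ Euler's totient. -}

module Defs where

open import Data.Bool using (Bool; true; false; if_then_else_; _∧_; not)
open import Data.Nat as ℕ using (ℕ; zero; suc; _∸_; _≤_)
open import Data.Nat.Divisibility using (_∣_; _∣?_)
open import Data.Nat.GCD using (gcd)
open import Data.Nat.LCM using (lcm)
open import Data.Nat.Primality using (Prime; prime?)
open import Data.Integer as ℤ using (ℤ; +_)
open import Data.Rational as ℚ using (ℚ; 0ℚ; 1ℚ)
open import Data.List using (List; []; _∷_; map; filter; upTo; foldr; length)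
open import Data.Product using (Σ; ∃; _×_; _,_)
open import Data.Sum using (_⊎_)
open import Relation.Nullary using (¬_)
open import Relation.Nullary.Decidable using (⌊_⌋; _×-dec_; ¬?)
open import Relation.Binary.PropositionalEquality using (_≡_)

range1 : ℕ → List ℕ
range1 n = map suc (upTo n)

-- total natural-number quotient (junk value 0 for divisor 0; only used with nonzero divisors)
_div_ : ℕ → ℕ → ℕ
n div zero = zero
n div suc m = n ℕ./ suc m

-- total rational fraction a / b (junk value 0 for b = 0; only used with b ≠ 0)
_//_ : ℤ → ℕ → ℚ
a // zero = 0ℚ
a // suc m = a ℚ./ suc m

_^ℚ_ : ℚ → ℕ → ℚ
q ^ℚ zero = 1ℚ
q ^ℚ suc k = q ℚ.* (q ^ℚ k)

allB : {A : Set} → (A → Bool) → List A → Bool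
allB f [] = true
allB f (x ∷ xs) = f x ∧ allB f xs

sumℚ : List ℚ → ℚ
sumℚ = foldr ℚ._+_ 0ℚ

prodℚ : List ℚ → ℚ
prodℚ = foldr ℚ._*_ 1ℚ

prodℕ : List ℕ → ℕ
prodℕ = foldr ℕ._*_ 1

divisors : ℕ → List ℕ
divisors d = filter (λ a → a ∣? d) (range1 d)

primeDivisors : ℕ → List ℕ
primeDivisors d = filter (λ p → prime? p ×-dec p ∣? d) (range1 d)

-- p-adic valuation of n (for p ≥ 2, n ≥ 1); fuel n suffices
valF : ℕ → ℕ → ℕ → ℕ
valF zero p n = zero
valF (suc f) p n with ⌊ p ∣? n ⌋
... | false = zero
... | true = suc (valF f p (n div p))

ν : ℕ → ℕ → ℕ
ν zero n = zero
ν (suc zero) n = zero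
ν p@(suc (suc _)) zero = zero
ν p@(suc (suc _)) n@(suc _) = valF n p n

ν₂ : ℕ → ℕ
ν₂ = ν 2

-- v ∣ d^∞ : v ≥ 1 and every prime factor of v divides d
-- (prime factors of v are ≤ v, so checking primes p ≤ v is the full condition)
dInf : ℕ → ℕ → Bool
dInf d zero = false
dInf d v@(suc _) = allB (λ p → not ⌊ prime? p ×-dec p ∣? v ⌋ Data.Bool.∨ ⌊ p ∣? d ⌋) (range1 v)

squarefreeB : ℕ → Bool
squarefreeB n = allB (λ k → not ⌊ (k ℕ.* k) ∣? n ⌋) (filter (λ k → ¬? (k ℕ.≟ 1)) (range1 n))

μ : ℕ → ℤ
μ zero = + 0
μ n@(suc _) = if squarefreeB n then (ℤ.- (+ 1)) ℤ.^ length (primeDivisors n) else + 0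

φ : ℕ → ℕ
φ n = length (filter (λ k → gcd k n ℕ.≟ 1) (range1 n))

-- (h, d^∞) = ∏_{p ∣ d} p^{ν_p(h)}
gcdInf : ℕ → ℕ → ℕ
gcdInf h d = prodℕ (map (λ p → p ℕ.^ ν p h) (primeDivisors d))

Sdh : ℕ → ℕ → ℚ
Sdh d h = ((+ 1) // (d ℕ.* gcdInf h d))
          ℚ.* prodℚ (map (λ p → (+ (p ℕ.* p)) // (p ℕ.* p ∸ 1)) (primeDivisors d))

condB : ℕ → ℕ → ℤ → ℕ → ℕ → Bool
condB d h D v α = ⌊ lcm (2 ℕ.^ (ν₂ (h ℕ.* (d div α)) ℕ.+ 1)) (ℤ.∣ D ∣) ∣? (d ℕ.* v) ⌋

term : ℕ → ℕ → ℕ → ℕ → ℚ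
term d h v α = (μ α ℤ.* (+ gcd (α ℕ.* v) h)) // (φ (d ℕ.* v) ℕ.* (α ℕ.* v))

-- partial sums of S₃(D): terms with v ≤ N (the α-sum is finite)
S₃partial : ℕ → ℕ → ℤ → ℕ → ℚ
S₃partial d h D N =
  sumℚ (map (λ v → sumℚ (map (λ α → if condB d h D v α then term d h v α else 0ℚ) (divisors d)))
            (filter (λ v → Data.Bool._≟_ (dInf d v) true) (range1 N)))

ConvergesTo : (ℕ → ℚ) → ℚ → Set
ConvergesTo f L = ∀ (ε : ℚ) → 0ℚ ℚ.< ε → ∃ λ M → ∀ N → M ≤ N → ℚ.∣ f N ℚ.- L ∣ ℚ.< ε

SquarefreeZ : ℤ → Set
SquarefreeZ z = ∀ (n : ℕ) → (n ℕ.* n) ∣ ℤ.∣ z ∣ → n ≡ 1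

_≡_mod4 : ℤ → ℕ → Set
z ≡ r mod4 = ∃ λ (k : ℤ) → z ≡ (+ 4) ℤ.* k ℤ.+ (+ r)

IsFundamentalDiscriminant : ℤ → Set
IsFundamentalDiscriminant D =
  (D ≡ 1 mod4 × SquarefreeZ D)
  ⊎ (∃ λ (m : ℤ) → D ≡ (+ 4) ℤ.* m × (m ≡ 2 mod4 ⊎ m ≡ 3 mod4) × SquarefreeZ m)

IsExactPower : ℚ → Set
IsExactPower q = ∃ λ (r : ℚ) → ∃ λ (k : ℕ) → 2 ≤ k × q ≡ r ^ℚ k

-- γ = max{0, ν₂(D/(dh))} = ν₂(D) - ν₂(d) - ν₂(h) truncated at 0
γ : ℕ → ℕ → ℤ → ℕ
γ d h D = ν₂ (ℤ.∣ D ∣) ∸ (ν₂ d ℕ.+ ν₂ h)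

-- Truncate the v-sum at v ≤ N. For v ∣ d^∞ and squarefree α ∣ d we have φ(dv) = v φ(d), and the
-- summand factorises over the primes p ∣ d as (1/φ(d)) ∏_p X_p(ν_p v, ν_p α), where
-- X_p(j, e) = (−1)^e p^min(e+j, ν_p h) p^(−j) p^(−e−j).
-- When 2 ∣ d and D ∣ 4d the summation condition reads ν₂(h) < ν₂(α) + ν₂(v) and ν₂(D) ≤ ν₂(d) + ν₂(v),
-- so it only restricts the factor at p = 2, and the sum over the box {v : ν_p(v) ≤ N for all p ∣ d}
-- is (1/φ(d)) ∏_p Σ_{j ≤ N} σ_p(j), with σ_p(j) the sum of the admissible X_p(j, e), e ∈ {0, 1}.
-- For odd p, σ_p(j) vanishes for j < ν_p(h) and is geometric with ratio p⁻² from there on, which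
-- gives the limit (1 − 1/p) p^(−ν_p(h)) p²/(p² − 1). At p = 2 the condition delays the geometric tail
-- by γ, producing the factor 4^(−γ); when γ = 0 it leaves instead an isolated negative term at
-- j = ν₂(h), and the factor becomes −1/2. As φ(d) = d ∏_p (1 − 1/p), the product of the local limits
-- is 4^(−γ) S(d,h), resp. −S(d,h)/2. The box contains every v ∣ d^∞ with v ≤ N, and each of its
-- elements v > N contributes O(dh/v²), so the truncation error is O(dh/N).
-- If 2 ∤ d or D ∤ 4d, the condition [2^(…), D] ∣ dv fails for every v ∣ d^∞, as D is squarefree up to
-- a factor 4, so all partial sums vanish.

module Submission where

open import Data.Nat as ℕ using (ℕ)
open import Data.Nat.Divisibility using (_∣_)
open import Data.Integer as ℤ using (ℤ)

module Booleans where

  open import Data.Bool using (Bool; true; false; _∧_)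
  open import Data.Product using (_×_; _,_)
  open import Relation.Nullary using (Dec; yes; no; ¬_)
  open import Relation.Nullary.Decidable using (⌊_⌋)
  open import Relation.Binary.PropositionalEquality using (_≡_; refl; sym)
  open import Data.Empty using (⊥-elim)

  private variable P Q : Set

  -- ⌊_⌋ = isYes, used throughout Defs, is not definitionally `does`, so stdlib's dec-true/dec-false do not apply.
  ⌊⌋≡true : (p? : Dec P) → P → ⌊ p? ⌋ ≡ true
  ⌊⌋≡true (yes _) _ = refl
  ⌊⌋≡true (no ¬p) p = ⊥-elim (¬p p)

  ⌊⌋≡false : (p? : Dec P) → ¬ P → ⌊ p? ⌋ ≡ false
  ⌊⌋≡false (yes p) ¬p = ⊥-elim (¬p p)
  ⌊⌋≡false (no _) _ = refl

  ⌊⌋≡true⇒ : (p? : Dec P) → ⌊ p? ⌋ ≡ true → P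
  ⌊⌋≡true⇒ (yes p) _ = p

  ⌊⌋-cong : (p? : Dec P) (q? : Dec Q) → (P → Q) → (Q → P) → ⌊ p? ⌋ ≡ ⌊ q? ⌋
  ⌊⌋-cong (yes p) q? f g = sym (⌊⌋≡true q? (f p))
  ⌊⌋-cong (no ¬p) q? f g = sym (⌊⌋≡false q? (λ q → ¬p (g q)))

  ∧≡true⇒ : ∀ {a b} → a ∧ b ≡ true → a ≡ true × b ≡ true
  ∧≡true⇒ {true} {true} refl = refl , refl

  ≡true-ext : ∀ {a b : Bool} → (a ≡ true → b ≡ true) → (b ≡ true → a ≡ true) → a ≡ b
  ≡true-ext {true} {true} f g = refl
  ≡true-ext {true} {false} f g = sym (f refl)
  ≡true-ext {false} {true} f g = g refl
  ≡true-ext {false} {false} f g = refl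


module FiniteSums where

  open import Data.Bool using (Bool; true; false; if_then_else_; _∧_)
  open import Data.Nat as ℕ using (ℕ; zero; suc; _<_)
  import Data.Nat.Properties as ℕP
  open import Data.Rational as ℚ using (ℚ; 0ℚ; _+_; _*_; -_; _-_; _≤_; ∣_∣)
  open import Data.Rational.Properties
  open import Data.Rational.Solver using (module +-*-Solver)
  open import Data.List using (List; []; _∷_; map; filter; upTo; _∷ʳ_)
  import Data.List.Properties as LP
  open import Data.Empty using (⊥-elim)
  open import Function using (_∘_)
  open import Relation.Nullary using (Dec; yes; no)
  open import Relation.Nullary.Decidable using (⌊_⌋)
  open import Relation.Binary.PropositionalEquality
  open import Defs using (sumℚ; range1)
  open Booleans

  Σ< : ℕ → (ℕ → ℚ) → ℚ
  Σ< zero    f = 0ℚ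
  Σ< (suc n) f = Σ< n f + f n

  Σ≤ : ℕ → (ℕ → ℚ) → ℚ
  Σ≤ n f = Σ< n (f ∘ suc)

  [_]·_ : Bool → ℚ → ℚ
  [ b ]· x = if b then x else 0ℚ

  Σ<-cong : ∀ n {f g : ℕ → ℚ} → (∀ i → i < n → f i ≡ g i) → Σ< n f ≡ Σ< n g
  Σ<-cong zero    f≡g = refl
  Σ<-cong (suc n) f≡g = cong₂ _+_ (Σ<-cong n (λ i i<n → f≡g i (ℕP.m<n⇒m<1+n i<n))) (f≡g n (ℕP.n<1+n n))

  Σ<-zero : ∀ n {f : ℕ → ℚ} → (∀ i → i < n → f i ≡ 0ℚ) → Σ< n f ≡ 0ℚ
  Σ<-zero zero    f≡0 = refl
  Σ<-zero (suc n) f≡0 = cong₂ _+_ (Σ<-zero n (λ i i<n → f≡0 i (ℕP.m<n⇒m<1+n i<n))) (f≡0 n (ℕP.n<1+n n))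

  Σ<-distrib-+ : ∀ n (f g : ℕ → ℚ) → Σ< n (λ i → f i + g i) ≡ Σ< n f + Σ< n g
  Σ<-distrib-+ zero    f g = refl
  Σ<-distrib-+ (suc n) f g = trans (cong (_+ (f n + g n)) (Σ<-distrib-+ n f g)) (interchange (Σ< n f) (Σ< n g) (f n) (g n))
    where
    open +-*-Solver
    interchange : ∀ a b c d → (a + b) + (c + d) ≡ (a + c) + (b + d)
    interchange = solve 4 (λ a b c d → (a :+ b) :+ (c :+ d) := (a :+ c) :+ (b :+ d)) refl

  Σ<-*ˡ : ∀ n (c : ℚ) (f : ℕ → ℚ) → Σ< n (λ i → c * f i) ≡ c * Σ< n f
  Σ<-*ˡ zero    c f = sym (*-zeroʳ c)
  Σ<-*ˡ (suc n) c f = trans (cong (_+ (c * f n)) (Σ<-*ˡ n c f)) (sym (*-distribˡ-+ c (Σ< n f) (f n)))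

  Σ<-*ʳ : ∀ n (c : ℚ) (f : ℕ → ℚ) → Σ< n (λ i → f i * c) ≡ Σ< n f * c
  Σ<-*ʳ n c f = trans (Σ<-cong n (λ i _ → *-comm (f i) c)) (trans (Σ<-*ˡ n c f) (*-comm c (Σ< n f)))

  Σ<-distrib-minus : ∀ n (f g : ℕ → ℚ) → Σ< n (λ i → f i - g i) ≡ Σ< n f - Σ< n g
  Σ<-distrib-minus n f g = trans (Σ<-distrib-+ n f (λ i → - g i)) (cong (Σ< n f +_) (Σ<-neg n))
    where
    Σ<-neg : ∀ n → Σ< n (λ i → - g i) ≡ - Σ< n g
    Σ<-neg zero    = refl
    Σ<-neg (suc n) = trans (cong (_+ (- g n)) (Σ<-neg n)) (sym (neg-distrib-+ (Σ< n g) (g n)))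

  Σ<-split : ∀ m n (f : ℕ → ℚ) → Σ< (m ℕ.+ n) f ≡ Σ< m f + Σ< n (λ i → f (m ℕ.+ i))
  Σ<-split m zero f = trans (cong (λ k → Σ< k f) (ℕP.+-identityʳ m)) (sym (+-identityʳ (Σ< m f)))
  Σ<-split m (suc n) f = begin
      Σ< (m ℕ.+ suc n) f                                        ≡⟨ cong (λ k → Σ< k f) (ℕP.+-suc m n) ⟩
      Σ< (m ℕ.+ n) f + f (m ℕ.+ n)                               ≡⟨ cong (_+ f (m ℕ.+ n)) (Σ<-split m n f) ⟩
      (Σ< m f + Σ< n (λ i → f (m ℕ.+ i))) + f (m ℕ.+ n)          ≡⟨ +-assoc (Σ< m f) _ _ ⟩
      Σ< m f + (Σ< n (λ i → f (m ℕ.+ i)) + f (m ℕ.+ n))          ∎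
    where open ≡-Reasoning

  Σ<-swap : ∀ m n (f : ℕ → ℕ → ℚ) → Σ< m (λ i → Σ< n (f i)) ≡ Σ< n (λ j → Σ< m (λ i → f i j))
  Σ<-swap zero    n f = sym (Σ<-zero n (λ _ _ → refl))
  Σ<-swap (suc m) n f = trans (cong (_+ Σ< n (f m)) (Σ<-swap m n f)) (sym (Σ<-distrib-+ n _ (f m)))

  Σ<-mono-≤ : ∀ n {f g : ℕ → ℚ} → (∀ i → i < n → f i ≤ g i) → Σ< n f ≤ Σ< n g
  Σ<-mono-≤ zero    f≤g = ≤-refl
  Σ<-mono-≤ (suc n) f≤g = +-mono-≤ (Σ<-mono-≤ n (λ i i<n → f≤g i (ℕP.m<n⇒m<1+n i<n))) (f≤g n (ℕP.n<1+n n))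

  ∣Σ<∣≤Σ<∣∣ : ∀ n (f : ℕ → ℚ) → ∣ Σ< n f ∣ ≤ Σ< n (λ i → ∣ f i ∣)
  ∣Σ<∣≤Σ<∣∣ zero    f = ≤-refl
  ∣Σ<∣≤Σ<∣∣ (suc n) f = ≤-trans (∣p+q∣≤∣p∣+∣q∣ (Σ< n f) (f n)) (+-monoˡ-≤ ∣ f n ∣ (∣Σ<∣≤Σ<∣∣ n f))

  Σ<-indicator-unique : ∀ n t (P : ℕ → Bool) (g : ℕ → ℚ) → (∀ i → i < n → P i ≡ true → i ≡ t) →
    Σ< n (λ i → [ P i ]· g i) ≡ [ ⌊ t ℕ.<? n ⌋ ∧ P t ]· g t
  Σ<-indicator-unique zero    t P g unique = refl
  Σ<-indicator-unique (suc n) t P g unique =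
    trans (cong (_+ [ P n ]· g n) (Σ<-indicator-unique n t P g (λ i i<n → unique i (ℕP.m<n⇒m<1+n i<n))))
          (last (n ℕ.≟ t))
    where
    last : Dec (n ≡ t) → [ ⌊ t ℕ.<? n ⌋ ∧ P t ]· g t + [ P n ]· g n ≡ [ ⌊ t ℕ.<? suc n ⌋ ∧ P t ]· g t
    last (yes refl) rewrite ⌊⌋≡false (n ℕ.<? n) (ℕP.<-irrefl refl) | ⌊⌋≡true (n ℕ.<? suc n) (ℕP.n<1+n n) =
      +-identityˡ _
    last (no n≢t) with P n in Pn
    ... | true  = ⊥-elim (n≢t (unique n (ℕP.n<1+n n) Pn))
    ... | false rewrite ⌊⌋-cong (t ℕ.<? n) (t ℕ.<? suc n) ℕP.m<n⇒m<1+n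
                                 (λ t<1+n → ℕP.≤∧≢⇒< (ℕP.≤-pred t<1+n) (λ t≡n → n≢t (sym t≡n))) =
      +-identityʳ _

  [b]·-∧ : ∀ a b x → [ a ]· ([ b ]· x) ≡ [ a ∧ b ]· x
  [b]·-∧ true  b x = refl
  [b]·-∧ false b x = refl

  [b]·-*ˡ : ∀ b x y → [ b ]· (x * y) ≡ x * [ b ]· y
  [b]·-*ˡ true  x y = refl
  [b]·-*ˡ false x y = sym (*-zeroʳ x)

  [b]·-*ʳ : ∀ b x y → [ b ]· (x * y) ≡ [ b ]· x * y
  [b]·-*ʳ true  x y = refl
  [b]·-*ʳ false x y = sym (*-zeroˡ y)

  sumℚ-∷ʳ : ∀ (xs : List ℚ) x → sumℚ (xs ∷ʳ x) ≡ sumℚ xs + x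
  sumℚ-∷ʳ []       x = trans (+-identityʳ x) (sym (+-identityˡ x))
  sumℚ-∷ʳ (y ∷ xs) x = trans (cong (y +_) (sumℚ-∷ʳ xs x)) (sym (+-assoc y (sumℚ xs) x))

  sumℚ-upTo : ∀ n (f : ℕ → ℚ) → sumℚ (map f (upTo n)) ≡ Σ< n f
  sumℚ-upTo zero    f = refl
  sumℚ-upTo (suc n) f = begin
      sumℚ (map f (upTo (suc n)))     ≡⟨ cong (sumℚ ∘ map f) (sym (LP.upTo-∷ʳ n)) ⟩
      sumℚ (map f (upTo n ∷ʳ n))      ≡⟨ cong sumℚ (LP.map-++ f (upTo n) (n ∷ [])) ⟩
      sumℚ (map f (upTo n) ∷ʳ f n)    ≡⟨ sumℚ-∷ʳ (map f (upTo n)) (f n) ⟩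
      sumℚ (map f (upTo n)) + f n     ≡⟨ cong (_+ f n) (sumℚ-upTo n f) ⟩
      Σ< n f + f n                    ∎
    where open ≡-Reasoning

  sumℚ-range1 : ∀ n (f : ℕ → ℚ) → sumℚ (map f (range1 n)) ≡ Σ≤ n f
  sumℚ-range1 n f = trans (cong sumℚ (sym (LP.map-∘ (upTo n)))) (sumℚ-upTo n (f ∘ suc))

  sumℚ-filter : ∀ {A : Set} {P : A → Set} (P? : (x : A) → Dec (P x)) (f : A → ℚ) (xs : List A) →
               sumℚ (map f (filter P? xs)) ≡ sumℚ (map (λ x → [ ⌊ P? x ⌋ ]· f x) xs)
  sumℚ-filter P? f [] = refl
  sumℚ-filter P? f (x ∷ xs) with P? x
  ... | yes _ = cong (f x +_) (sumℚ-filter P? f xs)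
  ... | no _  = trans (sumℚ-filter P? f xs) (sym (+-identityˡ _))


module Valuation where

  open import Data.Nat as ℕ using (ℕ; zero; suc; _≤_; _<_; z≤n; s≤s; _^_; _*_; _+_; NonZero; _/_; >-nonZero)
  open import Data.Nat.Properties
  open import Data.Nat.Divisibility
  open import Data.Nat.DivMod using (m*[n/m]≡n; m*n/n≡m; m/n<m)
  open import Data.Nat.Primality
  open import Data.Nat.Primality.Factorisation using (factorise; PrimeFactorisation)
  open import Data.Nat.ListAction using (product)
  open import Data.List using ([]; _∷_)
  open import Data.List.Relation.Unary.All using (All; _∷_)
  open import Data.Product using (∃; _×_; _,_)
  open import Data.Sum using (inj₁; inj₂)
  open import Data.Empty using (⊥-elim)
  open import Relation.Nullary using (yes; no; ¬_)
  open import Relation.Binary.PropositionalEquality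
  open import Defs using (ν; valF; _div_)

  private variable p q n m k : ℕ

  div≡/ : ∀ n k .{{_ : NonZero k}} → n div k ≡ n / k
  div≡/ n (suc k) = refl

  m*n≥1 : 1 ≤ m → 1 ≤ n → 1 ≤ m * n
  m*n≥1 {suc m} {suc n} _ _ = s≤s z≤n

  prime⇒≥2 : Prime p → 2 ≤ p
  prime⇒≥2 {suc (suc _)} _ = s≤s (s≤s z≤n)

  ∃prime∣ : 2 ≤ n → ∃ λ p → Prime p × p ∣ n
  ∃prime∣ {n} n≥2 = first-factor (PrimeFactorisation.factors F) (PrimeFactorisation.isFactorisation F)
                                 (PrimeFactorisation.factorsPrime F)
    where
    instance _ = >-nonZero (≤-trans (s≤s z≤n) n≥2)
    F = factorise n
    first-factor : ∀ ps → n ≡ product ps → All Prime ps → ∃ λ p → Prime p × p ∣ n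
    first-factor []       n≡1 _         = ⊥-elim (<⇒≢ n≥2 (sym n≡1))
    first-factor (p ∷ ps) n≡∏ (pp ∷ _) = p , pp , subst (p ∣_) (sym n≡∏) (m∣m*n (product ps))

  module _ (p-2 : ℕ) where
    private P = suc (suc p-2)

    valF-sound : ∀ fuel n k → 1 ≤ n → k ≤ valF fuel P n → P ^ k ∣ n
    valF-sound fuel n zero _ _ = 1∣ n
    valF-sound (suc fuel) n (suc k) n≥1 k<v with P ∣? n
    ... | yes p∣n = subst (P ^ suc k ∣_) (m*[n/m]≡n p∣n) (*-monoʳ-∣ P (valF-sound fuel (n / P) k n/p≥1 (≤-pred k<v)))
      where
      n/p≥1 : 1 ≤ n / P
      n/p≥1 = n≢0⇒n>0 (λ n/p≡0 → <⇒≢ n≥1 (sym (trans (sym (m*[n/m]≡n p∣n)) (trans (cong (P *_) n/p≡0) (*-zeroʳ P)))))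

    valF-complete : ∀ fuel n k → 1 ≤ n → n ≤ fuel → P ^ k ∣ n → k ≤ valF fuel P n
    valF-complete fuel n zero _ _ _ = z≤n
    valF-complete zero n (suc k) n≥1 n≤0 _ = ⊥-elim (<⇒≱ n≥1 n≤0)
    valF-complete (suc fuel) n (suc k) n≥1 n≤fuel p^k∣n with P ∣? n
    ... | no p∤n = ⊥-elim (p∤n (∣-trans (m∣m*n (P ^ k)) p^k∣n))
    ... | yes p∣n = s≤s (valF-complete fuel (n / P) k n/p≥1 n/p≤fuel
                          (*-cancelˡ-∣ P (subst (P * P ^ k ∣_) (sym (m*[n/m]≡n p∣n)) p^k∣n)))
      where
      instance _ = >-nonZero n≥1
      n/p≥1 : 1 ≤ n / P
      n/p≥1 = n≢0⇒n>0 (λ n/p≡0 → <⇒≢ n≥1 (sym (trans (sym (m*[n/m]≡n p∣n)) (trans (cong (P *_) n/p≡0) (*-zeroʳ P)))))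
      n/p≤fuel : n / P ≤ fuel
      n/p≤fuel = ≤-pred (≤-trans (m/n<m n P (s≤s (s≤s z≤n))) n≤fuel)

  pow∣⇒≤ν : Prime p → 1 ≤ n → p ^ k ∣ n → k ≤ ν p n
  pow∣⇒≤ν {suc (suc p-2)} {suc n} _ n≥1 = valF-complete p-2 (suc n) (suc n) _ n≥1 ≤-refl

  ≤ν⇒pow∣ : Prime p → 1 ≤ n → k ≤ ν p n → p ^ k ∣ n
  ≤ν⇒pow∣ {suc (suc p-2)} {suc n} _ n≥1 = valF-sound p-2 (suc n) (suc n) _ n≥1

  p^ν∣n : Prime p → 1 ≤ n → p ^ ν p n ∣ n
  p^ν∣n pp n≥1 = ≤ν⇒pow∣ pp n≥1 ≤-refl

  p^[1+ν]∤n : Prime p → 1 ≤ n → ¬ (p ^ suc (ν p n) ∣ n)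
  p^[1+ν]∤n pp n≥1 p^[1+ν]∣n = <-irrefl refl (pow∣⇒≤ν pp n≥1 p^[1+ν]∣n)

  pFree : ℕ → ℕ → ℕ
  pFree p n = n div (p ^ ν p n)

  p^ν*pFree≡n : Prime p → 1 ≤ n → p ^ ν p n * pFree p n ≡ n
  p^ν*pFree≡n {p} {n} pp n≥1 = trans (cong (p ^ ν p n *_) (div≡/ n (p ^ ν p n))) (m*[n/m]≡n (p^ν∣n pp n≥1))
    where instance _ = prime⇒nonZero pp
                   _ = m^n≢0 p (ν p n)

  pFree≥1 : Prime p → 1 ≤ n → 1 ≤ pFree p n
  pFree≥1 {p} {n} pp n≥1 = n≢0⇒n>0 λ pFree≡0 →
    <⇒≢ n≥1 (sym (trans (sym (p^ν*pFree≡n pp n≥1)) (trans (cong (p ^ ν p n *_) pFree≡0) (*-zeroʳ (p ^ ν p n)))))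

  p∤pFree : Prime p → 1 ≤ n → ¬ (p ∣ pFree p n)
  p∤pFree {p} {n} pp n≥1 p∣pFree = p^[1+ν]∤n pp n≥1 (subst (_∣ n) (*-comm (p ^ ν p n) p)
     (subst (p ^ ν p n * p ∣_) (p^ν*pFree≡n pp n≥1) (*-monoʳ-∣ (p ^ ν p n) p∣pFree)))

  pFree∣n : Prime p → 1 ≤ n → pFree p n ∣ n
  pFree∣n {p} {n} pp n≥1 = subst (pFree p n ∣_) (p^ν*pFree≡n pp n≥1) (n∣m*n (p ^ ν p n))

  ν[p^k*w]≡k : ∀ {w} → Prime p → 1 ≤ w → ¬ (p ∣ w) → ν p (p ^ k * w) ≡ k
  ν[p^k*w]≡k {p} {k} {w} pp w≥1 p∤w = ≤-antisym ν≤k k≤ν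
    where
    instance _ = prime⇒nonZero pp
             _ = m^n≢0 p k
    p^k*w≥1 : 1 ≤ p ^ k * w
    p^k*w≥1 = m*n≥1 (m^n>0 p k) w≥1
    k≤ν : k ≤ ν p (p ^ k * w)
    k≤ν = pow∣⇒≤ν pp p^k*w≥1 (m∣m*n w)
    ν≤k : ν p (p ^ k * w) ≤ k
    ν≤k = ≮⇒≥ λ k<ν → p∤w (*-cancelˡ-∣ (p ^ k) (subst (_∣ p ^ k * w) (*-comm p (p ^ k)) (≤ν⇒pow∣ pp p^k*w≥1 k<ν)))

  pFree[p^k*w]≡w : ∀ {w} → Prime p → 1 ≤ w → ¬ (p ∣ w) → pFree p (p ^ k * w) ≡ w
  pFree[p^k*w]≡w {p} {k} {w} pp w≥1 p∤w = begin
      (p ^ k * w) div (p ^ ν p (p ^ k * w)) ≡⟨ cong (λ e → (p ^ k * w) div (p ^ e)) (ν[p^k*w]≡k {k = k} pp w≥1 p∤w) ⟩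
      (p ^ k * w) div (p ^ k)               ≡⟨ div≡/ _ (p ^ k) ⟩
      (p ^ k * w) / (p ^ k)                 ≡⟨ cong (_/ p ^ k) (*-comm (p ^ k) w) ⟩
      (w * p ^ k) / (p ^ k)                 ≡⟨ m*n/n≡m w (p ^ k) ⟩
      w                                     ∎
    where
    open ≡-Reasoning
    instance _ = prime⇒nonZero pp
             _ = m^n≢0 p k

  ∣p^k⇒∣p : Prime q → q ∣ p ^ k → q ∣ p
  ∣p^k⇒∣p {q} {p} {zero}  pq q∣1 = ⊥-elim (<⇒≱ (prime⇒≥2 pq) (∣⇒≤ q∣1))
  ∣p^k⇒∣p {q} {p} {suc k} pq q∣p^[1+k] with euclidsLemma p (p ^ k) pq q∣p^[1+k]
  ... | inj₁ q∣p   = q∣p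
  ... | inj₂ q∣p^k = ∣p^k⇒∣p {k = k} pq q∣p^k

  prime∣prime⇒≡ : Prime p → Prime q → q ∣ p → q ≡ p
  prime∣prime⇒≡ pp pq q∣p with prime⇒irreducible pp q∣p
  ... | inj₁ q≡1 = ⊥-elim (<⇒≱ (prime⇒≥2 pq) (≤-reflexive q≡1))
  ... | inj₂ q≡p = q≡p

  prime∤p^k : Prime p → Prime q → q ≢ p → ¬ (q ∣ p ^ k)
  prime∤p^k {k = k} pp pq q≢p q∣p^k = q≢p (prime∣prime⇒≡ pp pq (∣p^k⇒∣p {k = k} pq q∣p^k))

  ∤⇒ν≡0 : Prime p → 1 ≤ n → ¬ (p ∣ n) → ν p n ≡ 0
  ∤⇒ν≡0 {p} {n} pp n≥1 p∤n = trans (cong (ν p) (sym (*-identityˡ n))) (ν[p^k*w]≡k {k = 0} pp n≥1 p∤n)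

  ν-* : Prime p → 1 ≤ m → 1 ≤ n → ν p (m * n) ≡ ν p m + ν p n
  ν-* {p} {m} {n} pp m≥1 n≥1 =
    trans (cong (ν p) m*n≡) (ν[p^k*w]≡k pp (m*n≥1 (pFree≥1 pp m≥1) (pFree≥1 pp n≥1)) p∤s*t)
    where
    a = ν p m
    b = ν p n
    s = pFree p m
    t = pFree p n
    m*n≡ : m * n ≡ p ^ (a + b) * (s * t)
    m*n≡ = begin
      m * n                       ≡⟨ cong₂ _*_ (sym (p^ν*pFree≡n pp m≥1)) (sym (p^ν*pFree≡n pp n≥1)) ⟩
      (p ^ a * s) * (p ^ b * t)   ≡⟨ [m*n]*[o*p]≡[m*o]*[n*p] (p ^ a) s (p ^ b) t ⟩
      (p ^ a * p ^ b) * (s * t)   ≡⟨ cong (_* (s * t)) (sym (^-distribˡ-+-* p a b)) ⟩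
      p ^ (a + b) * (s * t)       ∎
      where open ≡-Reasoning
    p∤s*t : ¬ (p ∣ s * t)
    p∤s*t p∣s*t with euclidsLemma s t pp p∣s*t
    ... | inj₁ p∣s = p∤pFree pp m≥1 p∣s
    ... | inj₂ p∣t = p∤pFree pp n≥1 p∣t

  ν[p^k*w]≡ν[w] : ∀ {w} → Prime p → Prime q → q ≢ p → 1 ≤ w → ν q (p ^ k * w) ≡ ν q w
  ν[p^k*w]≡ν[w] {p} {q} {k} {w} pp pq q≢p w≥1 = trans (ν-* pq (m^n>0 p k) w≥1)
      (cong (_+ ν q w) (∤⇒ν≡0 pq (m^n>0 p k) (prime∤p^k {k = k} pp pq q≢p)))
    where instance _ = prime⇒nonZero pp

  ν-pFree : Prime p → Prime q → q ≢ p → 1 ≤ n → ν q (pFree p n) ≡ ν q n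
  ν-pFree {p} {q} {n} pp pq q≢p n≥1 =
    trans (sym (ν[p^k*w]≡ν[w] {k = ν p n} pp pq q≢p (pFree≥1 pp n≥1))) (cong (ν q) (p^ν*pFree≡n pp n≥1))

  ν-mono-∣ : Prime q → 1 ≤ m → 1 ≤ n → m ∣ n → ν q m ≤ ν q n
  ν-mono-∣ pq m≥1 n≥1 m∣n = pow∣⇒≤ν pq n≥1 (∣-trans (p^ν∣n pq m≥1) m∣n)

  n<2^n : ∀ n → n < 2 ^ n
  n<2^n zero    = s≤s z≤n
  n<2^n (suc n) = +-mono-≤-< (m^n>0 2 n) (subst (n <_) (sym (+-identityʳ (2 ^ n))) (n<2^n n))

  ν<n : Prime p → 1 ≤ n → ν p n < n
  ν<n {p} {n} pp n≥1 = <-≤-trans (n<2^n (ν p n))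
    (≤-trans (^-monoˡ-≤ (ν p n) (prime⇒≥2 pp)) (∣⇒≤ {{>-nonZero n≥1}} (p^ν∣n pp n≥1)))


module Box where

  open import Data.Bool using (Bool; true; _∧_)
  open import Data.Bool.Properties using (∧-comm; ∧-identityʳ)
  open import Data.Nat as ℕ using (ℕ; zero; suc; _≤_; _<_; z≤n; s≤s; _^_; _*_; _/_; >-nonZero; _≤?_; _<?_; _≟_)
  open import Data.Nat.Properties
  open import Data.Nat.Divisibility
  open import Data.Nat.DivMod using (m*[n/m]≡n)
  open import Data.Nat.Primality
  open import Data.Rational as ℚ using (ℚ)
  open import Data.List using (List; []; _∷_; map)
  open import Data.List.Membership.Propositional using (_∈_; _∉_)
  open import Data.List.Relation.Unary.Any using (here; there)
  open import Data.Product using (_,_; proj₁; proj₂)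
  open import Data.Sum using (inj₁; inj₂)
  open import Data.Empty using (⊥; ⊥-elim)
  open import Relation.Nullary using (yes; no; ¬_)
  open import Relation.Nullary.Decidable using (⌊_⌋)
  open import Relation.Binary.PropositionalEquality hiding (J)
  open import Defs using (ν; _div_; prodℚ)
  open Booleans
  open FiniteSums
  open Valuation

  data DistinctPrimes : List ℕ → Set where
    []   : DistinctPrimes []
    cons : ∀ {p qs} → Prime p → p ∉ qs → DistinctPrimes qs → DistinctPrimes (p ∷ qs)

  ∈-prime : ∀ {qs q} → DistinctPrimes qs → q ∈ qs → Prime q
  ∈-prime (cons pp _ _)  (here refl) = pp
  ∈-prime (cons _ _ ps) (there q∈)  = ∈-prime ps q∈

  -- InBox qs J w holds iff w = ∏_{q ∈ qs} q ^ e_q with every e_q ≤ J.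
  InBox : List ℕ → ℕ → ℕ → Bool
  InBox []       J w = ⌊ w ≟ 1 ⌋
  InBox (p ∷ qs) J w = ⌊ ν p w ≤? J ⌋ ∧ InBox qs J (pFree p w)

  boxSum : List ℕ → ℕ → (ℕ → ℚ) → ℚ
  boxSum []       J f = f 1
  boxSum (p ∷ qs) J f = Σ< (suc J) (λ j → boxSum qs J (λ w → f (p ^ j * w)))

  boxBound : List ℕ → ℕ → ℕ
  boxBound []       J = 1
  boxBound (p ∷ qs) J = p ^ J * boxBound qs J

  private variable J w v : ℕ

  pFree-0 : ∀ {p} → Prime p → pFree p 0 ≡ 0
  pFree-0 {suc (suc _)} _ = refl

  InBox⇒≥1 : ∀ {qs} → DistinctPrimes qs → InBox qs J w ≡ true → 1 ≤ w
  InBox⇒≥1 {J} {w}    {[]}     _             w∈ = ≤-reflexive (sym (⌊⌋≡true⇒ (w ≟ 1) w∈))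
  InBox⇒≥1 {J} {zero} {p ∷ qs} (cons pp _ ps) w∈ =
    ⊥-elim (<⇒≱ (InBox⇒≥1 ps (subst (λ z → InBox qs J z ≡ true) (pFree-0 pp) (proj₂ (∧≡true⇒ w∈)))) z≤n)
  InBox⇒≥1 {J} {suc w} {p ∷ qs} _ _ = s≤s z≤n

  InBox-primeFactors : ∀ {qs} → DistinctPrimes qs → InBox qs J w ≡ true → ∀ q → Prime q → q ∣ w → q ∈ qs
  InBox-primeFactors {J} {w} {[]} _ w∈ q pq q∣w =
    ⊥-elim (<⇒≱ (prime⇒≥2 pq) (≤-reflexive (∣1⇒≡1 (subst (q ∣_) (⌊⌋≡true⇒ (w ≟ 1) w∈) q∣w))))
  InBox-primeFactors {J} {w} {p ∷ qs} ps@(cons pp _ ps′) w∈ q pq q∣w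
    with euclidsLemma (p ^ ν p w) (pFree p w) pq (subst (q ∣_) (sym (p^ν*pFree≡n pp (InBox⇒≥1 ps w∈))) q∣w)
  ... | inj₁ q∣p^ν    = here (prime∣prime⇒≡ pp pq (∣p^k⇒∣p {k = ν p w} pq q∣p^ν))
  ... | inj₂ q∣pFree = there (InBox-primeFactors ps′ (proj₂ (∧≡true⇒ w∈)) q pq q∣pFree)

  InBox-ν≤ : ∀ {qs} → DistinctPrimes qs → InBox qs J w ≡ true → ∀ q → q ∈ qs → ν q w ≤ J
  InBox-ν≤ {J} {w} {p ∷ qs} _ w∈ q (here refl) = ⌊⌋≡true⇒ (ν q w ≤? J) (proj₁ (∧≡true⇒ w∈))
  InBox-ν≤ {J} {w} {p ∷ qs} ps@(cons pp p∉qs ps′) w∈ q (there q∈) =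
    subst (_≤ J) (ν-pFree pp (∈-prime ps′ q∈) (λ { refl → p∉qs q∈ }) (InBox⇒≥1 ps w∈))
          (InBox-ν≤ ps′ (proj₂ (∧≡true⇒ w∈)) q q∈)

  InBox-intro : ∀ {qs} → DistinctPrimes qs → 1 ≤ w → (∀ q → Prime q → q ∣ w → q ∈ qs) →
                (∀ q → q ∈ qs → ν q w ≤ J) → InBox qs J w ≡ true
  InBox-intro {w} {J} {[]} _ w≥1 factors _ = ⌊⌋≡true (w ≟ 1) (≤-antisym w≤1 w≥1)
    where
    w≤1 : w ≤ 1
    w≤1 = ≮⇒≥ λ 1<w → let (q , pq , q∣w) = ∃prime∣ 1<w in ∉[] (factors q pq q∣w)
      where
      ∉[] : ∀ {q : ℕ} → q ∈ [] → ⊥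
      ∉[] ()
  InBox-intro {w} {J} {p ∷ qs} (cons pp p∉qs ps) w≥1 factors ν≤J =
    cong₂ _∧_ (⌊⌋≡true (ν p w ≤? J) (ν≤J p (here refl)))
              (InBox-intro ps (pFree≥1 pp w≥1) factors′ ν≤J′)
    where
    factors′ : ∀ q → Prime q → q ∣ pFree p w → q ∈ qs
    factors′ q pq q∣pFree with factors q pq (∣-trans q∣pFree (pFree∣n pp w≥1))
    ... | here refl = ⊥-elim (p∤pFree pp w≥1 q∣pFree)
    ... | there q∈  = q∈
    ν≤J′ : ∀ q → q ∈ qs → ν q (pFree p w) ≤ J
    ν≤J′ q q∈ = subst (_≤ J) (sym (ν-pFree pp (∈-prime ps q∈) (λ { refl → p∉qs q∈ }) w≥1)) (ν≤J q (there q∈))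

  InBox-p^j* : ∀ {p qs j} → DistinctPrimes (p ∷ qs) → j ≤ J → InBox qs J w ≡ true → InBox (p ∷ qs) J (p ^ j * w) ≡ true
  InBox-p^j* {J} {w} {p} {qs} {j} (cons pp p∉qs ps) j≤J w∈ =
    cong₂ _∧_ (trans (cong (λ e → ⌊ e ≤? J ⌋) (ν[p^k*w]≡k pp w≥1 p∤w)) (⌊⌋≡true (j ≤? J) j≤J))
              (trans (cong (InBox qs J) (pFree[p^k*w]≡w {k = j} pp w≥1 p∤w)) w∈)
    where
    w≥1 = InBox⇒≥1 ps w∈
    p∤w = λ p∣w → p∉qs (InBox-primeFactors ps w∈ p pp p∣w)

  InBox-prime-p∤ : ∀ {p qs} → DistinctPrimes (p ∷ qs) → InBox qs J w ≡ true → ¬ (p ∣ w)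
  InBox-prime-p∤ (cons pp p∉qs ps) w∈ p∣w = p∉qs (InBox-primeFactors ps w∈ _ pp p∣w)

  InBox⇒≤boxBound : ∀ {qs} → DistinctPrimes qs → InBox qs J w ≡ true → w ≤ boxBound qs J
  InBox⇒≤boxBound {J} {w} {[]} _ w∈ = ≤-reflexive (⌊⌋≡true⇒ (w ≟ 1) w∈)
  InBox⇒≤boxBound {J} {w} {p ∷ qs} ps@(cons pp _ ps′) w∈ = begin
      w                       ≡⟨ sym (p^ν*pFree≡n pp (InBox⇒≥1 ps w∈)) ⟩
      p ^ ν p w * pFree p w   ≤⟨ *-mono-≤ (^-monoʳ-≤ p (⌊⌋≡true⇒ (ν p w ≤? J) (proj₁ (∧≡true⇒ w∈))))
                                          (InBox⇒≤boxBound ps′ (proj₂ (∧≡true⇒ w∈))) ⟩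
      p ^ J * boxBound qs J   ∎
    where
    open ≤-Reasoning
    instance _ = prime⇒nonZero pp

  boxSum-cong-≗ : ∀ qs J {f g : ℕ → ℚ} → (∀ w → f w ≡ g w) → boxSum qs J f ≡ boxSum qs J g
  boxSum-cong-≗ []       J f≗g = f≗g 1
  boxSum-cong-≗ (p ∷ qs) J f≗g = Σ<-cong (suc J) (λ j _ → boxSum-cong-≗ qs J (λ w → f≗g (p ^ j * w)))

  boxSum-cong : ∀ {qs} J {f g : ℕ → ℚ} → DistinctPrimes qs →
                (∀ w → InBox qs J w ≡ true → f w ≡ g w) → boxSum qs J f ≡ boxSum qs J g
  boxSum-cong {[]}     J _ f≡g = f≡g 1 refl
  boxSum-cong {p ∷ qs} J ps@(cons _ _ ps′) f≡g =
    Σ<-cong (suc J) (λ j j≤J → boxSum-cong J ps′ (λ w w∈ → f≡g (p ^ j * w) (InBox-p^j* ps (≤-pred j≤J) w∈)))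

  boxSum-*ˡ : ∀ qs J (c : ℚ) (f : ℕ → ℚ) → boxSum qs J (λ w → c ℚ.* f w) ≡ c ℚ.* boxSum qs J f
  boxSum-*ˡ []       J c f = refl
  boxSum-*ˡ (p ∷ qs) J c f = trans (Σ<-cong (suc J) (λ j _ → boxSum-*ˡ qs J c (λ w → f (p ^ j * w))))
                                    (Σ<-*ˡ (suc J) c (λ j → boxSum qs J (λ w → f (p ^ j * w))))

  prodℚ-cong : ∀ (qs : List ℕ) {f g : ℕ → ℚ} → (∀ q → q ∈ qs → f q ≡ g q) → prodℚ (map f qs) ≡ prodℚ (map g qs)
  prodℚ-cong []       f≡g = refl
  prodℚ-cong (q ∷ qs) f≡g = cong₂ ℚ._*_ (f≡g q (here refl)) (prodℚ-cong qs (λ r r∈ → f≡g r (there r∈)))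

  boxSum-multiplicative : ∀ qs J (ℓ : ℕ → ℕ → ℚ) → DistinctPrimes qs →
    boxSum qs J (λ w → prodℚ (map (λ q → ℓ q (ν q w)) qs)) ≡ prodℚ (map (λ q → Σ< (suc J) (ℓ q)) qs)
  boxSum-multiplicative []       J ℓ _ = refl
  boxSum-multiplicative (p ∷ qs) J ℓ ps@(cons pp p∉qs ps′) = begin
      Σ< (suc J) (λ j → boxSum qs J (λ w → ℓ p (ν p (p ^ j * w)) ℚ.* prodℚ (map (λ q → ℓ q (ν q (p ^ j * w))) qs)))
        ≡⟨ Σ<-cong (suc J) (λ j _ → boxSum-cong J ps′ (λ w w∈ → split-off-p j w w∈)) ⟩
      Σ< (suc J) (λ j → boxSum qs J (λ w → ℓ p j ℚ.* prodℚ (map (λ q → ℓ q (ν q w)) qs)))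
        ≡⟨ Σ<-cong (suc J) (λ j _ → trans (boxSum-*ˡ qs J (ℓ p j) _) (cong (ℓ p j ℚ.*_) (boxSum-multiplicative qs J ℓ ps′))) ⟩
      Σ< (suc J) (λ j → ℓ p j ℚ.* prodℚ (map (λ q → Σ< (suc J) (ℓ q)) qs))
        ≡⟨ Σ<-*ʳ (suc J) _ (ℓ p) ⟩
      Σ< (suc J) (ℓ p) ℚ.* prodℚ (map (λ q → Σ< (suc J) (ℓ q)) qs) ∎
    where
    open ≡-Reasoning
    split-off-p : ∀ j w → InBox qs J w ≡ true →
      ℓ p (ν p (p ^ j * w)) ℚ.* prodℚ (map (λ q → ℓ q (ν q (p ^ j * w))) qs) ≡ ℓ p j ℚ.* prodℚ (map (λ q → ℓ q (ν q w)) qs)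
    split-off-p j w w∈ = cong₂ ℚ._*_ (cong (ℓ p) (ν[p^k*w]≡k pp (InBox⇒≥1 ps′ w∈) (InBox-prime-p∤ ps w∈)))
      (prodℚ-cong qs (λ q q∈ → cong (ℓ q) (ν[p^k*w]≡ν[w] {k = j} pp (∈-prime ps′ q∈) (λ { refl → p∉qs q∈ }) (InBox⇒≥1 ps′ w∈))))

  Σ≤-δ : ∀ t X c (g : ℕ → ℚ) → 1 ≤ t → Σ≤ X (λ v → [ ⌊ v ≟ t ⌋ ∧ c ]· g v) ≡ [ ⌊ t ≤? X ⌋ ∧ c ]· g t
  Σ≤-δ (suc t) X c g _ = trans (Σ<-indicator-unique X t (λ i → ⌊ suc i ≟ suc t ⌋ ∧ c) (λ i → g (suc i)) unique)
      (cong (λ b → [ ⌊ suc t ≤? X ⌋ ∧ b ∧ c ]· g (suc t)) (⌊⌋≡true (suc t ≟ suc t) refl))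
    where
    unique : ∀ i → i < X → (⌊ suc i ≟ suc t ⌋ ∧ c) ≡ true → i ≡ t
    unique i _ i≡t = suc-injective (⌊⌋≡true⇒ (suc i ≟ suc t) (proj₁ (∧≡true⇒ i≡t)))

  Σ≤-reindex-* : ∀ k X (B : ℕ → Bool) (f : ℕ → ℚ) → 1 ≤ k →
    Σ≤ X (λ w → [ B w ]· ([ ⌊ k * w ≤? X ⌋ ]· f (k * w))) ≡ Σ≤ X (λ v → [ ⌊ k ∣? v ⌋ ∧ B (v div k) ]· f v)
  Σ≤-reindex-* k X B f k≥1 = begin
      Σ≤ X (λ w → [ B w ]· ([ ⌊ k * w ≤? X ⌋ ]· f (k * w)))
        ≡⟨ Σ<-cong X (λ i _ → as-δ (suc i) (s≤s z≤n)) ⟩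
      Σ≤ X (λ w → Σ≤ X (λ v → [ ⌊ v ≟ k * w ⌋ ∧ B w ]· f v))
        ≡⟨ Σ<-swap X X (λ i j → [ ⌊ suc j ≟ k * suc i ⌋ ∧ B (suc i) ]· f (suc j)) ⟩
      Σ≤ X (λ v → Σ≤ X (λ w → [ ⌊ v ≟ k * w ⌋ ∧ B w ]· f v))
        ≡⟨ Σ<-cong X (λ j j<X → sum-over-w (suc j) (f (suc j)) (s≤s z≤n) j<X) ⟩
      Σ≤ X (λ v → [ ⌊ k ∣? v ⌋ ∧ B (v div k) ]· f v) ∎
    where
    open ≡-Reasoning
    instance _ = >-nonZero k≥1
    as-δ : ∀ w → 1 ≤ w → [ B w ]· ([ ⌊ k * w ≤? X ⌋ ]· f (k * w)) ≡ Σ≤ X (λ v → [ ⌊ v ≟ k * w ⌋ ∧ B w ]· f v)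
    as-δ w w≥1 = trans ([b]·-∧ (B w) ⌊ k * w ≤? X ⌋ (f (k * w)))
                  (trans (cong (λ b → [ b ]· f (k * w)) (∧-comm (B w) ⌊ k * w ≤? X ⌋))
                         (sym (Σ≤-δ (k * w) X (B w) f (m*n≥1 k≥1 w≥1))))
    sum-over-w : ∀ v x → 1 ≤ v → v ≤ X → Σ≤ X (λ w → [ ⌊ v ≟ k * w ⌋ ∧ B w ]· x) ≡ [ ⌊ k ∣? v ⌋ ∧ B (v div k) ]· x
    sum-over-w v x v≥1 v≤X with k ∣? v
    ... | no k∤v = Σ<-zero X (λ i _ → cong (λ b → [ b ∧ B (suc i) ]· x)
                     (⌊⌋≡false (v ≟ k * suc i) (λ v≡ → k∤v (subst (k ∣_) (sym v≡) (m∣m*n (suc i))))))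
    ... | yes k∣v = begin
        Σ≤ X (λ w → [ ⌊ v ≟ k * w ⌋ ∧ B w ]· x)  ≡⟨ Σ<-cong X (λ i _ → cong (λ b → [ b ]· x) (v≟k*w⇔w≟m (suc i))) ⟩
        Σ≤ X (λ w → [ ⌊ w ≟ m ⌋ ∧ B m ]· x)      ≡⟨ Σ≤-δ m X (B m) (λ _ → x) m≥1 ⟩
        [ ⌊ m ≤? X ⌋ ∧ B m ]· x                   ≡⟨ cong (λ b → [ b ∧ B m ]· x) (⌊⌋≡true (m ≤? X) (≤-trans m≤v v≤X)) ⟩
        [ B m ]· x                                ≡⟨ cong (λ z → [ B z ]· x) (sym (div≡/ v k)) ⟩
        [ B (v div k) ]· x                        ∎
      where
      m = v / k
      k*m≡v : k * m ≡ v
      k*m≡v = m*[n/m]≡n k∣v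
      m≥1 : 1 ≤ m
      m≥1 = n≢0⇒n>0 λ m≡0 → <⇒≱ v≥1 (≤-reflexive (trans (sym k*m≡v) (trans (cong (k *_) m≡0) (*-zeroʳ k))))
      m≤v : m ≤ v
      m≤v = subst (m ≤_) k*m≡v (m≤n*m m k)
      v≟k*w⇔w≟m : ∀ w → (⌊ v ≟ k * w ⌋ ∧ B w) ≡ (⌊ w ≟ m ⌋ ∧ B m)
      v≟k*w⇔w≟m w with w ≟ m
      ... | yes refl = cong (_∧ B m) (⌊⌋≡true (v ≟ k * m) (sym k*m≡v))
      ... | no w≢m   = cong (_∧ B w) (⌊⌋≡false (v ≟ k * w) (λ v≡k*w → w≢m (*-cancelˡ-≡ w m k (trans (sym v≡k*w) (sym k*m≡v)))))

  indicator-InBox-∷ : ∀ {p qs} J (x : ℚ) → DistinctPrimes (p ∷ qs) → 1 ≤ v →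
    Σ< (suc J) (λ j → [ ⌊ p ^ j ∣? v ⌋ ∧ InBox qs J (v div (p ^ j)) ]· x) ≡ [ InBox (p ∷ qs) J v ]· x
  indicator-InBox-∷ {v} {p} {qs} J x ps@(cons pp p∉qs ps′) v≥1 =
    trans (Σ<-indicator-unique (suc J) (ν p v) (λ j → ⌊ p ^ j ∣? v ⌋ ∧ InBox qs J (v div (p ^ j))) (λ _ → x) only-ν)
          (cong (λ b → [ b ]· x) (cong₂ _∧_ ν<1+J⇔ν≤J
                (cong (_∧ InBox qs J (pFree p v)) (⌊⌋≡true (p ^ ν p v ∣? v) (p^ν∣n pp v≥1)))))
    where
    instance _ = prime⇒nonZero pp
    ν<1+J⇔ν≤J : ⌊ ν p v <? suc J ⌋ ≡ ⌊ ν p v ≤? J ⌋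
    ν<1+J⇔ν≤J = ⌊⌋-cong (ν p v <? suc J) (ν p v ≤? J) ≤-pred s≤s
    only-ν : ∀ j → j < suc J → (⌊ p ^ j ∣? v ⌋ ∧ InBox qs J (v div (p ^ j))) ≡ true → j ≡ ν p v
    only-ν j _ j-ok = ≤-antisym j≤ν (≮⇒≥ j≮ν)
      where
      instance _ = m^n≢0 p j
      p^j∣v = ⌊⌋≡true⇒ (p ^ j ∣? v) (proj₁ (∧≡true⇒ j-ok))
      j≤ν = pow∣⇒≤ν pp v≥1 p^j∣v
      j≮ν : ¬ (j < ν p v)
      j≮ν j<ν = InBox-prime-p∤ ps (proj₂ (∧≡true⇒ j-ok)) (subst (p ∣_) (sym (div≡/ v (p ^ j)))
        (*-cancelˡ-∣ (p ^ j) (subst₂ _∣_ (*-comm p (p ^ j)) (sym (m*[n/m]≡n p^j∣v)) (≤ν⇒pow∣ pp v≥1 j<ν))))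

  Σ≤-InBox≡boxSum : ∀ qs J (f : ℕ → ℚ) X → DistinctPrimes qs →
    Σ≤ X (λ v → [ InBox qs J v ]· f v) ≡ boxSum qs J (λ w → [ ⌊ w ≤? X ⌋ ]· f w)
  Σ≤-InBox≡boxSum [] J f X _ =
    trans (Σ<-cong X (λ i _ → cong (λ b → [ b ]· f (suc i)) (sym (∧-identityʳ ⌊ suc i ≟ 1 ⌋))))
          (trans (Σ≤-δ 1 X true f (s≤s z≤n)) (cong (λ b → [ b ]· f 1) (∧-identityʳ ⌊ 1 ≤? X ⌋)))
  Σ≤-InBox≡boxSum (p ∷ qs) J f X ps@(cons pp p∉qs ps′) = begin
      Σ≤ X (λ v → [ InBox (p ∷ qs) J v ]· f v)
        ≡⟨ Σ<-cong X (λ i _ → sym (indicator-InBox-∷ J (f (suc i)) ps (s≤s z≤n))) ⟩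
      Σ≤ X (λ v → Σ< (suc J) (λ j → [ ⌊ p ^ j ∣? v ⌋ ∧ InBox qs J (v div (p ^ j)) ]· f v))
        ≡⟨ Σ<-swap X (suc J) (λ i j → [ ⌊ p ^ j ∣? suc i ⌋ ∧ InBox qs J (suc i div (p ^ j)) ]· f (suc i)) ⟩
      Σ< (suc J) (λ j → Σ≤ X (λ v → [ ⌊ p ^ j ∣? v ⌋ ∧ InBox qs J (v div (p ^ j)) ]· f v))
        ≡⟨ Σ<-cong (suc J) (λ j _ → sym (Σ≤-reindex-* (p ^ j) X (InBox qs J) f (m^n>0 p j))) ⟩
      Σ< (suc J) (λ j → Σ≤ X (λ w → [ InBox qs J w ]· ([ ⌊ p ^ j * w ≤? X ⌋ ]· f (p ^ j * w))))
        ≡⟨ Σ<-cong (suc J) (λ j _ → Σ≤-InBox≡boxSum qs J (λ w → [ ⌊ p ^ j * w ≤? X ⌋ ]· f (p ^ j * w)) X ps′) ⟩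
      Σ< (suc J) (λ j → boxSum qs J (λ w → [ ⌊ w ≤? X ⌋ ]· ([ ⌊ p ^ j * w ≤? X ⌋ ]· f (p ^ j * w))))
        ≡⟨ Σ<-cong (suc J) (λ j _ → boxSum-cong-≗ qs J (λ w → drop-w≤X j w)) ⟩
      Σ< (suc J) (λ j → boxSum qs J (λ w → [ ⌊ p ^ j * w ≤? X ⌋ ]· f (p ^ j * w))) ∎
    where
    open ≡-Reasoning
    instance _ = prime⇒nonZero pp
    drop-w≤X : ∀ j w → [ ⌊ w ≤? X ⌋ ]· ([ ⌊ p ^ j * w ≤? X ⌋ ]· f (p ^ j * w)) ≡ [ ⌊ p ^ j * w ≤? X ⌋ ]· f (p ^ j * w)
    drop-w≤X j w with w ≤? X | p ^ j * w ≤? X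
    ... | yes _   | _         = refl
    ... | no _    | no _      = refl
    ... | no w≰X  | yes pw≤X  = ⊥-elim (w≰X (≤-trans (m≤n*m w (p ^ j) {{m^n≢0 p j}}) pw≤X))


module Embedding where

  open import Data.Nat as ℕ using (ℕ; zero; suc; _≤_)
  import Data.Nat.Properties as ℕP
  open import Data.Integer as ℤ using (ℤ; +_)
  import Data.Integer.Properties as ℤP
  open import Data.Rational as ℚ using (ℚ; 1ℚ; _+_; _*_; -_; _/_; toℚᵘ)
  open import Data.Rational.Properties
  open import Data.Rational.Unnormalised as ℚᵘ using (ℚᵘ; mkℚᵘ; *≡*)
  import Data.Rational.Unnormalised.Properties as ℚᵘP
  open import Data.Rational.Solver using (module +-*-Solver)
  open import Relation.Binary.PropositionalEquality
  open import Defs using (_//_; _^ℚ_)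

  fromℕ : ℕ → ℚ
  fromℕ n = + n / 1

  fromℤ : ℤ → ℚ
  fromℤ z = z / 1

  recip : ℕ → ℚ
  recip n = (+ 1) // n

  private
    infixr 10 _▹_
    _▹_ : ∀ {a b c : ℚᵘ} → a ℚᵘ.≃ b → b ℚᵘ.≃ c → a ℚᵘ.≃ c
    _▹_ = ℚᵘP.≃-trans

  normalise-/ : ∀ z m → toℚᵘ (z / suc m) ℚᵘ.≃ mkℚᵘ z m
  normalise-/ z m = toℚᵘ-fromℚᵘ (mkℚᵘ z m)

  fromℤ-* : ∀ a b → fromℤ (a ℤ.* b) ≡ fromℤ a * fromℤ b
  fromℤ-* a b = toℚᵘ-injective (normalise-/ (a ℤ.* b) 0 ▹ *≡* refl ▹
    ℚᵘP.≃-sym (toℚᵘ-homo-* (fromℤ a) (fromℤ b) ▹ ℚᵘP.*-cong (normalise-/ a 0) (normalise-/ b 0)))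

  fromℤ-+ : ∀ a b → fromℤ (a ℤ.+ b) ≡ fromℤ a + fromℤ b
  fromℤ-+ a b = toℚᵘ-injective (normalise-/ (a ℤ.+ b) 0 ▹ *≡* a+b≡ ▹
    ℚᵘP.≃-sym (toℚᵘ-homo-+ (fromℤ a) (fromℤ b) ▹ ℚᵘP.+-cong (normalise-/ a 0) (normalise-/ b 0)))
    where
    a+b≡ : (a ℤ.+ b) ℤ.* + 1 ≡ (a ℤ.* + 1 ℤ.+ b ℤ.* + 1) ℤ.* + 1
    a+b≡ = cong (ℤ._* + 1) (cong₂ ℤ._+_ (sym (ℤP.*-identityʳ a)) (sym (ℤP.*-identityʳ b)))

  fromℤ-neg : ∀ a → fromℤ (ℤ.- a) ≡ - fromℤ a
  fromℤ-neg a = toℚᵘ-injective (normalise-/ (ℤ.- a) 0 ▹ ℚᵘP.≃-sym (toℚᵘ-homo‿- (fromℤ a) ▹ ℚᵘP.-‿cong (normalise-/ a 0)))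

  fromℕ-* : ∀ m n → fromℕ (m ℕ.* n) ≡ fromℕ m * fromℕ n
  fromℕ-* m n = trans (cong fromℤ (ℤP.pos-* m n)) (fromℤ-* (+ m) (+ n))

  fromℕ-+ : ∀ m n → fromℕ (m ℕ.+ n) ≡ fromℕ m + fromℕ n
  fromℕ-+ m n = fromℤ-+ (+ m) (+ n)

  fromℕ-^ : ∀ p k → fromℕ (p ℕ.^ k) ≡ fromℕ p ^ℚ k
  fromℕ-^ p zero    = refl
  fromℕ-^ p (suc k) = trans (fromℕ-* p (p ℕ.^ k)) (cong (fromℕ p *_) (fromℕ-^ p k))

  fromℕ-injective : ∀ {a b} → fromℕ a ≡ fromℕ b → a ≡ b
  fromℕ-injective {a} {b} a≡b with ℚᵘP.≃-sym (normalise-/ (+ a) 0) ▹ toℚᵘ-cong a≡b ▹ normalise-/ (+ b) 0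
  ... | *≡* a*1≡b*1 = ℤP.+-injective (trans (sym (ℤP.*-identityʳ (+ a))) (trans a*1≡b*1 (ℤP.*-identityʳ (+ b))))

  [z//n]*n≡z : ∀ z {n} → 1 ≤ n → (z // n) * fromℕ n ≡ fromℤ z
  [z//n]*n≡z z {suc m} _ = toℚᵘ-injective (toℚᵘ-homo-* (z / suc m) (fromℕ (suc m)) ▹
      ℚᵘP.*-cong (normalise-/ z m) (normalise-/ (+ suc m) 0) ▹ *≡* z*n≡ ▹ ℚᵘP.≃-sym (normalise-/ z 0))
    where
    z*n≡ : (z ℤ.* + suc m) ℤ.* + 1 ≡ z ℤ.* (+ (suc m ℕ.* 1))
    z*n≡ = trans (ℤP.*-identityʳ _) (cong (z ℤ.*_) (cong +_ (sym (ℕP.*-identityʳ (suc m)))))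

  n*recip[n]≡1 : ∀ {n} → 1 ≤ n → fromℕ n * recip n ≡ 1ℚ
  n*recip[n]≡1 {n} n≥1 = trans (*-comm (fromℕ n) (recip n)) ([z//n]*n≡z (+ 1) n≥1)

  x*n≡z⇒x≡z//n : ∀ x z {n} → 1 ≤ n → x * fromℕ n ≡ fromℤ z → x ≡ z // n
  x*n≡z⇒x≡z//n x z {n} n≥1 x*n≡z = begin
      x                                ≡⟨ sym (*-identityʳ x) ⟩
      x * 1ℚ                           ≡⟨ cong (x *_) (sym (n*recip[n]≡1 n≥1)) ⟩
      x * (fromℕ n * recip n)          ≡⟨ sym (*-assoc x _ _) ⟩
      (x * fromℕ n) * recip n          ≡⟨ cong (_* recip n) (trans x*n≡z (sym ([z//n]*n≡z z n≥1))) ⟩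
      ((z // n) * fromℕ n) * recip n   ≡⟨ *-assoc (z // n) _ _ ⟩
      (z // n) * (fromℕ n * recip n)   ≡⟨ cong ((z // n) *_) (n*recip[n]≡1 n≥1) ⟩
      (z // n) * 1ℚ                    ≡⟨ *-identityʳ (z // n) ⟩
      z // n                           ∎
    where open ≡-Reasoning

  z//n≡z*recip[n] : ∀ z {n} → 1 ≤ n → z // n ≡ fromℤ z * recip n
  z//n≡z*recip[n] z {n} n≥1 = sym (x*n≡z⇒x≡z//n (fromℤ z * recip n) z n≥1
    (trans (*-assoc (fromℤ z) _ _) (trans (cong (fromℤ z *_) (trans (*-comm (recip n) _) (n*recip[n]≡1 n≥1))) (*-identityʳ _))))

  recip-* : ∀ {m n} → 1 ≤ m → 1 ≤ n → recip (m ℕ.* n) ≡ recip m * recip n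
  recip-* {m} {n} m≥1 n≥1 = sym (x*n≡z⇒x≡z//n (recip m * recip n) (+ 1) (ℕP.*-mono-≤ m≥1 n≥1) (begin
      recip m * recip n * fromℕ (m ℕ.* n)                ≡⟨ cong (recip m * recip n *_) (fromℕ-* m n) ⟩
      recip m * recip n * (fromℕ m * fromℕ n)            ≡⟨ regroup (recip m) (recip n) (fromℕ m) (fromℕ n) ⟩
      (fromℕ m * recip m) * (fromℕ n * recip n)          ≡⟨ cong₂ _*_ (n*recip[n]≡1 m≥1) (n*recip[n]≡1 n≥1) ⟩
      1ℚ                                                 ∎))
    where
    open ≡-Reasoning
    open +-*-Solver
    regroup : ∀ a b c d → a * b * (c * d) ≡ (c * a) * (d * b)
    regroup = solve 4 (λ a b c d → a :* b :* (c :* d) := (c :* a) :* (d :* b)) refl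

  recip-^ : ∀ {p} k → 1 ≤ p → recip (p ℕ.^ k) ≡ recip p ^ℚ k
  recip-^ zero    p≥1 = refl
  recip-^ {p} (suc k) p≥1 = let instance _ = ℕ.>-nonZero p≥1 in
    trans (recip-* p≥1 (ℕP.m^n>0 p k)) (cong (recip p *_) (recip-^ k p≥1))


module Divisors where

  open import Data.Bool using (Bool; true; _∧_; _∨_; not)
  open import Data.Nat as ℕ using (ℕ; zero; suc; _≤_; z≤n; s≤s; _^_; _*_; >-nonZero; _⊓_; _≟_; _≤?_)
  open import Data.Nat.Properties
  open import Data.Nat.Divisibility
  open import Data.Nat.Primality
  open import Data.Nat.Coprimality using (Coprime; coprime-divisor)
  open import Data.Nat.GCD using (gcd; gcd[m,n]∣m; gcd[m,n]∣n; gcd-greatest; gcd[m,n]≡0⇒m≡0)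
  import Data.Rational.Properties as ℚP
  open import Data.List using (List; []; _∷_; map)
  import Data.List.Properties as LP
  open import Data.List.Membership.Propositional using (_∈_)
  open import Data.List.Membership.Propositional.Properties using (∈-filter⁺; ∈-filter⁻; ∈-map⁺; ∈-map⁻; ∈-upTo⁺; ∈-upTo⁻)
  open import Data.List.Relation.Unary.Any using (here; there)
  open import Data.List.Relation.Unary.All using (All; []; _∷_)
  open import Data.List.Relation.Unary.AllPairs using ([]; _∷_)
  open import Data.List.Relation.Unary.Unique.Propositional using (Unique)
  import Data.List.Relation.Unary.Unique.Propositional.Properties as Unique
  open import Data.Product using (_×_; _,_; proj₁; proj₂)
  open import Data.Empty using (⊥-elim)
  open import Relation.Nullary using (yes; no; ¬_)
  open import Relation.Nullary.Decidable using (⌊_⌋; _×-dec_)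
  open import Relation.Binary.PropositionalEquality hiding (J)
  open import Defs
  open Booleans
  open Valuation
  open Box

  private variable J w v d α : ℕ

  ∈-range1⁻ : ∀ {x n} → x ∈ range1 n → 1 ≤ x × x ≤ n
  ∈-range1⁻ x∈ with ∈-map⁻ suc x∈
  ... | i , i∈ , refl = s≤s z≤n , ∈-upTo⁻ i∈

  ∈-range1⁺ : ∀ {x n} → 1 ≤ x → x ≤ n → x ∈ range1 n
  ∈-range1⁺ {suc x} _ x≤n = ∈-map⁺ suc (∈-upTo⁺ x≤n)

  ∈-primeDivisors⁻ : ∀ {p d} → p ∈ primeDivisors d → Prime p × p ∣ d
  ∈-primeDivisors⁻ {p} {d} p∈ = proj₂ (∈-filter⁻ (λ p → prime? p ×-dec p ∣? d) {xs = range1 d} p∈)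

  ∈-primeDivisors⁺ : ∀ {p d} → 1 ≤ d → Prime p → p ∣ d → p ∈ primeDivisors d
  ∈-primeDivisors⁺ {p} {d} d≥1 pp p∣d = ∈-filter⁺ (λ p → prime? p ×-dec p ∣? d)
    (∈-range1⁺ (≤-trans (s≤s z≤n) (prime⇒≥2 pp)) (∣⇒≤ {{>-nonZero d≥1}} p∣d)) (pp , p∣d)

  primeDivisors-distinct : ∀ d → DistinctPrimes (primeDivisors d)
  primeDivisors-distinct d = fromUnique _ (Unique.filter⁺ (λ p → prime? p ×-dec p ∣? d) (Unique.map⁺ suc-injective (Unique.upTo⁺ d)))
                                          (λ x x∈ → proj₁ (∈-primeDivisors⁻ {x} {d} x∈))
    where
    ∉-from-All≢ : ∀ {x : ℕ} {xs} → All (λ y → ¬ x ≡ y) xs → ¬ (x ∈ xs)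
    ∉-from-All≢ (x≢y ∷ _) (here x≡y) = x≢y x≡y
    ∉-from-All≢ (_ ∷ x≢ys) (there x∈) = ∉-from-All≢ x≢ys x∈
    fromUnique : ∀ (xs : List ℕ) → Unique xs → (∀ x → x ∈ xs → Prime x) → DistinctPrimes xs
    fromUnique []       _                 _      = []
    fromUnique (x ∷ xs) (x∉xs ∷ unique) primes =
      cons (primes x (here refl)) (∉-from-All≢ x∉xs) (fromUnique xs unique (λ y y∈ → primes y (there y∈)))

  allB≡true⇒ : ∀ {A : Set} (f : A → Bool) xs → allB f xs ≡ true → ∀ x → x ∈ xs → f x ≡ true
  allB≡true⇒ f (y ∷ ys) all x (here refl) = proj₁ (∧≡true⇒ all)
  allB≡true⇒ f (y ∷ ys) all x (there x∈) = allB≡true⇒ f ys (proj₂ (∧≡true⇒ all)) x x∈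

  allB≡true⇐ : ∀ {A : Set} (f : A → Bool) xs → (∀ x → x ∈ xs → f x ≡ true) → allB f xs ≡ true
  allB≡true⇐ f []       _   = refl
  allB≡true⇐ f (y ∷ ys) all = cong₂ _∧_ (all y (here refl)) (allB≡true⇐ f ys (λ x x∈ → all x (there x∈)))

  dInf≡true⇒ : dInf d v ≡ true → 1 ≤ v × (∀ q → Prime q → q ∣ v → q ∣ d)
  dInf≡true⇒ {d} {suc n} v∣d^∞ = s≤s z≤n , prime-factors-divide
    where
    prime-factors-divide : ∀ q → Prime q → q ∣ suc n → q ∣ d
    prime-factors-divide q pq q∣v
      with allB≡true⇒ (λ p → not ⌊ prime? p ×-dec p ∣? suc n ⌋ ∨ ⌊ p ∣? d ⌋) (range1 (suc n)) v∣d^∞ q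
                      (∈-range1⁺ (≤-trans (s≤s z≤n) (prime⇒≥2 pq)) (∣⇒≤ q∣v))
    ... | q-ok with prime? q ×-dec q ∣? suc n | q ∣? d
    ... | yes _ | yes q∣d = q∣d
    ... | no ¬q | _       = ⊥-elim (¬q (pq , q∣v))

  dInf≡true⇐ : 1 ≤ v → (∀ q → Prime q → q ∣ v → q ∣ d) → dInf d v ≡ true
  dInf≡true⇐ {suc n} {d} _ prime-factors-divide =
    allB≡true⇐ (λ p → not ⌊ prime? p ×-dec p ∣? suc n ⌋ ∨ ⌊ p ∣? d ⌋) (range1 (suc n)) q-ok
    where
    q-ok : ∀ q → q ∈ range1 (suc n) → (not ⌊ prime? q ×-dec q ∣? suc n ⌋ ∨ ⌊ q ∣? d ⌋) ≡ true
    q-ok q _ with prime? q ×-dec q ∣? suc n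
    ... | no _           = refl
    ... | yes (pq , q∣v) = ⌊⌋≡true (q ∣? d) (prime-factors-divide q pq q∣v)

  dInf≡InBox : 1 ≤ d → v ≤ J → dInf d v ≡ InBox (primeDivisors d) J v
  dInf≡InBox {d} {v} {J} d≥1 v≤J = ≡true-ext to from
    where
    ps = primeDivisors-distinct d
    to : dInf d v ≡ true → InBox (primeDivisors d) J v ≡ true
    to v∣d^∞ = let (v≥1 , factors) = dInf≡true⇒ v∣d^∞ in
      InBox-intro ps v≥1 (λ q pq q∣v → ∈-primeDivisors⁺ d≥1 pq (factors q pq q∣v))
                         (λ q q∈ → <⇒≤ (<-≤-trans (ν<n (proj₁ (∈-primeDivisors⁻ {q} {d} q∈)) v≥1) v≤J))
    from : InBox (primeDivisors d) J v ≡ true → dInf d v ≡ true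
    from v∈ = dInf≡true⇐ (InBox⇒≥1 ps v∈) (λ q pq q∣v → proj₂ (∈-primeDivisors⁻ {q} {d} (InBox-primeFactors ps v∈ q pq q∣v)))

  coprime-p^k : ∀ {p s} k → Prime p → 1 ≤ s → ¬ (p ∣ s) → Coprime (p ^ k) s
  coprime-p^k {p} {s} k pp s≥1 p∤s {i} (i∣p^k , i∣s) with i ℕ.≟ 1
  ... | yes i≡1 = i≡1
  ... | no i≢1 = ⊥-elim (p∤s (subst (_∣ s) (prime∣prime⇒≡ pp pr (∣p^k⇒∣p {k = k} pr (∣-trans r∣i i∣p^k))) (∣-trans r∣i i∣s)))
    where
    i≥1 : 1 ≤ i
    i≥1 = n≢0⇒n>0 (λ i≡0 → <⇒≱ s≥1 (≤-reflexive (0∣⇒≡0 (subst (_∣ s) i≡0 i∣s))))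
    r∣i-prime = ∃prime∣ (≤∧≢⇒< i≥1 (λ 1≡i → i≢1 (sym 1≡i)))
    r = proj₁ r∣i-prime
    pr = proj₁ (proj₂ r∣i-prime)
    r∣i = proj₂ (proj₂ r∣i-prime)

  coprime⇒*∣ : ∀ {a b d} → Coprime b a → a ∣ d → b ∣ d → a * b ∣ d
  coprime⇒*∣ {a} {b} coprime (divides k refl) b∣k*a =
    subst (a * b ∣_) (*-comm a k) (*-monoʳ-∣ a (coprime-divisor coprime (subst (b ∣_) (*-comm k a) b∣k*a)))

  InBox-1⇒∣ : ∀ {qs α d} → DistinctPrimes qs → (∀ q → q ∈ qs → q ∣ d) → InBox qs 1 α ≡ true → α ∣ d
  InBox-1⇒∣ {[]} {α} _ _ α∈ = subst (_∣ _) (sym (⌊⌋≡true⇒ (α ℕ.≟ 1) α∈)) (1∣ _)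
  InBox-1⇒∣ {p ∷ qs} {α} {d} ps@(cons pp p∉qs ps′) qs∣d α∈ =
    subst (_∣ d) (p^ν*pFree≡n pp α≥1) (coprime⇒*∣ coprime p^ν∣d s∣d)
    where
    α≥1 = InBox⇒≥1 ps α∈
    s∈ = proj₂ (∧≡true⇒ α∈)
    s∣d = InBox-1⇒∣ ps′ (λ q q∈ → qs∣d q (there q∈)) s∈
    p^ν∣d : p ^ ν p α ∣ d
    p^ν∣d with ν p α | ⌊⌋≡true⇒ (ν p α ≤? 1) (proj₁ (∧≡true⇒ α∈))
    ... | zero     | _ = 1∣ d
    ... | suc zero | _ = subst (_∣ d) (sym (*-identityʳ p)) (qs∣d p (here refl))
    ... | suc (suc _) | s≤s ()
    coprime : Coprime (pFree p α) (p ^ ν p α)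
    coprime = Data.Nat.Coprimality.sym (coprime-p^k (ν p α) pp (InBox⇒≥1 ps′ s∈) (InBox-prime-p∤ ps s∈))

  InBox-1⇒∣d : InBox (primeDivisors d) 1 α ≡ true → α ∣ d
  InBox-1⇒∣d {d} = InBox-1⇒∣ (primeDivisors-distinct d) (λ q q∈ → proj₂ (∈-primeDivisors⁻ {q} {d} q∈))

  prodℕ-cong : ∀ (qs : List ℕ) {f g : ℕ → ℕ} → (∀ q → q ∈ qs → f q ≡ g q) → prodℕ (map f qs) ≡ prodℕ (map g qs)
  prodℕ-cong []       f≡g = refl
  prodℕ-cong (q ∷ qs) f≡g = cong₂ _*_ (f≡g q (here refl)) (prodℕ-cong qs (λ r r∈ → f≡g r (there r∈)))

  InBox⇒≡∏p^ν : ∀ {qs} → DistinctPrimes qs → InBox qs J w ≡ true → w ≡ prodℕ (map (λ q → q ^ ν q w) qs)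
  InBox⇒≡∏p^ν {J} {w} {[]} _ w∈ = ⌊⌋≡true⇒ (w ℕ.≟ 1) w∈
  InBox⇒≡∏p^ν {J} {w} {p ∷ qs} ps@(cons pp p∉qs ps′) w∈ = begin
      w                                                      ≡⟨ sym (p^ν*pFree≡n pp w≥1) ⟩
      p ^ ν p w * pFree p w                                  ≡⟨ cong (p ^ ν p w *_) (InBox⇒≡∏p^ν ps′ (proj₂ (∧≡true⇒ w∈))) ⟩
      p ^ ν p w * prodℕ (map (λ q → q ^ ν q (pFree p w)) qs)  ≡⟨ cong (p ^ ν p w *_) (prodℕ-cong qs (λ q q∈ →
                                                                   cong (q ^_) (ν-pFree pp (∈-prime ps′ q∈) (λ { refl → p∉qs q∈ }) w≥1))) ⟩
      p ^ ν p w * prodℕ (map (λ q → q ^ ν q w) qs)            ∎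
    where
    open ≡-Reasoning
    w≥1 = InBox⇒≥1 ps w∈

  gcd≥1 : ∀ {n h} → 1 ≤ n → 1 ≤ gcd n h
  gcd≥1 {n} {h} n≥1 = n≢0⇒n>0 (λ gcd≡0 → <⇒≱ n≥1 (≤-reflexive (gcd[m,n]≡0⇒m≡0 gcd≡0)))

  gcd≡∏p^min : ∀ {qs J n h} → DistinctPrimes qs → InBox qs J n ≡ true → 1 ≤ h →
    gcd n h ≡ prodℕ (map (λ q → q ^ (ν q n ⊓ ν q h)) qs)
  gcd≡∏p^min {qs} {J} {n} {h} ps n∈ h≥1 =
    trans (InBox⇒≡∏p^ν ps gcd∈) (prodℕ-cong qs (λ q q∈ → cong (q ^_) (ν-gcd q (∈-prime ps q∈))))
    where
    n≥1 = InBox⇒≥1 ps n∈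
    G = gcd n h
    G≥1 = gcd≥1 {n} {h} n≥1
    gcd∈ : InBox qs J G ≡ true
    gcd∈ = InBox-intro ps G≥1 (λ q pq q∣G → InBox-primeFactors ps n∈ q pq (∣-trans q∣G (gcd[m,n]∣m n h)))
             (λ q q∈ → ≤-trans (ν-mono-∣ (∈-prime ps q∈) G≥1 n≥1 (gcd[m,n]∣m n h)) (InBox-ν≤ ps n∈ q q∈))
    ν-gcd : ∀ q → Prime q → ν q G ≡ ν q n ⊓ ν q h
    ν-gcd q pq = ≤-antisym (⊓-glb (ν-mono-∣ pq G≥1 n≥1 (gcd[m,n]∣m n h)) (ν-mono-∣ pq G≥1 h≥1 (gcd[m,n]∣n n h)))
       (pow∣⇒≤ν pq G≥1 (gcd-greatest (≤ν⇒pow∣ pq n≥1 (m⊓n≤m (ν q n) (ν q h))) (≤ν⇒pow∣ pq h≥1 (m⊓n≤n (ν q n) (ν q h)))))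


module Mobius where

  open import Data.Bool using (true; false; not)
  open import Data.Nat as ℕ using (ℕ; zero; suc; _≤_; _<_; z≤n; s≤s; _^_; _*_; _+_; _∸_; >-nonZero; _≤?_)
  open import Data.Nat.Properties
  open import Data.Nat.Divisibility
  open import Data.Nat.Primality
  open import Data.Integer as ℤ using (ℤ; +_)
  open import Data.Rational as ℚ using (ℚ; 0ℚ; 1ℚ)
  import Data.Rational.Properties as ℚP
  open import Data.List using (List; []; _∷_; map; filter; length; upTo; _++_)
  import Data.List.Properties as LP
  open import Data.List.Membership.Propositional using (_∈_)
  open import Data.List.Membership.Propositional.Properties using (∈-filter⁺; ∈-filter⁻)
  open import Data.List.Relation.Unary.Any using (here; there)
  open import Data.Product using (_×_; _,_; proj₁; proj₂)
  open import Data.Empty using (⊥-elim)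
  open import Relation.Nullary using (yes; no; ¬_)
  open import Relation.Nullary.Decidable using (⌊_⌋; _×-dec_; ¬?)
  open import Relation.Unary using (Decidable)
  open import Relation.Binary.PropositionalEquality hiding (J)
  open import Defs
  open Booleans
  open FiniteSums
  open Valuation
  open Box
  open Embedding
  open Divisors

  private variable d α : ℕ

  -1ℚ : ℚ
  -1ℚ = ℚ.- 1ℚ

  private
    nontrivial : ℕ → List ℕ
    nontrivial n = filter (λ k → ¬? (k ℕ.≟ 1)) (range1 n)

  squarefreeB⇒ν≤1 : ∀ {q} → 1 ≤ α → squarefreeB α ≡ true → Prime q → ν q α ≤ 1
  squarefreeB⇒ν≤1 {α} {q} α≥1 sqf pq = ≮⇒≥ λ 1<ν → true≢false (trans (sym (allB≡true⇒ _ (nontrivial α) sqf q (q∈ 1<ν)))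
                                                               (cong not (⌊⌋≡true ((q * q) ∣? α) (q²∣α 1<ν))))
    where
    true≢false : ¬ (true ≡ false)
    true≢false ()
    q²∣α : 1 < ν q α → q * q ∣ α
    q²∣α 1<ν = subst (_∣ α) (cong (q *_) (*-identityʳ q)) (≤ν⇒pow∣ {k = 2} pq α≥1 1<ν)
    q∈ : 1 < ν q α → q ∈ nontrivial α
    q∈ 1<ν = ∈-filter⁺ (λ k → ¬? (k ℕ.≟ 1))
      (∈-range1⁺ (≤-trans (s≤s z≤n) (prime⇒≥2 pq)) (≤-trans (m≤m*n q q {{prime⇒nonZero pq}}) (∣⇒≤ {{>-nonZero α≥1}} (q²∣α 1<ν))))
      (λ q≡1 → <⇒≢ (prime⇒≥2 pq) (sym q≡1))

  squarefree-divisor⇒InBox : 1 ≤ d → 1 ≤ α → α ∣ d → squarefreeB α ≡ true → InBox (primeDivisors d) 1 α ≡ true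
  squarefree-divisor⇒InBox {d} {α} d≥1 α≥1 α∣d sqf = InBox-intro (primeDivisors-distinct d) α≥1
    (λ q pq q∣α → ∈-primeDivisors⁺ d≥1 pq (∣-trans q∣α α∣d))
    (λ q q∈ → squarefreeB⇒ν≤1 α≥1 sqf (proj₁ (∈-primeDivisors⁻ {q} {d} q∈)))

  InBox-1⇒squarefreeB : ∀ {qs} → DistinctPrimes qs → InBox qs 1 α ≡ true → squarefreeB α ≡ true
  InBox-1⇒squarefreeB {α} {qs} ps α∈ = allB≡true⇐ _ (nontrivial α) λ k k∈ → cong not (⌊⌋≡false ((k * k) ∣? α) (k²∤α k k∈))
    where
    α≥1 = InBox⇒≥1 ps α∈
    k²∤α : ∀ k → k ∈ nontrivial α → ¬ (k * k ∣ α)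
    k²∤α k k∈ k²∣α = <⇒≱ (s≤s (s≤s z≤n)) (≤-trans (pow∣⇒≤ν {k = 2} pr α≥1 r²∣α)
                                            (InBox-ν≤ ps α∈ r (InBox-primeFactors ps α∈ r pr (∣-trans r∣k (∣-trans (m∣m*n k) k²∣α)))))
      where
      k∈′ = ∈-filter⁻ (λ k → ¬? (k ℕ.≟ 1)) {xs = range1 α} k∈
      k≥2 : 2 ≤ k
      k≥2 = ≤∧≢⇒< (proj₁ (∈-range1⁻ (proj₁ k∈′))) (λ 1≡k → proj₂ k∈′ (sym 1≡k))
      r∣k-prime = ∃prime∣ k≥2
      r = proj₁ r∣k-prime
      pr = proj₁ (proj₂ r∣k-prime)
      r∣k = proj₂ (proj₂ r∣k-prime)
      r²∣α : r ^ 2 ∣ α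
      r²∣α = ∣-trans (subst (_∣ k * k) (cong (r *_) (sym (*-identityʳ r))) (*-pres-∣ r∣k r∣k)) k²∣α

  μ≡0-outside-box : 1 ≤ d → α ∣ d → InBox (primeDivisors d) 1 α ≡ false → μ α ≡ + 0
  μ≡0-outside-box {d} {zero}  _ _ _ = refl
  μ≡0-outside-box {d} {suc n} d≥1 α∣d α∉ with squarefreeB (suc n) in sqf
  ... | false = refl
  ... | true  with () ← trans (sym α∉) (squarefree-divisor⇒InBox d≥1 (s≤s z≤n) α∣d sqf)

  filter-filter : ∀ {P Q : ℕ → Set} (P? : Decidable P) (Q? : Decidable Q) xs →
    filter Q? (filter P? xs) ≡ filter (λ x → P? x ×-dec Q? x) xs
  filter-filter P? Q? [] = refl
  filter-filter P? Q? (x ∷ xs) with P? x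
  ... | no _  = filter-filter P? Q? xs
  ... | yes _ with Q? x
  ...   | yes _ = cong (x ∷_) (filter-filter P? Q? xs)
  ...   | no _  = filter-filter P? Q? xs

  range1-suc : ∀ n → range1 (suc n) ≡ range1 n ++ (suc n ∷ [])
  range1-suc n = trans (cong (map suc) (sym (LP.upTo-∷ʳ n))) (LP.map-++ suc (upTo n) (n ∷ []))

  filter-range1-+ : ∀ {R : ℕ → Set} (R? : Decidable R) n k → (∀ x → n < x → ¬ R x) →
    filter R? (range1 (n + k)) ≡ filter R? (range1 n)
  filter-range1-+ R? n zero _ = cong (λ m → filter R? (range1 m)) (+-identityʳ n)
  filter-range1-+ R? n (suc k) ¬R = begin
      filter R? (range1 (n + suc k))
        ≡⟨ cong (λ m → filter R? (range1 m)) (+-suc n k) ⟩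
      filter R? (range1 (suc (n + k)))
        ≡⟨ cong (filter R?) (range1-suc (n + k)) ⟩
      filter R? (range1 (n + k) ++ (suc (n + k) ∷ []))
        ≡⟨ LP.filter-++ R? (range1 (n + k)) _ ⟩
      filter R? (range1 (n + k)) ++ filter R? (suc (n + k) ∷ [])
        ≡⟨ cong (filter R? (range1 (n + k)) ++_) (LP.filter-reject R? (¬R _ (s≤s (m≤m+n n k)))) ⟩
      filter R? (range1 (n + k)) ++ []
        ≡⟨ LP.++-identityʳ _ ⟩
      filter R? (range1 (n + k))
        ≡⟨ filter-range1-+ R? n k ¬R ⟩
      filter R? (range1 n) ∎
    where open ≡-Reasoning

  primeDivisors-∣ : 1 ≤ α → α ∣ d → 1 ≤ d → primeDivisors α ≡ filter (λ p → p ∣? α) (primeDivisors d)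
  primeDivisors-∣ {α} {d} α≥1 α∣d d≥1 = sym (begin
      filter (λ p → p ∣? α) (filter (λ p → prime? p ×-dec p ∣? d) (range1 d))
        ≡⟨ filter-filter (λ p → prime? p ×-dec p ∣? d) (λ p → p ∣? α) (range1 d) ⟩
      filter (λ p → (prime? p ×-dec p ∣? d) ×-dec p ∣? α) (range1 d)
        ≡⟨ LP.filter-≐ _ (λ p → prime? p ×-dec p ∣? α) ((λ ((pp , _) , p∣α) → pp , p∣α) , (λ (pp , p∣α) → (pp , ∣-trans p∣α α∣d) , p∣α)) (range1 d) ⟩
      filter (λ p → prime? p ×-dec p ∣? α) (range1 d)
        ≡⟨ cong (λ m → filter (λ p → prime? p ×-dec p ∣? α) (range1 m)) (sym (m+[n∸m]≡n α≤d)) ⟩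
      filter (λ p → prime? p ×-dec p ∣? α) (range1 (α + (d ∸ α)))
        ≡⟨ filter-range1-+ (λ p → prime? p ×-dec p ∣? α) α (d ∸ α) (λ x α<x (_ , x∣α) → <⇒≱ α<x (∣⇒≤ {{>-nonZero α≥1}} x∣α)) ⟩
      filter (λ p → prime? p ×-dec p ∣? α) (range1 α) ∎)
    where
    open ≡-Reasoning
    α≤d = ∣⇒≤ {{>-nonZero d≥1}} α∣d

  [-1]^count≡∏[-1]^ν : ∀ qs → 1 ≤ α → (∀ q → q ∈ qs → Prime q × ν q α ≤ 1) →
    fromℤ ((ℤ.- (+ 1)) ℤ.^ length (filter (λ p → p ∣? α) qs)) ≡ prodℚ (map (λ p → -1ℚ ^ℚ ν p α) qs)
  [-1]^count≡∏[-1]^ν []       α≥1 _ = refl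
  [-1]^count≡∏[-1]^ν {α} (q ∷ qs) α≥1 ν≤1 with q ∣? α
  ... | yes q∣α = begin
      fromℤ ((ℤ.- (+ 1)) ℤ.* (ℤ.- (+ 1)) ℤ.^ L)          ≡⟨ fromℤ-* (ℤ.- (+ 1)) ((ℤ.- (+ 1)) ℤ.^ L) ⟩
      -1ℚ ℚ.* fromℤ ((ℤ.- (+ 1)) ℤ.^ L)                   ≡⟨ cong₂ ℚ._*_ (sym (ℚP.*-identityʳ -1ℚ)) IH ⟩
      (-1ℚ ^ℚ 1) ℚ.* prodℚ (map (λ p → -1ℚ ^ℚ ν p α) qs)  ≡⟨ cong (λ e → (-1ℚ ^ℚ e) ℚ.* prodℚ (map (λ p → -1ℚ ^ℚ ν p α) qs)) (sym ν≡1) ⟩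
      (-1ℚ ^ℚ ν q α) ℚ.* prodℚ (map (λ p → -1ℚ ^ℚ ν p α) qs) ∎
    where
    open ≡-Reasoning
    L = length (filter (λ p → p ∣? α) qs)
    IH = [-1]^count≡∏[-1]^ν qs α≥1 (λ r r∈ → ν≤1 r (there r∈))
    ν≡1 : ν q α ≡ 1
    ν≡1 = ≤-antisym (proj₂ (ν≤1 q (here refl)))
                    (pow∣⇒≤ν {k = 1} (proj₁ (ν≤1 q (here refl))) α≥1 (subst (_∣ α) (sym (*-identityʳ q)) q∣α))
  ... | no q∤α = begin
      fromℤ ((ℤ.- (+ 1)) ℤ.^ L)                           ≡⟨ [-1]^count≡∏[-1]^ν qs α≥1 (λ r r∈ → ν≤1 r (there r∈)) ⟩
      prodℚ (map (λ p → -1ℚ ^ℚ ν p α) qs)                 ≡⟨ sym (ℚP.*-identityˡ _) ⟩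
      (-1ℚ ^ℚ 0) ℚ.* prodℚ (map (λ p → -1ℚ ^ℚ ν p α) qs)  ≡⟨ cong (λ e → (-1ℚ ^ℚ e) ℚ.* prodℚ (map (λ p → -1ℚ ^ℚ ν p α) qs))
                                                                 (sym (∤⇒ν≡0 (proj₁ (ν≤1 q (here refl))) α≥1 q∤α)) ⟩
      (-1ℚ ^ℚ ν q α) ℚ.* prodℚ (map (λ p → -1ℚ ^ℚ ν p α) qs) ∎
    where
    open ≡-Reasoning
    L = length (filter (λ p → p ∣? α) qs)

  μ≡∏[-1]^ν : ∀ {d α} → 1 ≤ d → InBox (primeDivisors d) 1 α ≡ true →
    fromℤ (μ α) ≡ prodℚ (map (λ p → -1ℚ ^ℚ ν p α) (primeDivisors d))
  μ≡∏[-1]^ν {d} {α} d≥1 α∈ with α | InBox⇒≥1 (primeDivisors-distinct d) α∈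
                              | InBox-1⇒squarefreeB (primeDivisors-distinct d) α∈ | InBox-1⇒∣d {d} α∈ | α∈
  ... | suc n | α≥1 | sqf | α∣d | α∈′ rewrite sqf | primeDivisors-∣ α≥1 α∣d d≥1 =
    [-1]^count≡∏[-1]^ν (primeDivisors d) α≥1
      (λ q q∈ → proj₁ (∈-primeDivisors⁻ {q} {d} q∈) , InBox-ν≤ (primeDivisors-distinct d) α∈′ q q∈)

  sum-divisors≡boxSum : ∀ d (G : ℕ → ℚ) → 1 ≤ d →
    (∀ α → α ∣ d → InBox (primeDivisors d) 1 α ≡ false → G α ≡ 0ℚ) →
    sumℚ (map G (divisors d)) ≡ boxSum (primeDivisors d) 1 G
  sum-divisors≡boxSum d G d≥1 G≡0 = begin
      sumℚ (map G (divisors d))                      ≡⟨ sumℚ-filter (λ a → a ∣? d) G (range1 d) ⟩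
      sumℚ (map (λ α → [ ⌊ α ∣? d ⌋ ]· G α) (range1 d)) ≡⟨ sumℚ-range1 d _ ⟩
      Σ≤ d (λ α → [ ⌊ α ∣? d ⌋ ]· G α)              ≡⟨ Σ<-cong d (λ i _ → divisor⇔InBox (suc i)) ⟩
      Σ≤ d (λ α → [ InBox ps 1 α ]· G α)            ≡⟨ Σ≤-InBox≡boxSum ps 1 G d (primeDivisors-distinct d) ⟩
      boxSum ps 1 (λ w → [ ⌊ w ≤? d ⌋ ]· G w)       ≡⟨ boxSum-cong 1 (primeDivisors-distinct d) (λ w w∈ →
                                                         cong (λ b → [ b ]· G w) (⌊⌋≡true (w ≤? d) (∣⇒≤ {{>-nonZero d≥1}} (InBox-1⇒∣d {d} w∈)))) ⟩
      boxSum ps 1 G                                 ∎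
    where
    open ≡-Reasoning
    ps = primeDivisors d
    divisor⇔InBox : ∀ α → [ ⌊ α ∣? d ⌋ ]· G α ≡ [ InBox ps 1 α ]· G α
    divisor⇔InBox α with α ∣? d | InBox ps 1 α in α∈
    ... | yes _   | true  = refl
    ... | yes α∣d | false = G≡0 α α∣d α∈
    ... | no _    | false = refl
    ... | no α∤d  | true  = ⊥-elim (α∤d (InBox-1⇒∣d {d} α∈))


module Totient where

  open import Data.Bool using (true; false; _∧_; not)
  open import Data.Nat as ℕ using (ℕ; zero; suc; _≤_; _<_; z≤n; s≤s; _*_; _+_; _<?_; _≟_)
  open import Data.Nat.Properties
  open import Data.Nat.Divisibility
  open import Data.Nat.Primality
  open import Data.Nat.GCD using (gcd; gcd[m,n]∣m; gcd[m,n]∣n; gcd-greatest; gcd[m,n]≡0⇒n≡0; gcd-zeroˡ)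
  open import Data.Rational as ℚ using (ℚ; 1ℚ; _-_)
  import Data.Rational.Properties as ℚP
  open import Data.Rational.Solver using (module +-*-Solver)
  open import Data.List using (List; []; _∷_; map; filter; length)
  open import Data.List.Membership.Propositional using (_∈_)
  open import Data.List.Membership.Propositional.Properties using (∈-filter⁺)
  open import Data.List.Relation.Unary.Any using (here; there)
  open import Data.Product using (_×_; _,_; proj₁; proj₂)
  open import Data.Sum using (inj₁; inj₂)
  open import Data.Empty using (⊥-elim)
  open import Relation.Nullary using (¬_)
  open import Relation.Nullary.Decidable using (⌊_⌋)
  open import Relation.Binary.PropositionalEquality
  open import Defs
  open Booleans
  open FiniteSums
  open Valuation
  open Box
  open Embedding
  open Divisors

  coprimeTo : List ℕ → ℕ → ℚ
  coprimeTo qs k = prodℚ (map (λ q → [ not ⌊ q ∣? k ⌋ ]· 1ℚ) qs)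

  eulerProduct : List ℕ → ℚ
  eulerProduct qs = prodℚ (map (λ q → 1ℚ - recip q) qs)

  fromℕ-length : ∀ {A : Set} (xs : List A) → fromℕ (length xs) ≡ sumℚ (map (λ _ → 1ℚ) xs)
  fromℕ-length []       = refl
  fromℕ-length (x ∷ xs) = trans (fromℕ-+ 1 (length xs)) (cong (1ℚ ℚ.+_) (fromℕ-length xs))

  coprimeTo≡[allB] : ∀ qs k → coprimeTo qs k ≡ [ allB (λ q → not ⌊ q ∣? k ⌋) qs ]· 1ℚ
  coprimeTo≡[allB] []       k = refl
  coprimeTo≡[allB] (q ∷ qs) k with not ⌊ q ∣? k ⌋
  ... | true  = trans (ℚP.*-identityˡ _) (coprimeTo≡[allB] qs k)
  ... | false = ℚP.*-zeroˡ (coprimeTo qs k)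

  [gcd≡1]≡coprimeTo : ∀ {n qs k} → 1 ≤ n → (∀ q → Prime q → q ∣ n → q ∈ qs) → (∀ q → q ∈ qs → Prime q × q ∣ n) →
    [ ⌊ gcd k n ≟ 1 ⌋ ]· 1ℚ ≡ coprimeTo qs k
  [gcd≡1]≡coprimeTo {n} {qs} {k} n≥1 factors qs-factors =
    trans (cong (λ b → [ b ]· 1ℚ) (≡true-ext to from)) (sym (coprimeTo≡[allB] qs k))
    where
    to : ⌊ gcd k n ≟ 1 ⌋ ≡ true → allB (λ q → not ⌊ q ∣? k ⌋) qs ≡ true
    to gcd≡1 = allB≡true⇐ _ qs λ q q∈ → cong not (⌊⌋≡false (q ∣? k) λ q∣k →
      <⇒≱ (prime⇒≥2 (proj₁ (qs-factors q q∈)))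
          (≤-reflexive (∣1⇒≡1 (subst (q ∣_) (⌊⌋≡true⇒ (gcd k n ≟ 1) gcd≡1) (gcd-greatest q∣k (proj₂ (qs-factors q q∈)))))))
    from : allB (λ q → not ⌊ q ∣? k ⌋) qs ≡ true → ⌊ gcd k n ≟ 1 ⌋ ≡ true
    from none∣k = ⌊⌋≡true (gcd k n ≟ 1) (≤-antisym (≮⇒≥ 1≮gcd) gcd≥1′)
      where
      gcd≥1′ : 1 ≤ gcd k n
      gcd≥1′ = n≢0⇒n>0 (λ gcd≡0 → <⇒≱ n≥1 (≤-reflexive (gcd[m,n]≡0⇒n≡0 k gcd≡0)))
      1≮gcd : ¬ (1 < gcd k n)
      1≮gcd 1<gcd with ∃prime∣ 1<gcd
      ... | r , pr , r∣gcd with () ← trans (sym (allB≡true⇒ _ qs none∣k r (factors r pr (∣-trans r∣gcd (gcd[m,n]∣n k n)))))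
                                           (cong not (⌊⌋≡true (r ∣? k) (∣-trans r∣gcd (gcd[m,n]∣m k n))))

  φ≡Σ≤ : ∀ n → fromℕ (φ n) ≡ Σ≤ n (λ k → [ ⌊ gcd k n ≟ 1 ⌋ ]· 1ℚ)
  φ≡Σ≤ n = trans (fromℕ-length (filter (λ k → gcd k n ≟ 1) (range1 n)))
          (trans (sumℚ-filter (λ k → gcd k n ≟ 1) (λ _ → 1ℚ) (range1 n)) (sumℚ-range1 n _))

  Σ<-1 : ∀ m → Σ< m (λ _ → 1ℚ) ≡ fromℕ m
  Σ<-1 zero    = refl
  Σ<-1 (suc m) = trans (cong (ℚ._+ 1ℚ) (Σ<-1 m)) (trans (ℚP.+-comm (fromℕ m) 1ℚ) (sym (fromℕ-+ 1 m)))

  Σ≤-multiples : ∀ p t (g : ℕ → ℚ) → 1 ≤ p → Σ≤ (p * t) (λ k → [ ⌊ p ∣? k ⌋ ]· g k) ≡ Σ≤ t (λ k → g (p * k))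
  Σ≤-multiples p zero    g _ = cong (λ m → Σ≤ m (λ k → [ ⌊ p ∣? k ⌋ ]· g k)) (*-zeroʳ p)
  Σ≤-multiples (suc p-1) (suc t) g p≥1 = begin
      Σ≤ (p * suc t) F                                 ≡⟨ cong (λ m → Σ≤ m F) (trans (*-suc p t) (+-comm p (p * t))) ⟩
      Σ< (p * t + p) (λ i → F (suc i))                 ≡⟨ Σ<-split (p * t) p (λ i → F (suc i)) ⟩
      Σ≤ (p * t) F ℚ.+ Σ< p (λ i → F (suc (p * t + i))) ≡⟨ cong₂ ℚ._+_ (Σ≤-multiples p t g p≥1) last-block ⟩
      Σ≤ t (λ k → g (p * k)) ℚ.+ g (p * suc t)          ∎
    where
    open ≡-Reasoning
    p = suc p-1
    F = λ k → [ ⌊ p ∣? k ⌋ ]· g k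
    end≡ : suc (p * t + p-1) ≡ p * suc t
    end≡ = trans (sym (+-suc (p * t) p-1)) (trans (+-comm (p * t) p) (sym (*-suc p t)))
    only-last : ∀ i → i < p → ⌊ p ∣? suc (p * t + i) ⌋ ≡ true → i ≡ p-1
    only-last i i<p p∣ = suc-injective (≤-antisym i<p (∣⇒≤ p∣1+i))
      where
      p∣1+i : p ∣ suc i
      p∣1+i = ∣m+n∣m⇒∣n (subst (p ∣_) (sym (+-suc (p * t) i)) (⌊⌋≡true⇒ (p ∣? suc (p * t + i)) p∣)) (m∣m*n t)
    last-block : Σ< p (λ i → F (suc (p * t + i))) ≡ g (p * suc t)
    last-block = trans (Σ<-indicator-unique p p-1 (λ i → ⌊ p ∣? suc (p * t + i) ⌋) (λ i → g (suc (p * t + i))) only-last)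
      (trans (cong (λ b → [ b ]· g (suc (p * t + p-1)))
                   (cong₂ _∧_ (⌊⌋≡true (p-1 <? p) ≤-refl) (⌊⌋≡true (p ∣? suc (p * t + p-1)) (subst (p ∣_) (sym end≡) (m∣m*n (suc t))))))
             (cong g end≡))

  coprimeTo-p* : ∀ {p qs} → DistinctPrimes (p ∷ qs) → ∀ k → coprimeTo qs (p * k) ≡ coprimeTo qs k
  coprimeTo-p* {p} {qs} (cons pp p∉qs ps) k = prodℚ-cong qs (λ q q∈ → cong (λ b → [ not b ]· 1ℚ) (≡true-ext (to q q∈) (from q)))
    where
    to : ∀ q → q ∈ qs → ⌊ q ∣? p * k ⌋ ≡ true → ⌊ q ∣? k ⌋ ≡ true
    to q q∈ q∣p*k with euclidsLemma p k (∈-prime ps q∈) (⌊⌋≡true⇒ (q ∣? p * k) q∣p*k)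
    ... | inj₁ q∣p = ⊥-elim (p∉qs (subst (_∈ qs) (prime∣prime⇒≡ pp (∈-prime ps q∈) q∣p) q∈))
    ... | inj₂ q∣k = ⌊⌋≡true (q ∣? k) q∣k
    from : ∀ q → ⌊ q ∣? k ⌋ ≡ true → ⌊ q ∣? p * k ⌋ ≡ true
    from q q∣k = ⌊⌋≡true (q ∣? p * k) (∣n⇒∣m*n p (⌊⌋≡true⇒ (q ∣? k) q∣k))

  [not]·1*x : ∀ b (x : ℚ) → ([ not b ]· 1ℚ) ℚ.* x ≡ x - [ b ]· x
  [not]·1*x true  x = trans (ℚP.*-zeroˡ x) (sym (ℚP.+-inverseʳ x))
  [not]·1*x false x = trans (ℚP.*-identityˡ x) (sym (ℚP.+-identityʳ x))

  -- Inclusion–exclusion one prime at a time: the k ≤ m coprime to p are all k minus the multiples p·k', k' ≤ m/p.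
  Σ≤-coprimeTo : ∀ qs m → DistinctPrimes qs → (∀ q → q ∈ qs → q ∣ m) → Σ≤ m (coprimeTo qs) ≡ fromℕ m ℚ.* eulerProduct qs
  Σ≤-coprimeTo []       m _ _ = trans (Σ<-1 m) (sym (ℚP.*-identityʳ (fromℕ m)))
  Σ≤-coprimeTo (p ∷ qs) m ps@(cons pp p∉qs ps′) qs∣m with qs∣m p (here refl)
  ... | divides t refl = begin
      Σ≤ (t * p) (coprimeTo (p ∷ qs))
        ≡⟨ Σ<-cong (t * p) (λ i _ → [not]·1*x ⌊ p ∣? suc i ⌋ (coprimeTo qs (suc i))) ⟩
      Σ≤ (t * p) (λ k → coprimeTo qs k - [ ⌊ p ∣? k ⌋ ]· coprimeTo qs k)
        ≡⟨ Σ<-distrib-minus (t * p) _ _ ⟩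
      Σ≤ (t * p) (coprimeTo qs) - Σ≤ (t * p) (λ k → [ ⌊ p ∣? k ⌋ ]· coprimeTo qs k)
        ≡⟨ cong (Σ≤ (t * p) (coprimeTo qs) -_) (trans (cong (λ z → Σ≤ z (λ k → [ ⌊ p ∣? k ⌋ ]· coprimeTo qs k)) (*-comm t p))
                                                      (Σ≤-multiples p t (coprimeTo qs) p≥1)) ⟩
      Σ≤ (t * p) (coprimeTo qs) - Σ≤ t (λ k → coprimeTo qs (p * k))
        ≡⟨ cong (Σ≤ (t * p) (coprimeTo qs) -_) (Σ<-cong t (λ i _ → coprimeTo-p* ps (suc i))) ⟩
      Σ≤ (t * p) (coprimeTo qs) - Σ≤ t (coprimeTo qs)
        ≡⟨ cong₂ _-_ (Σ≤-coprimeTo qs (t * p) ps′ (λ q q∈ → qs∣m q (there q∈))) (Σ≤-coprimeTo qs t ps′ qs∣t) ⟩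
      fromℕ (t * p) ℚ.* E - fromℕ t ℚ.* E
        ≡⟨ cong (λ z → z ℚ.* E - fromℕ t ℚ.* E) (fromℕ-* t p) ⟩
      (fromℕ t ℚ.* fromℕ p) ℚ.* E - fromℕ t ℚ.* E
        ≡⟨ factor-out (fromℕ t) (fromℕ p) (recip p) E (n*recip[n]≡1 p≥1) ⟩
      (fromℕ t ℚ.* fromℕ p) ℚ.* ((1ℚ - recip p) ℚ.* E)
        ≡⟨ cong (ℚ._* ((1ℚ - recip p) ℚ.* E)) (sym (fromℕ-* t p)) ⟩
      fromℕ (t * p) ℚ.* ((1ℚ - recip p) ℚ.* E) ∎
    where
    open ≡-Reasoning
    E = eulerProduct qs
    p≥1 = ≤-trans (s≤s z≤n) (prime⇒≥2 pp)
    qs∣t : ∀ q → q ∈ qs → q ∣ t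
    qs∣t q q∈ with euclidsLemma t p (∈-prime ps′ q∈) (qs∣m q (there q∈))
    ... | inj₁ q∣t = q∣t
    ... | inj₂ q∣p = ⊥-elim (p∉qs (subst (_∈ qs) (prime∣prime⇒≡ pp (∈-prime ps′ q∈) q∣p) q∈))
    factor-out : ∀ t p r e → p ℚ.* r ≡ 1ℚ → (t ℚ.* p) ℚ.* e - t ℚ.* e ≡ (t ℚ.* p) ℚ.* ((1ℚ - r) ℚ.* e)
    factor-out t p r e p*r≡1 = begin
      (t ℚ.* p) ℚ.* e - t ℚ.* e
        ≡⟨ solve 4 (λ t p r e → (t :* p) :* e :- t :* e
                                                                              := (t :* p) :* ((con 1ℚ :- r) :* e) :+ t :* e :* (p :* r :- con 1ℚ)) refl t p r e ⟩
      (t ℚ.* p) ℚ.* ((1ℚ - r) ℚ.* e) ℚ.+ t ℚ.* e ℚ.* (p ℚ.* r - 1ℚ)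
        ≡⟨ cong (λ z → (t ℚ.* p) ℚ.* ((1ℚ - r) ℚ.* e) ℚ.+ t ℚ.* e ℚ.* (z - 1ℚ)) p*r≡1 ⟩
      (t ℚ.* p) ℚ.* ((1ℚ - r) ℚ.* e) ℚ.+ t ℚ.* e ℚ.* (1ℚ - 1ℚ)
        ≡⟨ solve 3 (λ a b c → a :+ b :* (c :- c) := a) refl _ (t ℚ.* e) 1ℚ ⟩
      (t ℚ.* p) ℚ.* ((1ℚ - r) ℚ.* e) ∎
      where open +-*-Solver

  φ≡n*eulerProduct : ∀ n qs → DistinctPrimes qs → 1 ≤ n → (∀ q → Prime q → q ∣ n → q ∈ qs) → (∀ q → q ∈ qs → q ∣ n) →
    fromℕ (φ n) ≡ fromℕ n ℚ.* eulerProduct qs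
  φ≡n*eulerProduct n qs ps n≥1 factors qs∣n = begin
      fromℕ (φ n)                                ≡⟨ φ≡Σ≤ n ⟩
      Σ≤ n (λ k → [ ⌊ gcd k n ≟ 1 ⌋ ]· 1ℚ)       ≡⟨ Σ<-cong n (λ i _ → [gcd≡1]≡coprimeTo n≥1 factors (λ q q∈ → ∈-prime ps q∈ , qs∣n q q∈)) ⟩
      Σ≤ n (coprimeTo qs)                        ≡⟨ Σ≤-coprimeTo qs n ps qs∣n ⟩
      fromℕ n ℚ.* eulerProduct qs                ∎
    where open ≡-Reasoning

  φ≥1 : ∀ {d} → 1 ≤ d → 1 ≤ φ d
  φ≥1 {d} d≥1 = nonempty (∈-filter⁺ (λ k → gcd k d ≟ 1) (∈-range1⁺ (s≤s z≤n) d≥1) (gcd-zeroˡ d))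
    where
    nonempty : ∀ {xs : List ℕ} {x} → x ∈ xs → 1 ≤ length xs
    nonempty (here _)  = s≤s z≤n
    nonempty (there _) = s≤s z≤n


module ProductLemmas where

  open import Data.Bool using (Bool; if_then_else_; not; _∨_)
  open import Data.Nat as ℕ using (ℕ; suc; _≤_; z≤n; s≤s; _*_; _^_; _≟_)
  open import Data.Nat.Properties using (m^n>0)
  open import Data.Rational as ℚ using (ℚ; 1ℚ)
  import Data.Rational.Properties as ℚP
  open import Data.Rational.Solver using (module +-*-Solver)
  open import Data.List using ([]; _∷_; map)
  open import Data.List.Membership.Propositional using (_∈_)
  open import Data.List.Relation.Unary.Any using (here; there)
  open import Relation.Nullary.Decidable using (⌊_⌋)
  open import Relation.Binary.PropositionalEquality
  open import Defs using (prodℚ; prodℕ; _^ℚ_)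
  open Booleans
  open FiniteSums
  open Valuation using (m*n≥1)
  open Box using (DistinctPrimes; cons; prodℚ-cong)
  open Embedding

  prodℚ-* : ∀ {A : Set} (f g : A → ℚ) xs → prodℚ (map (λ x → f x ℚ.* g x) xs) ≡ prodℚ (map f xs) ℚ.* prodℚ (map g xs)
  prodℚ-* f g []       = refl
  prodℚ-* f g (x ∷ xs) = trans (cong (f x ℚ.* g x ℚ.*_) (prodℚ-* f g xs))
    (solve 4 (λ a b c d → a :* b :* (c :* d) := a :* c :* (b :* d)) refl (f x) (g x) (prodℚ (map f xs)) (prodℚ (map g xs)))
    where open +-*-Solver

  fromℕ-prodℕ : ∀ (f : ℕ → ℕ) xs → fromℕ (prodℕ (map f xs)) ≡ prodℚ (map (λ x → fromℕ (f x)) xs)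
  fromℕ-prodℕ f []       = refl
  fromℕ-prodℕ f (x ∷ xs) = trans (fromℕ-* (f x) _) (cong (fromℕ (f x) ℚ.*_) (fromℕ-prodℕ f xs))

  prodℕ≥1 : ∀ (f : ℕ → ℕ) xs → (∀ x → x ∈ xs → 1 ≤ f x) → 1 ≤ prodℕ (map f xs)
  prodℕ≥1 f []       _    = s≤s z≤n
  prodℕ≥1 f (x ∷ xs) f≥1 = m*n≥1 (f≥1 x (here refl)) (prodℕ≥1 f xs (λ y y∈ → f≥1 y (there y∈)))

  recip-∏p^e : ∀ (e : ℕ → ℕ) xs → (∀ x → x ∈ xs → 1 ≤ x) →
    recip (prodℕ (map (λ p → p ^ e p) xs)) ≡ prodℚ (map (λ p → recip p ^ℚ e p) xs)
  recip-∏p^e e []       _   = refl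
  recip-∏p^e e (x ∷ xs) xs≥1 = begin
      recip (x ^ e x * prodℕ (map (λ p → p ^ e p) xs))              ≡⟨ recip-* (p^e≥1 (xs≥1 x (here refl)))
                                                                         (prodℕ≥1 (λ p → p ^ e p) xs (λ p p∈ → p^e≥1 (xs≥1 p (there p∈)))) ⟩
      recip (x ^ e x) ℚ.* recip (prodℕ (map (λ p → p ^ e p) xs))    ≡⟨ cong₂ ℚ._*_ (recip-^ (e x) (xs≥1 x (here refl)))
                                                                         (recip-∏p^e e xs (λ p p∈ → xs≥1 p (there p∈))) ⟩
      recip x ^ℚ e x ℚ.* prodℚ (map (λ p → recip p ^ℚ e p) xs)       ∎
    where
    open ≡-Reasoning
    p^e≥1 : ∀ {p} → 1 ≤ p → 1 ≤ p ^ e p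
    p^e≥1 {suc p} _ = m^n>0 (suc p) (e (suc p))


  [c]·prodℚ≡prodℚ[c]· : ∀ {q} qs → DistinctPrimes qs → q ∈ qs → (c : ℕ → Bool) (f : ℕ → ℚ) →
    [ c q ]· prodℚ (map f qs) ≡ prodℚ (map (λ p → [ not ⌊ p ≟ q ⌋ ∨ c p ]· f p) qs)
  [c]·prodℚ≡prodℚ[c]· {q} (q ∷ qs) (cons _ q∉qs _) (here refl) c f = begin
      [ c q ]· (f q ℚ.* prodℚ (map f qs))
        ≡⟨ [b]·-*ʳ (c q) (f q) _ ⟩
      [ c q ]· f q ℚ.* prodℚ (map f qs)
        ≡⟨ cong₂ ℚ._*_ (cong (λ b → [ not b ∨ c q ]· f q) (sym (⌊⌋≡true (q ≟ q) refl)))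
                                                                            (prodℚ-cong qs (λ p p∈ → sym (unguarded p p∈))) ⟩
      [ not ⌊ q ≟ q ⌋ ∨ c q ]· f q ℚ.* prodℚ (map (λ p → [ not ⌊ p ≟ q ⌋ ∨ c p ]· f p) qs) ∎
    where
    open ≡-Reasoning
    unguarded : ∀ p → p ∈ qs → [ not ⌊ p ≟ q ⌋ ∨ c p ]· f p ≡ f p
    unguarded p p∈ = cong (λ b → [ not b ∨ c p ]· f p) (⌊⌋≡false (p ≟ q) (λ { refl → q∉qs p∈ }))
  [c]·prodℚ≡prodℚ[c]· {q} (p ∷ qs) (cons _ p∉qs ps) (there q∈) c f =
    trans ([b]·-*ˡ (c q) (f p) _)
          (cong₂ ℚ._*_ (cong (λ b → [ not b ∨ c p ]· f p) (sym (⌊⌋≡false (p ≟ q) (λ { refl → p∉qs q∈ }))))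
                       ([c]·prodℚ≡prodℚ[c]· qs ps q∈ c f))

  prodℚ-select : ∀ {q} qs → DistinctPrimes qs → q ∈ qs → (F : ℚ) → prodℚ (map (λ p → if ⌊ p ≟ q ⌋ then F else 1ℚ) qs) ≡ F
  prodℚ-select {q} (q ∷ qs) (cons _ q∉qs _) (here refl) F =
    trans (cong₂ ℚ._*_ (cong (λ b → if b then F else 1ℚ) (⌊⌋≡true (q ≟ q) refl)) (all-one qs (λ p p∈ → λ { refl → q∉qs p∈ })))
          (ℚP.*-identityʳ F)
    where
    all-one : ∀ ps → (∀ p → p ∈ ps → p ≢ q) → prodℚ (map (λ p → if ⌊ p ≟ q ⌋ then F else 1ℚ) ps) ≡ 1ℚ
    all-one []       _   = refl
    all-one (p ∷ ps) p≢q = trans (cong₂ ℚ._*_ (cong (λ b → if b then F else 1ℚ) (⌊⌋≡false (p ≟ q) (p≢q p (here refl))))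
                                              (all-one ps (λ p′ p′∈ → p≢q p′ (there p′∈))))
                                 (ℚP.*-identityˡ 1ℚ)
  prodℚ-select {q} (p ∷ qs) (cons _ p∉qs ps) (there q∈) F =
    trans (cong₂ ℚ._*_ (cong (λ b → if b then F else 1ℚ) (⌊⌋≡false (p ≟ q) (λ { refl → p∉qs q∈ }))) (prodℚ-select qs ps q∈ F))
          (ℚP.*-identityˡ F)

module Condition where

  open import Data.Bool using (Bool; true; _∧_)
  open import Data.Nat as ℕ using (ℕ; suc; _≤_; z≤n; s≤s; _^_; _*_; _+_; _≤?_; >-nonZero)
  open import Data.Nat.Properties
  open import Data.Nat.Divisibility
  open import Data.Nat.DivMod using (m*[n/m]≡n)
  open import Data.Nat.Primality
  open import Data.Nat.Coprimality using (Coprime; coprime-divisor)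
  import Data.Nat.Coprimality as Coprime
  open import Data.Nat.LCM using (lcm; m∣lcm[m,n]; n∣lcm[m,n]; lcm-least)
  open import Data.Integer as ℤ using (ℤ; +_)
  import Data.Integer.Properties as ℤP
  import Data.Integer.Divisibility as ℤD
  open import Data.List.Membership.Propositional using (_∈_)
  open import Data.Product using (_×_; _,_; proj₁; proj₂)
  open import Data.Sum using (inj₁; inj₂)
  open import Relation.Nullary.Decidable using (⌊_⌋)
  open import Relation.Binary.PropositionalEquality hiding (J)
  open import Defs
  open Booleans
  open Valuation
  open Box
  open Divisors

  lcm∣?≡∧ : ∀ x y n → ⌊ lcm x y ∣? n ⌋ ≡ ⌊ x ∣? n ⌋ ∧ ⌊ y ∣? n ⌋
  lcm∣?≡∧ x y n = ≡true-ext to from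
    where
    to : ⌊ lcm x y ∣? n ⌋ ≡ true → (⌊ x ∣? n ⌋ ∧ ⌊ y ∣? n ⌋) ≡ true
    to lcm∣n = let lcm∣n′ = ⌊⌋≡true⇒ (lcm x y ∣? n) lcm∣n in
      cong₂ _∧_ (⌊⌋≡true (x ∣? n) (∣-trans (m∣lcm[m,n] x y) lcm∣n′)) (⌊⌋≡true (y ∣? n) (∣-trans (n∣lcm[m,n] x y) lcm∣n′))
    from : (⌊ x ∣? n ⌋ ∧ ⌊ y ∣? n ⌋) ≡ true → ⌊ lcm x y ∣? n ⌋ ≡ true
    from both = let (x∣n , y∣n) = ∧≡true⇒ both in
      ⌊⌋≡true (lcm x y ∣? n) (lcm-least (⌊⌋≡true⇒ (x ∣? n) x∣n) (⌊⌋≡true⇒ (y ∣? n) y∣n))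

  p^k∣?≡k≤?ν : ∀ {p} k n → Prime p → 1 ≤ n → ⌊ p ^ k ∣? n ⌋ ≡ ⌊ k ≤? ν p n ⌋
  p^k∣?≡k≤?ν {p} k n pp n≥1 = ⌊⌋-cong (p ^ k ∣? n) (k ≤? ν p n) (pow∣⇒≤ν pp n≥1) (≤ν⇒pow∣ pp n≥1)

  squarefree-∣d*v⇒∣d : ∀ {s d v} → 1 ≤ d → 1 ≤ s → (∀ n → n * n ∣ s → n ≡ 1) → s ∣ d * v →
                       (∀ q → Prime q → q ∣ v → q ∣ d) → s ∣ d
  squarefree-∣d*v⇒∣d {s} {d} {v} d≥1 s≥1 squarefree s∣d*v v-factors =
    InBox-1⇒∣d {d} (InBox-intro (primeDivisors-distinct d) s≥1 factors ν≤1)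
    where
    factors : ∀ q → Prime q → q ∣ s → q ∈ primeDivisors d
    factors q pq q∣s with euclidsLemma d v pq (∣-trans q∣s s∣d*v)
    ... | inj₁ q∣d = ∈-primeDivisors⁺ d≥1 pq q∣d
    ... | inj₂ q∣v = ∈-primeDivisors⁺ d≥1 pq (v-factors q pq q∣v)
    ν≤1 : ∀ q → q ∈ primeDivisors d → ν q s ≤ 1
    ν≤1 q q∈ = ≮⇒≥ λ 1<ν → <⇒≢ (prime⇒≥2 pq) (sym (squarefree q
                 (subst (_∣ s) (cong (q *_) (*-identityʳ q)) (≤ν⇒pow∣ {k = 2} pq s≥1 1<ν))))
      where pq = proj₁ (∈-primeDivisors⁻ {q} {d} q∈)

  ∣-pos : ∀ {m n} → 1 ≤ n → m ∣ n → 1 ≤ m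
  ∣-pos n≥1 m∣n = n≢0⇒n>0 λ { refl → <⇒≢ n≥1 (sym (0∣⇒≡0 m∣n)) }

  fundamental-∣d*v⇒∣4d : ∀ {D d v} → 1 ≤ d → 1 ≤ v → IsFundamentalDiscriminant D → ℤ.∣ D ∣ ∣ d * v →
                         (∀ q → Prime q → q ∣ v → q ∣ d) → D ℤD.∣ (+ (4 * d))
  fundamental-∣d*v⇒∣4d {D} {d} {v} d≥1 v≥1 (inj₁ (_ , squarefree)) D∣d*v v-factors =
    ∣n⇒∣m*n 4 (squarefree-∣d*v⇒∣d d≥1 (∣-pos (m*n≥1 d≥1 v≥1) D∣d*v) squarefree D∣d*v v-factors)
  fundamental-∣d*v⇒∣4d {D} {d} {v} d≥1 v≥1 (inj₂ (m , D≡4m , _ , squarefree)) D∣d*v v-factors =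
    subst (_∣ 4 * d) (sym ∣D∣≡4∣m∣) (*-monoʳ-∣ 4 m∣d)
    where
    ∣D∣≡4∣m∣ : ℤ.∣ D ∣ ≡ 4 * ℤ.∣ m ∣
    ∣D∣≡4∣m∣ = trans (cong ℤ.∣_∣ D≡4m) (ℤP.∣i*j∣≡∣i∣*∣j∣ (+ 4) m)
    m∣d*v : ℤ.∣ m ∣ ∣ d * v
    m∣d*v = ∣-trans (subst (ℤ.∣ m ∣ ∣_) (sym ∣D∣≡4∣m∣) (n∣m*n 4)) D∣d*v
    m∣d : ℤ.∣ m ∣ ∣ d
    m∣d = squarefree-∣d*v⇒∣d d≥1 (∣-pos (m*n≥1 d≥1 v≥1) m∣d*v) squarefree m∣d*v v-factors

  condB⇒2∣d×D∣4d : ∀ {d h D v α} → 1 ≤ d → dInf d v ≡ true → IsFundamentalDiscriminant D → condB d h D v α ≡ true →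
    2 ∣ d × D ℤD.∣ (+ (4 * d))
  condB⇒2∣d×D∣4d {d} {h} {D} {v} {α} d≥1 v∣d^∞ fundamental cond =
    2∣d , fundamental-∣d*v⇒∣4d d≥1 v≥1 fundamental (∣-trans (n∣lcm[m,n] (2 ^ (k + 1)) ℤ.∣ D ∣) lcm∣d*v) v-factors
    where
    k = ν₂ (h * (d div α))
    v≥1 = proj₁ (dInf≡true⇒ v∣d^∞)
    v-factors = proj₂ (dInf≡true⇒ v∣d^∞)
    lcm∣d*v : lcm (2 ^ (k + 1)) ℤ.∣ D ∣ ∣ d * v
    lcm∣d*v = ⌊⌋≡true⇒ (lcm (2 ^ (k + 1)) ℤ.∣ D ∣ ∣? d * v) cond
    2∣2^[k+1] : 2 ∣ 2 ^ (k + 1)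
    2∣2^[k+1] = subst (λ z → 2 ∣ 2 ^ z) (+-comm 1 k) (m∣m*n (2 ^ k))
    2∣d : 2 ∣ d
    2∣d with euclidsLemma d v prime[2] (∣-trans 2∣2^[k+1] (∣-trans (m∣lcm[m,n] _ _) lcm∣d*v))
    ... | inj₁ 2∣d = 2∣d
    ... | inj₂ 2∣v = v-factors 2 prime[2] 2∣v

  -- The summation condition when j = ν₂(v), e = ν₂(α), a = ν₂(d), b = ν₂(h), t = ν₂(D); see TwoAdic.condB≡cond₂.
  cond₂ : (a b t j e : ℕ) → Bool
  cond₂ a b t j e = ⌊ suc b ≤? e + j ⌋ ∧ ⌊ t ≤? a + j ⌋

  module TwoAdic (d h : ℕ) (D : ℤ) (d≥1 : 1 ≤ d) (h≥1 : 1 ≤ h) (D∣4d : ℤ.∣ D ∣ ∣ 4 * d) where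

    private
      ν₂d ν₂h ν₂D : ℕ
      ν₂d = ν₂ d
      ν₂h = ν₂ h
      ν₂D = ν₂ ℤ.∣ D ∣

      ∣D∣≥1 : 1 ≤ ℤ.∣ D ∣
      ∣D∣≥1 = ∣-pos (m*n≥1 {4} (s≤s z≤n) d≥1) D∣4d

    -- The odd part of D divides 4d, hence d, so only the 2-part of D matters.
    ∣D∣∣?d*v≡ : ∀ {v} → 1 ≤ v → ⌊ ℤ.∣ D ∣ ∣? d * v ⌋ ≡ ⌊ ν₂D ≤? ν₂d + ν₂ v ⌋
    ∣D∣∣?d*v≡ {v} v≥1 = trans (⌊⌋-cong (ℤ.∣ D ∣ ∣? d * v) (ν₂D ≤? ν₂ (d * v)) to from)
                              (cong (λ z → ⌊ ν₂D ≤? z ⌋) (ν-* prime[2] d≥1 v≥1))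
      where
      d*v≥1 = m*n≥1 d≥1 v≥1
      odd = pFree 2 ℤ.∣ D ∣
      odd∤2 = p∤pFree prime[2] ∣D∣≥1
      to : ℤ.∣ D ∣ ∣ d * v → ν₂D ≤ ν₂ (d * v)
      to D∣d*v = pow∣⇒≤ν prime[2] d*v≥1 (∣-trans (p^ν∣n prime[2] ∣D∣≥1) D∣d*v)
      from : ν₂D ≤ ν₂ (d * v) → ℤ.∣ D ∣ ∣ d * v
      from ν₂D≤ = subst (_∣ d * v) (p^ν*pFree≡n prime[2] ∣D∣≥1)
                    (coprime⇒*∣ (Coprime.sym (coprime-p^k ν₂D prime[2] (pFree≥1 prime[2] ∣D∣≥1) odd∤2))
                               (≤ν⇒pow∣ prime[2] d*v≥1 ν₂D≤) (∣m⇒∣m*n v odd∣d))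
        where
        odd∣d : odd ∣ d
        odd∣d = coprime-divisor (Coprime.sym (coprime-p^k 2 prime[2] (pFree≥1 prime[2] ∣D∣≥1) odd∤2))
                                (∣-trans (pFree∣n prime[2] ∣D∣≥1) D∣4d)

    condB≡cond₂ : ∀ {v α} → 1 ≤ v → 1 ≤ α → α ∣ d → condB d h D v α ≡ cond₂ (ν₂ d) (ν₂ h) (ν₂ ℤ.∣ D ∣) (ν₂ v) (ν₂ α)
    condB≡cond₂ {v} {α} v≥1 α≥1 α∣d = begin
        condB d h D v α
          ≡⟨ lcm∣?≡∧ (2 ^ (ν₂ (h * (d div α)) + 1)) ℤ.∣ D ∣ (d * v) ⟩
        ⌊ 2 ^ (ν₂ (h * (d div α)) + 1) ∣? d * v ⌋ ∧ ⌊ ℤ.∣ D ∣ ∣? d * v ⌋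
          ≡⟨ cong₂ _∧_ (trans (p^k∣?≡k≤?ν (ν₂ (h * (d div α)) + 1) (d * v) prime[2] d*v≥1) shift-by-c) (∣D∣∣?d*v≡ v≥1) ⟩
        cond₂ ν₂d ν₂h ν₂D (ν₂ v) (ν₂ α) ∎
      where
      open ≡-Reasoning
      instance _ = >-nonZero α≥1
      q = d ℕ./ α
      α*q≡d : α * q ≡ d
      α*q≡d = m*[n/m]≡n α∣d
      q≥1 : 1 ≤ q
      q≥1 = ∣-pos d≥1 (divides α (sym α*q≡d))
      c = ν₂ q
      e = ν₂ α
      j = ν₂ v
      lhs≡ : ν₂ (h * (d div α)) + 1 ≡ c + suc ν₂h
      lhs≡ = begin
        ν₂ (h * (d div α)) + 1   ≡⟨ cong (λ z → ν₂ (h * z) + 1) (div≡/ d α) ⟩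
        ν₂ (h * q) + 1           ≡⟨ cong (_+ 1) (ν-* prime[2] h≥1 q≥1) ⟩
        ν₂h + c + 1              ≡⟨ trans (+-comm (ν₂h + c) 1) (cong suc (+-comm ν₂h c)) ⟩
        suc (c + ν₂h)            ≡⟨ sym (+-suc c ν₂h) ⟩
        c + suc ν₂h              ∎
      rhs≡ : ν₂ (d * v) ≡ c + (e + j)
      rhs≡ = begin
        ν₂ (d * v)               ≡⟨ ν-* prime[2] d≥1 v≥1 ⟩
        ν₂ d + j                 ≡⟨ cong (λ z → ν₂ z + j) (sym α*q≡d) ⟩
        ν₂ (α * q) + j           ≡⟨ cong (_+ j) (trans (ν-* prime[2] α≥1 q≥1) (+-comm e c)) ⟩
        c + e + j                ≡⟨ +-assoc c e j ⟩
        c + (e + j)              ∎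
      d*v≥1 = m*n≥1 d≥1 v≥1
      shift-by-c : ⌊ ν₂ (h * (d div α)) + 1 ≤? ν₂ (d * v) ⌋ ≡ ⌊ suc ν₂h ≤? e + j ⌋
      shift-by-c = ⌊⌋-cong (ν₂ (h * (d div α)) + 1 ≤? ν₂ (d * v)) (suc ν₂h ≤? e + j)
        (λ ≤ → +-cancelˡ-≤ c (suc ν₂h) (e + j) (subst₂ _≤_ lhs≡ rhs≡ ≤))
        (λ ≤ → subst₂ _≤_ (sym lhs≡) (sym rhs≡) (+-monoʳ-≤ c ≤))


module RationalBounds where

  open import Data.Nat as ℕ using (ℕ; zero; suc; z≤n; s≤s)
  import Data.Nat.Properties as ℕP
  open import Data.Integer as ℤ using (ℤ; +_; -[1+_]; +≤+; +<+)
  import Data.Integer.Properties as ℤP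
  open import Data.Rational as ℚ using (ℚ; 0ℚ; 1ℚ; _+_; _*_; -_; _-_; _≤_; _<_; ∣_∣; mkℚ; ½)
  open import Data.Rational.Properties
  open import Data.Rational.Unnormalised using (*≤*; *<*)
  import Data.Rational.Unnormalised.Properties as ℚᵘP
  open import Data.Rational.Solver using (module +-*-Solver)
  open import Data.Product using (Σ; _,_)
  open import Data.Empty using (⊥-elim)
  open import Relation.Binary.PropositionalEquality
  open import Defs using (_//_; _^ℚ_)
  open Valuation using (n<2^n; m*n≥1)
  open FiniteSums
  open Embedding

  //-mono-≤ : ∀ a b c d → a ℕ.* suc d ℕ.≤ c ℕ.* suc b → (+ a) // suc b ≤ (+ c) // suc d
  //-mono-≤ a b c d a*d≤c*b = toℚᵘ-cancel-≤ (ℚᵘP.≤-respˡ-≃ (ℚᵘP.≃-sym (normalise-/ (+ a) b)) (ℚᵘP.≤-respʳ-≃ (ℚᵘP.≃-sym (normalise-/ (+ c) d))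
    (*≤* (subst₂ ℤ._≤_ (ℤP.pos-* a (suc d)) (ℤP.pos-* c (suc b)) (+≤+ a*d≤c*b)))))

  //-mono-< : ∀ a b c d → a ℕ.* suc d ℕ.< c ℕ.* suc b → (+ a) // suc b < (+ c) // suc d
  //-mono-< a b c d a*d<c*b = toℚᵘ-cancel-< (ℚᵘP.<-respˡ-≃ (ℚᵘP.≃-sym (normalise-/ (+ a) b)) (ℚᵘP.<-respʳ-≃ (ℚᵘP.≃-sym (normalise-/ (+ c) d))
    (*<* (subst₂ ℤ._<_ (ℤP.pos-* a (suc d)) (ℤP.pos-* c (suc b)) (+<+ a*d<c*b)))))

  pos⇒≡// : ∀ ε → 0ℚ < ε → Σ ℕ λ n → Σ ℕ λ d → ε ≡ (+ suc n) // suc d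
  pos⇒≡// ε@(mkℚ (+ suc n) d _) _           = n , d , sym (↥p/↧p≡p ε)
  pos⇒≡// (mkℚ (+ 0) d _)       (ℚ.*<* 0<0) = ⊥-elim (ℤP.<-irrefl refl 0<0)
  pos⇒≡// (mkℚ -[1+ n ] d _)    (ℚ.*<* ())

  recip-pos : ∀ n → 0ℚ < recip (suc n)
  recip-pos n = //-mono-< 0 0 1 n (s≤s z≤n)

  recip-nonNeg : ∀ n → 0ℚ ≤ recip n
  recip-nonNeg zero    = ≤-refl
  recip-nonNeg (suc n) = <⇒≤ (recip-pos n)

  recip≤1 : ∀ n → recip (suc n) ≤ 1ℚ
  recip≤1 n = //-mono-≤ 1 n 1 0 (s≤s z≤n)

  recip-antimono-≤ : ∀ {a b} → 1 ℕ.≤ a → a ℕ.≤ b → recip b ≤ recip a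
  recip-antimono-≤ {suc a} {suc b} _ a≤b =
    //-mono-≤ 1 b 1 a (subst₂ ℕ._≤_ (sym (ℕP.*-identityˡ (suc a))) (sym (ℕP.*-identityˡ (suc b))) a≤b)

  fromℕ-mono-≤ : ∀ a b → a ℕ.≤ b → fromℕ a ≤ fromℕ b
  fromℕ-mono-≤ a b a≤b = //-mono-≤ a 0 b 0 (subst₂ ℕ._≤_ (sym (ℕP.*-identityʳ a)) (sym (ℕP.*-identityʳ b)) a≤b)

  fromℕ-nonNeg : ∀ a → 0ℚ ≤ fromℕ a
  fromℕ-nonNeg a = fromℕ-mono-≤ 0 a z≤n

  ∃fromℕ≥∣∣ : ∀ q → Σ ℕ λ C → ∣ q ∣ ≤ fromℕ C
  ∃fromℕ≥∣∣ q@(mkℚ n d _) = ℤ.∣ n ∣ , subst (_≤ fromℕ ℤ.∣ n ∣) (↥p/↧p≡p ∣ q ∣)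
                                            (//-mono-≤ ℤ.∣ n ∣ d ℤ.∣ n ∣ 0 (ℕP.*-monoʳ-≤ ℤ.∣ n ∣ (s≤s z≤n)))

  *-mono-≤-nonNeg : ∀ {a b c d} → 0ℚ ≤ a → 0ℚ ≤ c → a ≤ b → c ≤ d → a * c ≤ b * d
  *-mono-≤-nonNeg {a} {b} {c} {d} a≥0 c≥0 a≤b c≤d =
    ≤-trans (*-monoʳ-≤-nonNeg c {{ℚ.nonNegative c≥0}} a≤b) (*-monoˡ-≤-nonNeg b {{ℚ.nonNegative (≤-trans a≥0 a≤b)}} c≤d)

  *-nonNeg : ∀ {a b} → 0ℚ ≤ a → 0ℚ ≤ b → 0ℚ ≤ a * b
  *-nonNeg a≥0 b≥0 = *-mono-≤-nonNeg ≤-refl ≤-refl a≥0 b≥0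

  archimedean : ∀ (C : ℕ) ε → 0ℚ < ε → Σ ℕ λ M → ∀ N → M ℕ.≤ N → fromℕ C * recip N < ε
  archimedean C ε ε>0 with pos⇒≡// ε ε>0
  ... | n , d , refl = suc (C ℕ.* suc d) , λ where
    (suc N) M≤N → <-≤-trans
      (subst (_< (+ 1) // suc d) (z//n≡z*recip[n] (+ C) (s≤s z≤n))
             (//-mono-< C N 1 d (subst (C ℕ.* suc d ℕ.<_) (sym (ℕP.*-identityˡ (suc N))) M≤N)))
      (//-mono-≤ 1 d (suc n) d (ℕP.*-monoˡ-≤ (suc d) {1} {suc n} (s≤s z≤n)))

  ^ℚ-nonNeg : ∀ q m → 0ℚ ≤ q → 0ℚ ≤ q ^ℚ m
  ^ℚ-nonNeg q zero    _   = //-mono-≤ 0 0 1 0 z≤n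
  ^ℚ-nonNeg q (suc m) q≥0 = *-nonNeg q≥0 (^ℚ-nonNeg q m q≥0)

  ^ℚ-monoˡ-≤ : ∀ q q′ m → 0ℚ ≤ q → q ≤ q′ → q ^ℚ m ≤ q′ ^ℚ m
  ^ℚ-monoˡ-≤ q q′ zero    _   _    = ≤-refl
  ^ℚ-monoˡ-≤ q q′ (suc m) q≥0 q≤q′ = *-mono-≤-nonNeg q≥0 (^ℚ-nonNeg q m q≥0) q≤q′ (^ℚ-monoˡ-≤ q q′ m q≥0 q≤q′)

  q^n≤recip[n] : ∀ q n → 0ℚ ≤ q → q ≤ ½ → 1 ℕ.≤ n → q ^ℚ n ≤ recip n
  q^n≤recip[n] q n q≥0 q≤½ n≥1 = begin
      q ^ℚ n            ≤⟨ ^ℚ-monoˡ-≤ q ½ n q≥0 q≤½ ⟩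
      ½ ^ℚ n            ≡⟨ sym (recip-^ n (s≤s z≤n)) ⟩
      recip (2 ℕ.^ n)   ≤⟨ recip-antimono-≤ n≥1 (ℕP.<⇒≤ (n<2^n n)) ⟩
      recip n           ∎
    where open ≤-Reasoning

  recip[m]-recip[1+m] : ∀ {m} → 1 ℕ.≤ m → recip m - recip (suc m) ≡ recip (m ℕ.* suc m)
  recip[m]-recip[1+m] {m} m≥1 = begin
      r - s
        ≡⟨ cong₂ _-_ (sym (*-identityʳ r)) (sym (*-identityʳ s)) ⟩
      r * 1ℚ - s * 1ℚ
        ≡⟨ cong₂ (λ x y → r * x - s * y) (sym (n*recip[n]≡1 {suc m} (s≤s z≤n))) (sym (n*recip[n]≡1 {m} m≥1)) ⟩
      r * (fromℕ (suc m) * s) - s * (fromℕ m * r)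
        ≡⟨ solve 4 (λ r s M N → r :* (N :* s) :- s :* (M :* r) := r :* s :* (N :- M)) refl r s (fromℕ m) (fromℕ (suc m)) ⟩
      r * s * (fromℕ (suc m) - fromℕ m)
        ≡⟨ cong (λ z → r * s * (z - fromℕ m)) (fromℕ-+ 1 m) ⟩
      r * s * (1ℚ + fromℕ m - fromℕ m)
        ≡⟨ solve 3 (λ r s M → r :* s :* (con 1ℚ :+ M :- M) := r :* s) refl r s (fromℕ m) ⟩
      r * s
        ≡⟨ sym (recip-* {m} {suc m} m≥1 (s≤s z≤n)) ⟩
      recip (m ℕ.* suc m) ∎
    where
    open ≡-Reasoning
    open +-*-Solver
    r = recip m
    s = recip (suc m)

  -- Telescoping against 1/(m(m+1)) = 1/m − 1/(m+1).
  Σ<-recip-square≤ : ∀ N B → 1 ℕ.≤ N → Σ< B (λ i → recip (suc (N ℕ.+ i) ℕ.* suc (N ℕ.+ i))) ≤ recip N - recip (N ℕ.+ B)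
  Σ<-recip-square≤ N zero    N≥1 = ≤-reflexive (sym (trans (cong (λ z → recip N - recip z) (ℕP.+-identityʳ N)) (+-inverseʳ (recip N))))
  Σ<-recip-square≤ N (suc B) N≥1 = begin
      Σ< B (λ i → recip (suc (N ℕ.+ i) ℕ.* suc (N ℕ.+ i))) + recip (suc (N ℕ.+ B) ℕ.* suc (N ℕ.+ B))
        ≤⟨ +-mono-≤ (Σ<-recip-square≤ N B N≥1)
                    (recip-antimono-≤ (m*n≥1 N+B≥1 (s≤s z≤n)) (ℕP.*-monoˡ-≤ (suc (N ℕ.+ B)) (ℕP.n≤1+n (N ℕ.+ B)))) ⟩
      recip N - recip (N ℕ.+ B) + recip ((N ℕ.+ B) ℕ.* suc (N ℕ.+ B))
        ≡⟨ cong (λ z → recip N - recip (N ℕ.+ B) + z) (sym (recip[m]-recip[1+m] N+B≥1)) ⟩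
      recip N - recip (N ℕ.+ B) + (recip (N ℕ.+ B) - recip (suc (N ℕ.+ B)))
        ≡⟨ solve 3 (λ x y z → x :- y :+ (y :- z) := x :- z) refl (recip N) (recip (N ℕ.+ B)) (recip (suc (N ℕ.+ B))) ⟩
      recip N - recip (suc (N ℕ.+ B))
        ≡⟨ cong (λ z → recip N - recip z) (sym (ℕP.+-suc N B)) ⟩
      recip N - recip (N ℕ.+ suc B) ∎
    where
    open ≤-Reasoning
    open +-*-Solver
    N+B≥1 = ℕP.≤-trans N≥1 (ℕP.m≤m+n N B)

  Σ<-recip-square≤recip : ∀ N B → 1 ℕ.≤ N → Σ< B (λ i → recip (suc (N ℕ.+ i) ℕ.* suc (N ℕ.+ i))) ≤ recip N
  Σ<-recip-square≤recip N B N≥1 = ≤-trans (Σ<-recip-square≤ N B N≥1)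
    (≤-trans (+-monoʳ-≤ (recip N) (neg-antimono-≤ (recip-nonNeg (N ℕ.+ B)))) (≤-reflexive (+-identityʳ (recip N))))


module Convergence where

  open import Data.Nat as ℕ using (ℕ; zero; suc; _⊔_)
  import Data.Nat.Properties as ℕP
  open import Data.Rational as ℚ using (ℚ; 0ℚ; 1ℚ; _+_; _*_; -_; _-_; _≤_; _<_; ∣_∣; ½)
  open import Data.Rational.Properties
  open import Data.Rational.Solver using (module +-*-Solver)
  open import Data.List using (List; []; _∷_; map)
  open import Data.List.Membership.Propositional using (_∈_)
  open import Data.List.Relation.Unary.Any using (here; there)
  open import Data.Product using (_,_)
  open import Relation.Binary.PropositionalEquality
  open import Defs using (ConvergesTo; prodℚ; _^ℚ_)
  open FiniteSums
  open Embedding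
  open RationalBounds

  private variable f g : ℕ → ℚ
                   L K : ℚ

  converges-cong : (∀ N → f N ≡ g N) → ConvergesTo g L → ConvergesTo f L
  converges-cong {f} {g} {L} f≡g g→L ε ε>0 with g→L ε ε>0
  ... | M , close = M , λ N M≤N → subst (λ x → ∣ x - L ∣ < ε) (sym (f≡g N)) (close N M≤N)

  converges-shift : ∀ K → ConvergesTo (λ m → f (K ℕ.+ m)) L → ConvergesTo f L
  converges-shift {f} {L} K f→L ε ε>0 with f→L ε ε>0
  ... | M , close = K ℕ.+ M , λ N K+M≤N → subst (λ x → ∣ f x - L ∣ < ε) (ℕP.m+[n∸m]≡n (ℕP.≤-trans (ℕP.m≤m+n K M) K+M≤N))
      (close (N ℕ.∸ K) (ℕP.≤-trans (ℕP.≤-reflexive (sym (ℕP.m+n∸n≡m M K))) (ℕP.∸-monoˡ-≤ K (subst (ℕ._≤ N) (ℕP.+-comm K M) K+M≤N))))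

  converges-suc : ConvergesTo f L → ConvergesTo (λ N → f (suc N)) L
  converges-suc {f} {L} f→L ε ε>0 with f→L ε ε>0
  ... | M , close = M , λ N M≤N → close (suc N) (ℕP.m≤n⇒m≤1+n M≤N)

  converges-const : ∀ c → ConvergesTo (λ _ → c) c
  converges-const c ε ε>0 = 0 , λ N _ → subst (_< ε) (sym (cong ∣_∣ (+-inverseʳ c))) ε>0

  converges-+ : ConvergesTo f L → ConvergesTo g K → ConvergesTo (λ N → f N + g N) (L + K)
  converges-+ {f} {L} {g} {K} f→L g→K ε ε>0 with f→L (ε * ½) ε/2>0 | g→K (ε * ½) ε/2>0
    where ε/2>0 = subst (_< ε * ½) (*-zeroˡ ½) (*-monoˡ-<-pos ½ ε>0)
  ... | M₁ , close₁ | M₂ , close₂ = M₁ ⊔ M₂ , λ N M≤N → begin-strict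
      ∣ f N + g N - (L + K) ∣     ≡⟨ cong ∣_∣ (solve 4 (λ a b c d → a :+ b :- (c :+ d) := (a :- c) :+ (b :- d)) refl (f N) (g N) L K) ⟩
      ∣ (f N - L) + (g N - K) ∣   ≤⟨ ∣p+q∣≤∣p∣+∣q∣ (f N - L) (g N - K) ⟩
      ∣ f N - L ∣ + ∣ g N - K ∣   <⟨ +-mono-< (close₁ N (ℕP.≤-trans (ℕP.m≤m⊔n M₁ M₂) M≤N)) (close₂ N (ℕP.≤-trans (ℕP.m≤n⊔m M₁ M₂) M≤N)) ⟩
      ε * ½ + ε * ½               ≡⟨ solve 1 (λ e → e :* con ½ :+ e :* con ½ := e) refl ε ⟩
      ε                           ∎
    where
    open ≤-Reasoning
    open +-*-Solver

  converges-neg : ConvergesTo f L → ConvergesTo (λ N → - f N) (- L)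
  converges-neg {f} {L} f→L ε ε>0 with f→L ε ε>0
  ... | M , close = M , λ N M≤N → subst (_< ε) (trans (sym (∣-p∣≡∣p∣ (f N - L)))
                         (cong ∣_∣ (solve 2 (λ a b → :- (a :- b) := :- a :- :- b) refl (f N) L))) (close N M≤N)
    where open +-*-Solver

  converges-−0 : ConvergesTo f L → ConvergesTo g 0ℚ → ConvergesTo (λ N → f N - g N) L
  converges-−0 {f} {L} {g} f→L g→0 =
    subst (ConvergesTo (λ N → f N - g N)) (+-identityʳ L) (converges-+ {f = f} {g = λ N → - g N} f→L (converges-neg {f = g} {L = 0ℚ} g→0))

  converges-*ˡ : ∀ c → ConvergesTo f L → ConvergesTo (λ N → c * f N) (c * L)
  converges-*ˡ {f} {L} c f→L ε ε>0 with ∃fromℕ≥∣∣ c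
  ... | C , ∣c∣≤C with archimedean C ε ε>0
  ... | M₁ , C/N<ε with f→L (recip (suc M₁)) (recip-pos M₁)
  ... | M₂ , close = M₂ , λ N M≤N → begin-strict
      ∣ c * f N - c * L ∣           ≡⟨ cong ∣_∣ (solve 3 (λ c a b → c :* a :- c :* b := c :* (a :- b)) refl c (f N) L) ⟩
      ∣ c * (f N - L) ∣             ≡⟨ ∣p*q∣≡∣p∣*∣q∣ c (f N - L) ⟩
      ∣ c ∣ * ∣ f N - L ∣           ≤⟨ *-mono-≤-nonNeg (0≤∣p∣ c) (0≤∣p∣ _) ∣c∣≤C (<⇒≤ (close N M≤N)) ⟩
      fromℕ C * recip (suc M₁)      <⟨ C/N<ε (suc M₁) (ℕP.n≤1+n M₁) ⟩
      ε                             ∎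
    where
    open ≤-Reasoning
    open +-*-Solver

  converges-* : ConvergesTo f L → ConvergesTo g K → ConvergesTo (λ N → f N * g N) (L * K)
  converges-* {f} {L} {g} {K} f→L g→K ε ε>0 with ∃fromℕ≥∣∣ L | ∃fromℕ≥∣∣ K
  ... | a , ∣L∣≤a | b , ∣K∣≤b with archimedean (suc a ℕ.+ b) ε ε>0
  ... | M₁ , C/N<ε with f→L (recip (suc M₁)) (recip-pos M₁) | g→K (recip (suc M₁)) (recip-pos M₁)
  ... | M₂ , close₂ | M₃ , close₃ = M₂ ⊔ M₃ , λ N M≤N → let
        δ = recip (suc M₁)
        f≈L = <⇒≤ (close₂ N (ℕP.≤-trans (ℕP.m≤m⊔n M₂ M₃) M≤N))
        g≈K = <⇒≤ (close₃ N (ℕP.≤-trans (ℕP.m≤n⊔m M₂ M₃) M≤N))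
        ∣fN∣≤1+a : ∣ f N ∣ ≤ fromℕ (suc a)
        ∣fN∣≤1+a = begin
          ∣ f N ∣                 ≡⟨ cong ∣_∣ (solve 2 (λ x l → x := l :+ (x :- l)) refl (f N) L) ⟩
          ∣ L + (f N - L) ∣       ≤⟨ ∣p+q∣≤∣p∣+∣q∣ L _ ⟩
          ∣ L ∣ + ∣ f N - L ∣     ≤⟨ +-mono-≤ ∣L∣≤a (≤-trans f≈L (recip≤1 M₁)) ⟩
          fromℕ a + 1ℚ            ≡⟨ trans (+-comm (fromℕ a) 1ℚ) (sym (fromℕ-+ 1 a)) ⟩
          fromℕ (suc a)           ∎
        in begin-strict
      ∣ f N * g N - L * K ∣
        ≡⟨ cong ∣_∣ (solve 4 (λ x y l k → x :* y :- l :* k := x :* (y :- k) :+ k :* (x :- l)) refl (f N) (g N) L K) ⟩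
      ∣ f N * (g N - K) + K * (f N - L) ∣
        ≤⟨ ∣p+q∣≤∣p∣+∣q∣ (f N * (g N - K)) (K * (f N - L)) ⟩
      ∣ f N * (g N - K) ∣ + ∣ K * (f N - L) ∣
        ≡⟨ cong₂ _+_ (∣p*q∣≡∣p∣*∣q∣ (f N) _) (∣p*q∣≡∣p∣*∣q∣ K _) ⟩
      ∣ f N ∣ * ∣ g N - K ∣ + ∣ K ∣ * ∣ f N - L ∣
        ≤⟨ +-mono-≤ (*-mono-≤-nonNeg (0≤∣p∣ _) (0≤∣p∣ _) ∣fN∣≤1+a g≈K)
                                                                    (*-mono-≤-nonNeg (0≤∣p∣ _) (0≤∣p∣ _) ∣K∣≤b f≈L) ⟩
      fromℕ (suc a) * δ + fromℕ b * δ
        ≡⟨ trans (sym (*-distribʳ-+ δ (fromℕ (suc a)) (fromℕ b))) (cong (_* δ) (sym (fromℕ-+ (suc a) b))) ⟩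
      fromℕ (suc a ℕ.+ b) * δ
        <⟨ C/N<ε (suc M₁) (ℕP.n≤1+n M₁) ⟩
      ε ∎
    where
    open ≤-Reasoning
    open +-*-Solver

  converges-prodℚ : ∀ (ps : List ℕ) (s : ℕ → ℕ → ℚ) (l : ℕ → ℚ) → (∀ p → p ∈ ps → ConvergesTo (s p) (l p)) →
    ConvergesTo (λ N → prodℚ (map (λ p → s p N) ps)) (prodℚ (map l ps))
  converges-prodℚ []       s l _       = converges-const 1ℚ
  converges-prodℚ (p ∷ ps) s l s→l =
    converges-* {f = s p} {g = λ N → prodℚ (map (λ p → s p N) ps)} (s→l p (here refl)) (converges-prodℚ ps s l (λ q q∈ → s→l q (there q∈)))

  ≤C*recip⇒converges-0 : ∀ C M₀ → (∀ N → M₀ ℕ.≤ N → ∣ f N ∣ ≤ fromℕ C * recip N) → ConvergesTo f 0ℚ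
  ≤C*recip⇒converges-0 {f} C M₀ bound ε ε>0 with archimedean C ε ε>0
  ... | M , C/N<ε = M₀ ⊔ M , λ N M≤N → subst (_< ε) (cong ∣_∣ (sym (+-identityʳ (f N))))
     (≤-<-trans (bound N (ℕP.≤-trans (ℕP.m≤m⊔n M₀ M) M≤N)) (C/N<ε N (ℕP.≤-trans (ℕP.m≤n⊔m M₀ M) M≤N)))

  converges-geometric : ∀ q → 0ℚ ≤ q → q ≤ ½ → ConvergesTo (λ m → q ^ℚ m) 0ℚ
  converges-geometric q q≥0 q≤½ = ≤C*recip⇒converges-0 1 1 λ N N≥1 →
    subst (_≤ fromℕ 1 * recip N) (sym (0≤p⇒∣p∣≡p (^ℚ-nonNeg q N q≥0)))
          (subst (q ^ℚ N ≤_) (sym (*-identityˡ (recip N))) (q^n≤recip[n] q N q≥0 q≤½ N≥1))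

  geometric-sum : ∀ q m → Σ< m (λ i → q ^ℚ i) * (1ℚ - q) ≡ 1ℚ - q ^ℚ m
  geometric-sum q zero    = *-zeroˡ (1ℚ - q)
  geometric-sum q (suc m) = begin
      (Σ< m (λ i → q ^ℚ i) + q ^ℚ m) * (1ℚ - q)
        ≡⟨ *-distribʳ-+ (1ℚ - q) (Σ< m (λ i → q ^ℚ i)) (q ^ℚ m) ⟩
      Σ< m (λ i → q ^ℚ i) * (1ℚ - q) + q ^ℚ m * (1ℚ - q)
        ≡⟨ cong (_+ q ^ℚ m * (1ℚ - q)) (geometric-sum q m) ⟩
      1ℚ - q ^ℚ m + q ^ℚ m * (1ℚ - q)
        ≡⟨ solve 2 (λ x q → con 1ℚ :- x :+ x :* (con 1ℚ :- q) := con 1ℚ :- q :* x) refl (q ^ℚ m) q ⟩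
      1ℚ - q * q ^ℚ m ∎
    where
    open ≡-Reasoning
    open +-*-Solver

  converges-geometric-series : ∀ q S → 0ℚ ≤ q → q ≤ ½ → S * (1ℚ - q) ≡ 1ℚ → ConvergesTo (λ m → Σ< m (λ i → q ^ℚ i)) S
  converges-geometric-series q S q≥0 q≤½ S*[1-q]≡1 = converges-cong partial-sum
      (converges-−0 {f = λ _ → S} {g = λ m → S * q ^ℚ m} (converges-const S)
        (subst (ConvergesTo (λ m → S * q ^ℚ m)) (*-zeroʳ S) (converges-*ˡ {f = λ m → q ^ℚ m} S (converges-geometric q q≥0 q≤½))))
    where
    open ≡-Reasoning
    open +-*-Solver
    partial-sum : ∀ m → Σ< m (λ i → q ^ℚ i) ≡ S - S * q ^ℚ m
    partial-sum m = begin
        Σ< m (λ i → q ^ℚ i)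
          ≡⟨ sym (*-identityʳ _) ⟩
        Σ< m (λ i → q ^ℚ i) * 1ℚ
          ≡⟨ cong (Σ< m (λ i → q ^ℚ i) *_) (sym S*[1-q]≡1) ⟩
        Σ< m (λ i → q ^ℚ i) * (S * (1ℚ - q))
          ≡⟨ solve 3 (λ s Q q → s :* (Q :* (con 1ℚ :- q)) := Q :* (s :* (con 1ℚ :- q))) refl (Σ< m (λ i → q ^ℚ i)) S q ⟩
        S * (Σ< m (λ i → q ^ℚ i) * (1ℚ - q))
          ≡⟨ cong (S *_) (geometric-sum q m) ⟩
        S * (1ℚ - q ^ℚ m)
          ≡⟨ solve 2 (λ Q x → Q :* (con 1ℚ :- x) := Q :- Q :* x) refl S (q ^ℚ m) ⟩
        S - S * q ^ℚ m ∎

  converges-eventually-geometric : ∀ (σ : ℕ → ℚ) K Z A q S → Σ< K σ ≡ Z → (∀ i → σ (K ℕ.+ i) ≡ A * q ^ℚ i) →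
    0ℚ ≤ q → q ≤ ½ → S * (1ℚ - q) ≡ 1ℚ → ConvergesTo (λ N → Σ< (suc N) σ) (Z + A * S)
  converges-eventually-geometric σ K Z A q S head tail q≥0 q≤½ S*[1-q]≡1 =
    converges-suc {f = λ n → Σ< n σ} (converges-shift {f = λ n → Σ< n σ} K (converges-cong {f = λ m → Σ< (K ℕ.+ m) σ} split
      (converges-+ {f = λ _ → Z} {g = λ m → A * Σ< m (λ i → q ^ℚ i)} (converges-const Z)
                   (converges-*ˡ {f = λ m → Σ< m (λ i → q ^ℚ i)} A (converges-geometric-series q S q≥0 q≤½ S*[1-q]≡1)))))
    where
    split : ∀ m → Σ< (K ℕ.+ m) σ ≡ Z + A * Σ< m (λ i → q ^ℚ i)
    split m = trans (Σ<-split K m σ) (cong₂ _+_ head (trans (Σ<-cong m (λ i _ → tail i)) (Σ<-*ˡ m A (λ i → q ^ℚ i))))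


module LocalSeries where

  open import Data.Nat as ℕ using (ℕ; zero; suc; _≤_; _<_; z≤n; s≤s; _⊓_; _∸_)
  import Data.Nat.Properties as ℕP
  open import Data.Integer as ℤ using (+_)
  open import Data.Rational as ℚ using (ℚ; 0ℚ; 1ℚ; _+_; _*_; -_; _-_; ½)
  open import Data.Rational.Properties
  open import Data.Rational.Solver using (module +-*-Solver)
  open import Relation.Binary.PropositionalEquality
  open import Defs using (_//_; _^ℚ_; ConvergesTo)
  open FiniteSums
  open Embedding
  open Mobius using (-1ℚ)
  open RationalBounds
  open Convergence

  ^ℚ-+ : ∀ x m n → x ^ℚ (m ℕ.+ n) ≡ x ^ℚ m * x ^ℚ n
  ^ℚ-+ x zero    n = sym (*-identityˡ _)
  ^ℚ-+ x (suc m) n = trans (cong (x *_) (^ℚ-+ x m n)) (sym (*-assoc x _ _))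

  ^ℚ-distrib-* : ∀ x y n → (x * y) ^ℚ n ≡ x ^ℚ n * y ^ℚ n
  ^ℚ-distrib-* x y zero    = refl
  ^ℚ-distrib-* x y (suc n) = trans (cong ((x * y) *_) (^ℚ-distrib-* x y n))
    (solve 4 (λ x y a b → (x :* y) :* (a :* b) := (x :* a) :* (y :* b)) refl x y (x ^ℚ n) (y ^ℚ n))
    where open +-*-Solver

  1^ℚn≡1 : ∀ n → 1ℚ ^ℚ n ≡ 1ℚ
  1^ℚn≡1 zero    = refl
  1^ℚn≡1 (suc n) = trans (*-identityˡ _) (1^ℚn≡1 n)

  -- The p-part of μ(α)(αv,h)/(v·αv) when j = ν_p(v), e = ν_p(α) and β = ν_p(h).
  localTerm : (p β j e : ℕ) → ℚ
  localTerm p β j e = (-1ℚ ^ℚ e) * (fromℕ p ^ℚ ((e ℕ.+ j) ⊓ β)) * (recip p ^ℚ j) * (recip p ^ℚ (e ℕ.+ j))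

  localPair : (p β j : ℕ) → ℚ
  localPair p β j = localTerm p β j 0 + localTerm p β j 1

  zeta2Factor : ℕ → ℚ
  zeta2Factor p = (+ (p ℕ.* p)) // (p ℕ.* p ∸ 1)

  localLimit : (p β : ℕ) → ℚ
  localLimit p β = (1ℚ - recip p) * (recip p ^ℚ β) * zeta2Factor p

  module _ {p} (p≥1 : 1 ≤ p) (β : ℕ) where

    private
      r = recip p

      p^k*r^k≡1 : ∀ k → fromℕ p ^ℚ k * r ^ℚ k ≡ 1ℚ
      p^k*r^k≡1 k = trans (sym (^ℚ-distrib-* (fromℕ p) r k)) (trans (cong (_^ℚ k) (n*recip[n]≡1 p≥1)) (1^ℚn≡1 k))

    localPair-below : ∀ j → j < β → localPair p β j ≡ 0ℚ
    localPair-below j j<β = begin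
        localTerm p β j 0 + localTerm p β j 1
          ≡⟨ cong₂ (λ a b → 1ℚ * (fromℕ p ^ℚ a) * (r ^ℚ j) * (r ^ℚ j) + (-1ℚ * 1ℚ) * (fromℕ p ^ℚ b) * (r ^ℚ j) * (r ^ℚ suc j))
               (ℕP.m≤n⇒m⊓n≡m (ℕP.<⇒≤ j<β)) (ℕP.m≤n⇒m⊓n≡m j<β) ⟩
        1ℚ * (fromℕ p ^ℚ j) * (r ^ℚ j) * (r ^ℚ j) + (-1ℚ * 1ℚ) * (fromℕ p * fromℕ p ^ℚ j) * (r ^ℚ j) * (r * r ^ℚ j)
          ≡⟨ solve 4 (λ P R a b → con 1ℚ :* a :* b :* b :+ (con -1ℚ :* con 1ℚ) :* (P :* a) :* b :* (R :* b)
                                 := (a :* b) :* b :* (con 1ℚ :- P :* R)) refl (fromℕ p) r (fromℕ p ^ℚ j) (r ^ℚ j) ⟩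
        (fromℕ p ^ℚ j * r ^ℚ j) * r ^ℚ j * (1ℚ - fromℕ p * r)
          ≡⟨ cong₂ (λ a b → a * r ^ℚ j * (1ℚ - b)) (p^k*r^k≡1 j) (n*recip[n]≡1 p≥1) ⟩
        1ℚ * r ^ℚ j * (1ℚ - 1ℚ)
          ≡⟨ solve 1 (λ a → con 1ℚ :* a :* (con 1ℚ :- con 1ℚ) := con 0ℚ) refl (r ^ℚ j) ⟩
        0ℚ ∎
      where
      open ≡-Reasoning
      open +-*-Solver

    localTerm-0-above : ∀ i → localTerm p β (β ℕ.+ i) 0 ≡ r ^ℚ β * (r * r) ^ℚ i
    localTerm-0-above i = begin
        1ℚ * (fromℕ p ^ℚ ((β ℕ.+ i) ⊓ β)) * (r ^ℚ (β ℕ.+ i)) * (r ^ℚ (β ℕ.+ i))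
          ≡⟨ cong₂ (λ a b → 1ℚ * (fromℕ p ^ℚ a) * b * b) (ℕP.m≥n⇒m⊓n≡n (ℕP.m≤m+n β i)) (^ℚ-+ r β i) ⟩
        1ℚ * (fromℕ p ^ℚ β) * (r ^ℚ β * r ^ℚ i) * (r ^ℚ β * r ^ℚ i)
          ≡⟨ solve 3 (λ P R a → con 1ℚ :* P :* (R :* a) :* (R :* a) := (P :* R) :* (R :* (a :* a))) refl (fromℕ p ^ℚ β) (r ^ℚ β) (r ^ℚ i) ⟩
        (fromℕ p ^ℚ β * r ^ℚ β) * (r ^ℚ β * (r ^ℚ i * r ^ℚ i))
          ≡⟨ cong₂ (λ a b → a * (r ^ℚ β * b)) (p^k*r^k≡1 β) (sym (^ℚ-distrib-* r r i)) ⟩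
        1ℚ * (r ^ℚ β * (r * r) ^ℚ i)
          ≡⟨ *-identityˡ _ ⟩
        r ^ℚ β * (r * r) ^ℚ i ∎
      where
      open ≡-Reasoning
      open +-*-Solver

    localTerm-1-above : ∀ i → localTerm p β (β ℕ.+ i) 1 ≡ - (r ^ℚ β * (r * r) ^ℚ i * r)
    localTerm-1-above i = begin
        (-1ℚ * 1ℚ) * (fromℕ p ^ℚ (suc (β ℕ.+ i) ⊓ β)) * (r ^ℚ (β ℕ.+ i)) * (r * r ^ℚ (β ℕ.+ i))
          ≡⟨ cong₂ (λ a b → (-1ℚ * 1ℚ) * (fromℕ p ^ℚ a) * b * (r * b)) (ℕP.m≥n⇒m⊓n≡n (ℕP.m≤n⇒m≤1+n (ℕP.m≤m+n β i))) (^ℚ-+ r β i) ⟩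
        (-1ℚ * 1ℚ) * (fromℕ p ^ℚ β) * (r ^ℚ β * r ^ℚ i) * (r * (r ^ℚ β * r ^ℚ i))
          ≡⟨ solve 4 (λ P R a r → (con -1ℚ :* con 1ℚ) :* P :* (R :* a) :* (r :* (R :* a)) := :- ((P :* R) :* (R :* (a :* a)) :* r))
                     refl (fromℕ p ^ℚ β) (r ^ℚ β) (r ^ℚ i) r ⟩
        - ((fromℕ p ^ℚ β * r ^ℚ β) * (r ^ℚ β * (r ^ℚ i * r ^ℚ i)) * r)
          ≡⟨ cong₂ (λ a b → - (a * (r ^ℚ β * b) * r)) (p^k*r^k≡1 β) (sym (^ℚ-distrib-* r r i)) ⟩
        - (1ℚ * (r ^ℚ β * (r * r) ^ℚ i) * r)
          ≡⟨ cong (λ z → - (z * r)) (*-identityˡ (r ^ℚ β * (r * r) ^ℚ i)) ⟩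
        - (r ^ℚ β * (r * r) ^ℚ i * r) ∎
      where
      open ≡-Reasoning
      open +-*-Solver

    localPair-above : ∀ i → localPair p β (β ℕ.+ i) ≡ r ^ℚ β * (1ℚ - r) * (r * r) ^ℚ i
    localPair-above i = trans (cong₂ _+_ (localTerm-0-above i) (localTerm-1-above i))
      (solve 3 (λ a q r → a :* q :+ :- (a :* q :* r) := a :* (con 1ℚ :- r) :* q) refl (r ^ℚ β) ((r * r) ^ℚ i) r)
      where open +-*-Solver

  [1+n]//n*[1-recip[1+n]]≡1 : ∀ n → 1 ≤ n → ((+ suc n) // n) * (1ℚ - recip (suc n)) ≡ 1ℚ
  [1+n]//n*[1-recip[1+n]]≡1 n n≥1 = begin
      ((+ suc n) // n) * (1ℚ - s)
        ≡⟨ cong (_* (1ℚ - s)) (z//n≡z*recip[n] (+ suc n) n≥1) ⟩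
      fromℕ (suc n) * r * (1ℚ - s)
        ≡⟨ solve 3 (λ P r s → P :* r :* (con 1ℚ :- s) := P :* r :- r :* (P :* s)) refl (fromℕ (suc n)) r s ⟩
      fromℕ (suc n) * r - r * (fromℕ (suc n) * s) ≡⟨ cong₂ (λ a b → a * r - r * b) (fromℕ-+ 1 n) (n*recip[n]≡1 {suc n} (s≤s z≤n)) ⟩
      (1ℚ + fromℕ n) * r - r * 1ℚ
        ≡⟨ solve 2 (λ N r → (con 1ℚ :+ N) :* r :- r :* con 1ℚ := N :* r) refl (fromℕ n) r ⟩
      fromℕ n * r
        ≡⟨ n*recip[n]≡1 n≥1 ⟩
      1ℚ ∎
    where
    open ≡-Reasoning
    open +-*-Solver
    r = recip n
    s = recip (suc n)

  zeta2Factor*[1-recip²]≡1 : ∀ {p} → 2 ≤ p → zeta2Factor p * (1ℚ - recip p * recip p) ≡ 1ℚ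
  zeta2Factor*[1-recip²]≡1 {p} p≥2 = begin
      (+ (p ℕ.* p)) // n * (1ℚ - recip p * recip p)  ≡⟨ cong (λ z → (+ (p ℕ.* p)) // n * (1ℚ - z)) (sym (recip-* p≥1 p≥1)) ⟩
      (+ (p ℕ.* p)) // n * (1ℚ - recip (p ℕ.* p))    ≡⟨ cong (λ m → (+ m) // n * (1ℚ - recip m)) p*p≡1+n ⟩
      (+ suc n) // n * (1ℚ - recip (suc n))          ≡⟨ [1+n]//n*[1-recip[1+n]]≡1 n n≥1 ⟩
      1ℚ                                             ∎
    where
    open ≡-Reasoning
    p≥1 = ℕP.≤-trans (s≤s z≤n) p≥2
    n = p ℕ.* p ∸ 1
    p*p≥2 : 2 ≤ p ℕ.* p
    p*p≥2 = ℕP.≤-trans p≥2 (ℕP.m≤m*n p p {{ℕ.>-nonZero p≥1}})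
    p*p≡1+n : p ℕ.* p ≡ suc n
    p*p≡1+n = sym (ℕP.m+[n∸m]≡n {1} (ℕP.≤-trans (s≤s z≤n) p*p≥2))
    n≥1 : 1 ≤ n
    n≥1 = ℕP.∸-monoˡ-≤ 1 p*p≥2

  recip²-nonNeg : ∀ {p} → 1 ≤ p → 0ℚ ℚ.≤ recip p * recip p
  recip²-nonNeg {p} p≥1 = *-nonNeg (recip-nonNeg p) (recip-nonNeg p)

  recip²≤½ : ∀ {p} → 2 ≤ p → recip p * recip p ℚ.≤ ½
  recip²≤½ {p} p≥2 = subst (ℚ._≤ ½) (recip-* p≥1 p≥1) (recip-antimono-≤ (s≤s z≤n) (ℕP.≤-trans p≥2 (ℕP.m≤m*n p p {{ℕ.>-nonZero p≥1}})))
    where p≥1 = ℕP.≤-trans (s≤s z≤n) p≥2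

  localPair-converges : ∀ {p} β → 2 ≤ p → ConvergesTo (λ N → Σ< (suc N) (localPair p β)) (localLimit p β)
  localPair-converges {p} β p≥2 = subst (ConvergesTo (λ N → Σ< (suc N) (localPair p β))) limit≡
    (converges-eventually-geometric (localPair p β) β 0ℚ (r ^ℚ β * (1ℚ - r)) (r * r) (zeta2Factor p)
      (Σ<-zero β (localPair-below p≥1 β)) (localPair-above p≥1 β) (recip²-nonNeg p≥1) (recip²≤½ p≥2) (zeta2Factor*[1-recip²]≡1 p≥2))
    where
    r = recip p
    p≥1 = ℕP.≤-trans (s≤s z≤n) p≥2
    limit≡ : 0ℚ + r ^ℚ β * (1ℚ - r) * zeta2Factor p ≡ localLimit p β
    limit≡ = solve 3 (λ a r Q → con 0ℚ :+ a :* (con 1ℚ :- r) :* Q := (con 1ℚ :- r) :* a :* Q) refl (r ^ℚ β) r (zeta2Factor p)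
      where open +-*-Solver


module TwoLocalSeries (a b t : ℕ) where

  open import Data.Bool using (true; false; _∧_)
  open import Data.Bool.Properties using (∧-zeroʳ)
  open import Data.Nat as ℕ using (suc; _≤_; _<_; z≤n; s≤s; _+_; _∸_; _^_; _≤?_)
  open import Data.Nat.Properties
  open import Data.Rational as ℚ using (ℚ; 0ℚ; 1ℚ; ½)
  import Data.Rational.Properties as ℚP
  open import Data.Rational.Solver using (module +-*-Solver)
  open import Relation.Nullary.Decidable using (⌊_⌋)
  open import Relation.Binary.PropositionalEquality
  open import Defs using (_^ℚ_; ConvergesTo)
  open Booleans
  open FiniteSums
  open Embedding
  open Condition using (cond₂)
  open Convergence
  open LocalSeries

  σ₂ : ℕ → ℚ
  σ₂ j = Σ< 2 (λ e → [ cond₂ a b t j e ]· localTerm 2 b j e)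

  private
    r q : ℚ
    r = recip 2
    q = r ℚ.* r

    σ₂-none : ∀ j → cond₂ a b t j 0 ≡ false → cond₂ a b t j 1 ≡ false → σ₂ j ≡ 0ℚ
    σ₂-none j c₀ c₁ = cong₂ (λ x y → (0ℚ ℚ.+ [ x ]· localTerm 2 b j 0) ℚ.+ [ y ]· localTerm 2 b j 1) c₀ c₁

    σ₂-both : ∀ j → cond₂ a b t j 0 ≡ true → cond₂ a b t j 1 ≡ true → σ₂ j ≡ localPair 2 b j
    σ₂-both j c₀ c₁ = trans (cong₂ (λ x y → (0ℚ ℚ.+ [ x ]· localTerm 2 b j 0) ℚ.+ [ y ]· localTerm 2 b j 1) c₀ c₁)
                            (cong (ℚ._+ localTerm 2 b j 1) (ℚP.+-identityˡ (localTerm 2 b j 0)))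

    cond₂-above : ∀ j e → b < e + j → t ≤ a + j → cond₂ a b t j e ≡ true
    cond₂-above j e b<e+j t≤a+j = cong₂ _∧_ (⌊⌋≡true (suc b ≤? e + j) b<e+j) (⌊⌋≡true (t ≤? a + j) t≤a+j)

    r^b*[1-r]*q^k*S≡ : ∀ k → r ^ℚ b ℚ.* (1ℚ ℚ.- r) ℚ.* q ^ℚ k ℚ.* zeta2Factor 2 ≡ q ^ℚ k ℚ.* localLimit 2 b
    r^b*[1-r]*q^k*S≡ k = solve 4 (λ x r y Q → x :* (con 1ℚ :- r) :* y :* Q := y :* ((con 1ℚ :- r) :* x :* Q)) refl (r ^ℚ b) r (q ^ℚ k) (zeta2Factor 2)
      where open +-*-Solver

  σ₂-converges-γ≥1 : 1 ≤ t ∸ (a + b) → ConvergesTo (λ N → Σ< (suc N) σ₂) (recip (4 ^ (t ∸ (a + b))) ℚ.* localLimit 2 b)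
  σ₂-converges-γ≥1 γ≥1 = subst (ConvergesTo (λ N → Σ< (suc N) σ₂)) limit≡
      (converges-eventually-geometric σ₂ (b + γ) 0ℚ (r ^ℚ b ℚ.* (1ℚ ℚ.- r) ℚ.* q ^ℚ γ) q (zeta2Factor 2) head tail
        (recip²-nonNeg {2} (s≤s z≤n)) (recip²≤½ {2} ≤-refl) (zeta2Factor*[1-recip²]≡1 {2} ≤-refl))
    where
    γ = t ∸ (a + b)
    t≡a+b+γ : t ≡ a + b + γ
    t≡a+b+γ = sym (m+[n∸m]≡n {a + b} (<⇒≤ (m∸n≢0⇒n<m (λ γ≡0 → <⇒≢ γ≥1 (sym γ≡0)))))
    head : Σ< (b + γ) σ₂ ≡ 0ℚ
    head = Σ<-zero (b + γ) λ j j<b+γ → σ₂-none j (off j j<b+γ 0) (off j j<b+γ 1)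
      where
      off : ∀ j → j < b + γ → ∀ e → cond₂ a b t j e ≡ false
      off j j<b+γ e = trans (cong (⌊ suc b ≤? e + j ⌋ ∧_) (⌊⌋≡false (t ≤? a + j) λ t≤a+j →
                              <⇒≱ (+-monoʳ-< a j<b+γ) (≤-trans (≤-reflexive (sym (trans t≡a+b+γ (+-assoc a b γ)))) t≤a+j)))
                            (∧-zeroʳ _)
    tail : ∀ i → σ₂ (b + γ + i) ≡ r ^ℚ b ℚ.* (1ℚ ℚ.- r) ℚ.* q ^ℚ γ ℚ.* q ^ℚ i
    tail i = begin
        σ₂ (b + γ + i)                               ≡⟨ σ₂-both j (on 0) (on 1) ⟩
        localPair 2 b (b + γ + i)                    ≡⟨ cong (localPair 2 b) (+-assoc b γ i) ⟩
        localPair 2 b (b + (γ + i))                  ≡⟨ localPair-above {2} (s≤s z≤n) b (γ + i) ⟩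
        r ^ℚ b ℚ.* (1ℚ ℚ.- r) ℚ.* q ^ℚ (γ + i)        ≡⟨ cong (r ^ℚ b ℚ.* (1ℚ ℚ.- r) ℚ.*_) (^ℚ-+ q γ i) ⟩
        r ^ℚ b ℚ.* (1ℚ ℚ.- r) ℚ.* (q ^ℚ γ ℚ.* q ^ℚ i) ≡⟨ sym (ℚP.*-assoc (r ^ℚ b ℚ.* (1ℚ ℚ.- r)) (q ^ℚ γ) (q ^ℚ i)) ⟩
        r ^ℚ b ℚ.* (1ℚ ℚ.- r) ℚ.* q ^ℚ γ ℚ.* q ^ℚ i   ∎
      where
      open ≡-Reasoning
      j = b + γ + i
      on : ∀ e → cond₂ a b t j e ≡ true
      on e = cond₂-above j e (≤-trans (subst (_≤ b + γ) (+-comm b 1) (+-monoʳ-≤ b γ≥1)) (≤-trans (m≤m+n (b + γ) i) (m≤n+m j e)))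
                             (≤-trans (≤-reflexive (trans t≡a+b+γ (+-assoc a b γ))) (+-monoʳ-≤ a (m≤m+n (b + γ) i)))
    limit≡ : 0ℚ ℚ.+ r ^ℚ b ℚ.* (1ℚ ℚ.- r) ℚ.* q ^ℚ γ ℚ.* zeta2Factor 2 ≡ recip (4 ^ γ) ℚ.* localLimit 2 b
    limit≡ = trans (ℚP.+-identityˡ _) (trans (r^b*[1-r]*q^k*S≡ γ) (cong (ℚ._* localLimit 2 b) (sym (recip-^ {4} γ (s≤s z≤n)))))

  -- With γ = 0 the condition first holds at j = ν₂(h), and only for e = 1: an isolated negative term.
  σ₂-converges-γ≡0 : t ∸ (a + b) ≡ 0 → ConvergesTo (λ N → Σ< (suc N) σ₂) ((ℚ.- ½) ℚ.* localLimit 2 b)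
  σ₂-converges-γ≡0 γ≡0 = subst (ConvergesTo (λ N → Σ< (suc N) σ₂)) limit≡
      (converges-eventually-geometric σ₂ (suc b) isolated (r ^ℚ b ℚ.* (1ℚ ℚ.- r) ℚ.* q) q (zeta2Factor 2) head tail
        (recip²-nonNeg {2} (s≤s z≤n)) (recip²≤½ {2} ≤-refl) (zeta2Factor*[1-recip²]≡1 {2} ≤-refl))
    where
    t≤a+b : t ≤ a + b
    t≤a+b = m∸n≡0⇒m≤n γ≡0
    isolated = ℚ.- (r ^ℚ b ℚ.* 1ℚ ℚ.* r)
    off : ∀ j → j < b → ∀ e → e ≤ 1 → cond₂ a b t j e ≡ false
    off j j<b e e≤1 = cong (_∧ ⌊ t ≤? a + j ⌋) (⌊⌋≡false (suc b ≤? e + j) (<⇒≱ (s≤s (≤-trans (+-monoˡ-≤ j e≤1) j<b))))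
    σ₂[b]≡isolated : σ₂ b ≡ isolated
    σ₂[b]≡isolated = begin
        (0ℚ ℚ.+ [ cond₂ a b t b 0 ]· localTerm 2 b b 0) ℚ.+ [ cond₂ a b t b 1 ]· localTerm 2 b b 1
          ≡⟨ cong₂ (λ x y → (0ℚ ℚ.+ [ x ]· localTerm 2 b b 0) ℚ.+ [ y ]· localTerm 2 b b 1)
                   (cong (_∧ ⌊ t ≤? a + b ⌋) (⌊⌋≡false (suc b ≤? b) (<-irrefl refl))) (cond₂-above b 1 ≤-refl t≤a+b) ⟩
        0ℚ ℚ.+ localTerm 2 b b 1
          ≡⟨ ℚP.+-identityˡ _ ⟩
        localTerm 2 b b 1
          ≡⟨ cong (λ j → localTerm 2 b j 1) (sym (+-identityʳ b)) ⟩
        localTerm 2 b (b + 0) 1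
          ≡⟨ localTerm-1-above {2} (s≤s z≤n) b 0 ⟩
        isolated ∎
      where open ≡-Reasoning
    head : Σ< (suc b) σ₂ ≡ isolated
    head = trans (cong (ℚ._+ σ₂ b) (Σ<-zero b (λ j j<b → σ₂-none j (off j j<b 0 z≤n) (off j j<b 1 (s≤s z≤n)))))
                 (trans (ℚP.+-identityˡ (σ₂ b)) σ₂[b]≡isolated)
    tail : ∀ i → σ₂ (suc b + i) ≡ r ^ℚ b ℚ.* (1ℚ ℚ.- r) ℚ.* q ℚ.* q ^ℚ i
    tail i = begin
        σ₂ (suc b + i)                           ≡⟨ cong σ₂ (sym (+-suc b i)) ⟩
        σ₂ (b + suc i)                           ≡⟨ σ₂-both j (on 0) (on 1) ⟩
        localPair 2 b (b + suc i)                ≡⟨ localPair-above {2} (s≤s z≤n) b (suc i) ⟩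
        r ^ℚ b ℚ.* (1ℚ ℚ.- r) ℚ.* (q ℚ.* q ^ℚ i) ≡⟨ sym (ℚP.*-assoc (r ^ℚ b ℚ.* (1ℚ ℚ.- r)) q (q ^ℚ i)) ⟩
        r ^ℚ b ℚ.* (1ℚ ℚ.- r) ℚ.* q ℚ.* q ^ℚ i   ∎
      where
      open ≡-Reasoning
      j = b + suc i
      on : ∀ e → cond₂ a b t j e ≡ true
      on e = cond₂-above j e (≤-trans (≤-trans (s≤s (m≤m+n b i)) (≤-reflexive (sym (+-suc b i)))) (m≤n+m j e))
                             (≤-trans t≤a+b (+-monoʳ-≤ a (m≤m+n b (suc i))))
    limit≡ : isolated ℚ.+ r ^ℚ b ℚ.* (1ℚ ℚ.- r) ℚ.* q ℚ.* zeta2Factor 2 ≡ (ℚ.- ½) ℚ.* localLimit 2 b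
    limit≡ = solve 1 (λ x → :- (x :* con 1ℚ :* con ½) :+ x :* (con 1ℚ :- con ½) :* (con ½ :* con ½) :* con (zeta2Factor 2)
                            := con (ℚ.- ½) :* ((con 1ℚ :- con ½) :* x :* con (zeta2Factor 2))) refl (r ^ℚ b)
      where open +-*-Solver


module Summand (d h : ℕ) (d≥1 : 1 ℕ.≤ d) (h≥1 : 1 ℕ.≤ h) where

  open import Data.Bool using (true)
  open import Data.Nat as ℕ using (ℕ; _≤_; z≤n; s≤s; _^_; _*_; _+_; _⊓_)
  open import Data.Nat.Properties
  open import Data.Nat.Divisibility
  open import Data.Nat.Primality
  open import Data.Nat.GCD using (gcd)
  open import Data.Integer as ℤ using (ℤ; +_)
  open import Data.Rational as ℚ using (ℚ)
  open import Data.Rational.Solver using (module +-*-Solver)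
  open import Data.List using (List; map)
  open import Data.List.Membership.Propositional using (_∈_)
  open import Data.Product using (proj₁; proj₂)
  open import Data.Sum using (inj₁; inj₂)
  open import Relation.Binary.PropositionalEquality hiding (J)
  open import Defs
  open Valuation
  open Box
  open Embedding
  open Divisors
  open Mobius using (-1ℚ; μ≡∏[-1]^ν)
  open Totient
  open ProductLemmas
  open LocalSeries using (localTerm)

  ps : List ℕ
  ps = primeDivisors d

  β : ℕ → ℕ
  β p = ν p h

  private variable J v α : ℕ

  ∈ps⇒≥1 : ∀ {p} → p ∈ ps → 1 ≤ p
  ∈ps⇒≥1 {p} p∈ = ≤-trans (s≤s z≤n) (prime⇒≥2 (proj₁ (∈-primeDivisors⁻ {p} {d} p∈)))

  φ[d]≡d*eulerProduct : ∀ {n} → 1 ≤ n → (∀ q → Prime q → q ∣ n → q ∈ ps) → d ∣ n → fromℕ (φ n) ≡ fromℕ n ℚ.* eulerProduct ps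
  φ[d]≡d*eulerProduct {n} n≥1 factors d∣n = φ≡n*eulerProduct n ps (primeDivisors-distinct d) n≥1 factors
                                              (λ q q∈ → ∣-trans (proj₂ (∈-primeDivisors⁻ {q} {d} q∈)) d∣n)

  φ[d*v]≡φ[d]*v : InBox ps J v ≡ true → φ (d * v) ≡ φ d * v
  φ[d*v]≡φ[d]*v {J} {v} v∈ = fromℕ-injective (begin
      fromℕ (φ (d * v))
        ≡⟨ φ[d]≡d*eulerProduct (m*n≥1 d≥1 v≥1) d*v-factors (∣m⇒∣m*n v ∣-refl) ⟩
      fromℕ (d * v) ℚ.* eulerProduct ps
        ≡⟨ cong (ℚ._* eulerProduct ps) (fromℕ-* d v) ⟩
      fromℕ d ℚ.* fromℕ v ℚ.* eulerProduct ps
        ≡⟨ solve 3 (λ a b c → a :* b :* c := a :* c :* b) refl (fromℕ d) (fromℕ v) _ ⟩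
      fromℕ d ℚ.* eulerProduct ps ℚ.* fromℕ v
        ≡⟨ cong (ℚ._* fromℕ v) (sym (φ[d]≡d*eulerProduct d≥1 (λ q pq q∣d → ∈-primeDivisors⁺ d≥1 pq q∣d) ∣-refl)) ⟩
      fromℕ (φ d) ℚ.* fromℕ v
        ≡⟨ sym (fromℕ-* (φ d) v) ⟩
      fromℕ (φ d * v)                             ∎)
    where
    open ≡-Reasoning
    open +-*-Solver
    v≥1 = InBox⇒≥1 (primeDivisors-distinct d) v∈
    d*v-factors : ∀ q → Prime q → q ∣ d * v → q ∈ ps
    d*v-factors q pq q∣d*v with euclidsLemma d v pq q∣d*v
    ... | inj₁ q∣d = ∈-primeDivisors⁺ d≥1 pq q∣d
    ... | inj₂ q∣v = InBox-primeFactors (primeDivisors-distinct d) v∈ q pq q∣v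

  φ[d*v]≥1 : InBox ps J v ≡ true → 1 ≤ φ (d * v)
  φ[d*v]≥1 v∈ = subst (1 ≤_) (sym (φ[d*v]≡φ[d]*v v∈)) (m*n≥1 (φ≥1 d≥1) (InBox⇒≥1 (primeDivisors-distinct d) v∈))

  recip≡∏ : InBox ps J v ≡ true → recip v ≡ prodℚ (map (λ p → recip p ^ℚ ν p v) ps)
  recip≡∏ {J} {v} v∈ = trans (cong recip (InBox⇒≡∏p^ν (primeDivisors-distinct d) v∈)) (recip-∏p^e (λ p → ν p v) ps (λ p → ∈ps⇒≥1))

  gcd≡∏ : InBox ps J v ≡ true → fromℕ (gcd v h) ≡ prodℚ (map (λ p → fromℕ p ^ℚ (ν p v ⊓ β p)) ps)
  gcd≡∏ {J} {v} v∈ = trans (cong fromℕ (gcd≡∏p^min (primeDivisors-distinct d) v∈ h≥1))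
    (trans (fromℕ-prodℕ (λ q → q ^ (ν q v ⊓ ν q h)) ps) (prodℚ-cong ps (λ q _ → fromℕ-^ q (ν q v ⊓ ν q h))))

  InBox-* : ∀ {qs Ja Jb a b} → DistinctPrimes qs → InBox qs Ja a ≡ true → InBox qs Jb b ≡ true → InBox qs (a * b) (a * b) ≡ true
  InBox-* {qs} {Ja} {Jb} {a} {b} qs-ok a∈ b∈ = InBox-intro qs-ok a*b≥1 factors (λ q q∈ → <⇒≤ (ν<n (∈-prime qs-ok q∈) a*b≥1))
    where
    a*b≥1 = m*n≥1 (InBox⇒≥1 qs-ok a∈) (InBox⇒≥1 qs-ok b∈)
    factors : ∀ q → Prime q → q ∣ a * b → q ∈ qs
    factors q pq q∣a*b with euclidsLemma a b pq q∣a*b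
    ... | inj₁ q∣a = InBox-primeFactors qs-ok a∈ q pq q∣a
    ... | inj₂ q∣b = InBox-primeFactors qs-ok b∈ q pq q∣b

  term≡parts : InBox ps J v ≡ true → 1 ≤ α →
    term d h v α ≡ recip (φ d) ℚ.* (((fromℤ (μ α) ℚ.* fromℕ (gcd (α * v) h)) ℚ.* recip v) ℚ.* recip (α * v))
  term≡parts {J} {v} {α} v∈ α≥1 = begin
      (μ α ℤ.* + g) // (φ (d * v) * (α * v))
        ≡⟨ z//n≡z*recip[n] _ (m*n≥1 (φ[d*v]≥1 v∈) α*v≥1) ⟩
      fromℤ (μ α ℤ.* + g) ℚ.* recip (φ (d * v) * (α * v))
        ≡⟨ cong₂ ℚ._*_ (fromℤ-* (μ α) (+ g)) (recip-* (φ[d*v]≥1 v∈) α*v≥1) ⟩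
      (fromℤ (μ α) ℚ.* fromℕ g) ℚ.* (recip (φ (d * v)) ℚ.* recip (α * v))
        ≡⟨ cong (λ z → (fromℤ (μ α) ℚ.* fromℕ g) ℚ.* (z ℚ.* recip (α * v))) (trans (cong recip (φ[d*v]≡φ[d]*v v∈)) (recip-* (φ≥1 d≥1) v≥1)) ⟩
      (fromℤ (μ α) ℚ.* fromℕ g) ℚ.* ((recip (φ d) ℚ.* recip v) ℚ.* recip (α * v))
        ≡⟨ solve 4 (λ m r s t → m :* ((r :* s) :* t) := r :* ((m :* s) :* t)) refl (fromℤ (μ α) ℚ.* fromℕ g) (recip (φ d)) (recip v) (recip (α * v)) ⟩
      recip (φ d) ℚ.* (((fromℤ (μ α) ℚ.* fromℕ g) ℚ.* recip v) ℚ.* recip (α * v)) ∎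
    where
    open ≡-Reasoning
    open +-*-Solver
    g = gcd (α * v) h
    v≥1 = InBox⇒≥1 (primeDivisors-distinct d) v∈
    α*v≥1 = m*n≥1 α≥1 v≥1

  term≡∏localTerm : InBox ps J v ≡ true → InBox ps 1 α ≡ true →
    term d h v α ≡ recip (φ d) ℚ.* prodℚ (map (λ p → localTerm p (β p) (ν p v) (ν p α)) ps)
  term≡∏localTerm {J} {v} {α} v∈ α∈ = begin
      term d h v α
        ≡⟨ term≡parts v∈ α≥1 ⟩
      recip (φ d) ℚ.* (((fromℤ (μ α) ℚ.* fromℕ (gcd (α * v) h)) ℚ.* recip v) ℚ.* recip (α * v))
        ≡⟨ cong (recip (φ d) ℚ.*_) (cong₂ (λ a b → (a ℚ.* recip v) ℚ.* b)
              (cong₂ ℚ._*_ (μ≡∏[-1]^ν d≥1 α∈) (trans (gcd≡∏ α*v∈) (prodℚ-cong ps λ p p∈ → cong (λ z → fromℕ p ^ℚ (z ⊓ β p)) (ν-*′ p∈))))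
              (trans (recip≡∏ α*v∈) (prodℚ-cong ps λ p p∈ → cong (recip p ^ℚ_) (ν-*′ p∈)))) ⟩
      recip (φ d) ℚ.* (((∏ signs ℚ.* ∏ gcds) ℚ.* recip v) ℚ.* ∏ denominators)
        ≡⟨ cong (λ z → recip (φ d) ℚ.* (((∏ signs ℚ.* ∏ gcds) ℚ.* z) ℚ.* ∏ denominators)) (recip≡∏ v∈) ⟩
      recip (φ d) ℚ.* (((∏ signs ℚ.* ∏ gcds) ℚ.* ∏ (λ p → recip p ^ℚ ν p v)) ℚ.* ∏ denominators)
        ≡⟨ cong (recip (φ d) ℚ.*_) (sym merge) ⟩
      recip (φ d) ℚ.* prodℚ (map (λ p → localTerm p (β p) (ν p v) (ν p α)) ps) ∎
    where
    open ≡-Reasoning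
    ∏ : (ℕ → ℚ) → ℚ
    ∏ f = prodℚ (map f ps)
    α≥1 = InBox⇒≥1 (primeDivisors-distinct d) α∈
    α*v∈ = InBox-* (primeDivisors-distinct d) α∈ v∈
    ν-*′ : ∀ {p} → p ∈ ps → ν p (α * v) ≡ ν p α + ν p v
    ν-*′ {p} p∈ = ν-* (proj₁ (∈-primeDivisors⁻ {p} {d} p∈)) α≥1 (InBox⇒≥1 (primeDivisors-distinct d) v∈)
    signs = λ p → -1ℚ ^ℚ ν p α
    gcds = λ p → fromℕ p ^ℚ ((ν p α + ν p v) ⊓ β p)
    denominators = λ p → recip p ^ℚ (ν p α + ν p v)
    merge : ∏ (λ p → localTerm p (β p) (ν p v) (ν p α)) ≡ ((∏ signs ℚ.* ∏ gcds) ℚ.* ∏ (λ p → recip p ^ℚ ν p v)) ℚ.* ∏ denominators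
    merge = trans (prodℚ-* (λ p → signs p ℚ.* gcds p ℚ.* (recip p ^ℚ ν p v)) denominators ps)
              (cong (ℚ._* ∏ denominators) (trans (prodℚ-* (λ p → signs p ℚ.* gcds p) (λ p → recip p ^ℚ ν p v) ps)
                                                  (cong (ℚ._* ∏ (λ p → recip p ^ℚ ν p v)) (prodℚ-* signs gcds ps))))


module PartialSums where

  open import Data.Bool using (Bool; true; false)
  import Data.Bool as Bool
  open import Data.Nat as ℕ using (ℕ; zero; suc; _≤_; z≤n; _*_; _+_)
  open import Data.Nat.Properties
  open import Data.Nat.Divisibility
  open import Data.Nat.GCD using (gcd; gcd[m,n]≤n)
  open import Data.Integer as ℤ using (ℤ; +_; -[1+_])
  import Data.Integer.Properties as ℤP
  import Data.Integer.Divisibility as ℤD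
  open import Data.Rational as ℚ using (ℚ; 0ℚ; 1ℚ)
  import Data.Rational.Properties as ℚP
  open import Data.Rational.Solver using (module +-*-Solver)
  open import Data.List using ([]; _∷_; map; length; upTo)
  import Data.List.Properties as LP
  open import Data.List.Membership.Propositional using (_∈_)
  open import Data.List.Membership.Propositional.Properties using (∈-filter⁻)
  open import Data.List.Relation.Unary.Any using (here; there)
  open import Data.Product using (_×_; proj₁)
  open import Data.Empty using (⊥-elim)
  open import Relation.Nullary using (¬_)
  open import Relation.Nullary.Decidable using (⌊_⌋)
  open import Relation.Binary.PropositionalEquality hiding (J)
  open import Defs
  open FiniteSums
  open Box using (InBox)
  open Embedding
  open Divisors using (∈-range1⁻)
  open Condition using (condB⇒2∣d×D∣4d)
  open RationalBounds

  αSum : ℕ → ℕ → ℤ → ℕ → ℚ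
  αSum d h D v = sumℚ (map (λ α → [ condB d h D v α ]· term d h v α) (divisors d))

  S₃partial≡Σ≤ : ∀ d h D N → S₃partial d h D N ≡ Σ≤ N (λ v → [ dInf d v ]· αSum d h D v)
  S₃partial≡Σ≤ d h D N = trans (sumℚ-filter (λ v → dInf d v Bool.≟ true) _ (range1 N))
    (trans (sumℚ-range1 N _) (Σ<-cong N (λ i _ → cong (λ b → [ b ]· αSum d h D (suc i)) (⌊b≟true⌋≡b (dInf d (suc i))))))
    where
    ⌊b≟true⌋≡b : ∀ b → ⌊ b Bool.≟ true ⌋ ≡ b
    ⌊b≟true⌋≡b true  = refl
    ⌊b≟true⌋≡b false = refl

  S₃partial≡0 : ∀ d h D → 1 ≤ d → IsFundamentalDiscriminant D → ¬ (2 ∣ d × D ℤD.∣ (+ (4 * d))) → ∀ N → S₃partial d h D N ≡ 0ℚ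
  S₃partial≡0 d h D d≥1 fundamental ¬2∣d×D∣4d N = trans (S₃partial≡Σ≤ d h D N) (Σ<-zero N (λ i _ → no-term (suc i)))
    where
    no-term : ∀ v → [ dInf d v ]· αSum d h D v ≡ 0ℚ
    no-term v with dInf d v in v∣d^∞
    ... | false = refl
    ... | true  = sum-zero (divisors d)
      where
      sum-zero : ∀ αs → sumℚ (map (λ α → [ condB d h D v α ]· term d h v α) αs) ≡ 0ℚ
      sum-zero []       = refl
      sum-zero (α ∷ αs) with condB d h D v α in cond
      ... | true  = ⊥-elim (¬2∣d×D∣4d (condB⇒2∣d×D∣4d {d} {h} {D} {v} {α} d≥1 v∣d^∞ fundamental cond))
      ... | false = trans (ℚP.+-identityˡ _) (sum-zero αs)

  ∣fromℤ∣≡ : ∀ z → ℚ.∣ fromℤ z ∣ ≡ fromℕ ℤ.∣ z ∣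
  ∣fromℤ∣≡ (+ n)    = ℚP.0≤p⇒∣p∣≡p (fromℕ-nonNeg n)
  ∣fromℤ∣≡ -[1+ n ] = trans (cong ℚ.∣_∣ (fromℤ-neg (+ suc n))) (trans (ℚP.∣-p∣≡∣p∣ (fromℕ (suc n))) (ℚP.0≤p⇒∣p∣≡p (fromℕ-nonNeg (suc n))))

  ∣μ∣≤1 : ∀ α → ℤ.∣ μ α ∣ ≤ 1
  ∣μ∣≤1 zero = z≤n
  ∣μ∣≤1 (suc n) with squarefreeB (suc n)
  ... | true  = ≤-reflexive (∣[-1]^k∣≡1 (length (primeDivisors (suc n))))
    where
    ∣[-1]^k∣≡1 : ∀ k → ℤ.∣ (ℤ.- (+ 1)) ℤ.^ k ∣ ≡ 1
    ∣[-1]^k∣≡1 zero    = refl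
    ∣[-1]^k∣≡1 (suc k) = trans (ℤP.∣i*j∣≡∣i∣*∣j∣ (ℤ.- (+ 1)) ((ℤ.- (+ 1)) ℤ.^ k)) (trans (+-identityʳ _) (∣[-1]^k∣≡1 k))
  ... | false = z≤n

  ∣sumℚ∣≤length* : ∀ {A : Set} (f : A → ℚ) (B : ℚ) xs → (∀ x → x ∈ xs → ℚ.∣ f x ∣ ℚ.≤ B) →
                  ℚ.∣ sumℚ (map f xs) ∣ ℚ.≤ fromℕ (length xs) ℚ.* B
  ∣sumℚ∣≤length* f B []       _     = ℚP.≤-reflexive (sym (ℚP.*-zeroˡ B))
  ∣sumℚ∣≤length* f B (x ∷ xs) f≤B = begin
      ℚ.∣ f x ℚ.+ sumℚ (map f xs) ∣
        ≤⟨ ℚP.∣p+q∣≤∣p∣+∣q∣ (f x) _ ⟩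
      ℚ.∣ f x ∣ ℚ.+ ℚ.∣ sumℚ (map f xs) ∣
        ≤⟨ ℚP.+-mono-≤ (f≤B x (here refl)) (∣sumℚ∣≤length* f B xs (λ y y∈ → f≤B y (there y∈))) ⟩
      B ℚ.+ fromℕ (length xs) ℚ.* B
        ≡⟨ solve 2 (λ b l → b :+ l :* b := (con 1ℚ :+ l) :* b) refl B (fromℕ (length xs)) ⟩
      (1ℚ ℚ.+ fromℕ (length xs)) ℚ.* B
        ≡⟨ cong (ℚ._* B) (sym (fromℕ-+ 1 (length xs))) ⟩
      fromℕ (suc (length xs)) ℚ.* B ∎
    where
    open ℚP.≤-Reasoning
    open +-*-Solver

  length-divisors≤ : ∀ d → length (divisors d) ≤ d
  length-divisors≤ d = ≤-trans (LP.length-filter (λ a → a ∣? d) (range1 d)) (≤-reflexive (trans (LP.length-map suc (upTo d)) (LP.length-upTo d)))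

  ∣[b]·x∣≤ : ∀ b x (B : ℚ) → 0ℚ ℚ.≤ B → (b ≡ true → ℚ.∣ x ∣ ℚ.≤ B) → ℚ.∣ [ b ]· x ∣ ℚ.≤ B
  ∣[b]·x∣≤ true  x B _   x≤B = x≤B refl
  ∣[b]·x∣≤ false x B B≥0 _   = B≥0

  module _ (d h : ℕ) (D : ℤ) (d≥1 : 1 ≤ d) (h≥1 : 1 ≤ h) where

    open Summand d h d≥1 h≥1 using (ps; φ[d*v]≡φ[d]*v; φ[d*v]≥1)
    open Totient using (φ≥1)

    h*recip[v²]-nonNeg : ∀ v → 0ℚ ℚ.≤ fromℕ h ℚ.* recip (v * v)
    h*recip[v²]-nonNeg v = *-nonNeg (fromℕ-nonNeg h) (recip-nonNeg (v * v))

    ∣term∣≤ : ∀ {J v α} → InBox ps J v ≡ true → 1 ≤ α → ℚ.∣ term d h v α ∣ ℚ.≤ fromℕ h ℚ.* recip (v * v)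
    ∣term∣≤ {J} {v} {α} v∈ α≥1 = begin
        ℚ.∣ term d h v α ∣                          ≡⟨ cong ℚ.∣_∣ (z//n≡z*recip[n] numerator n≥1) ⟩
        ℚ.∣ fromℤ numerator ℚ.* recip n ∣           ≡⟨ ℚP.∣p*q∣≡∣p∣*∣q∣ (fromℤ numerator) (recip n) ⟩
        ℚ.∣ fromℤ numerator ∣ ℚ.* ℚ.∣ recip n ∣     ≡⟨ cong₂ ℚ._*_ (∣fromℤ∣≡ numerator) (ℚP.0≤p⇒∣p∣≡p (recip-nonNeg n)) ⟩
        fromℕ ℤ.∣ numerator ∣ ℚ.* recip n           ≤⟨ *-mono-≤-nonNeg (fromℕ-nonNeg ℤ.∣ numerator ∣) (recip-nonNeg n)
                                                          (fromℕ-mono-≤ _ h ∣numerator∣≤h) (recip-antimono-≤ {v * v} {n} (Valuation.m*n≥1 v≥1 v≥1) v²≤n) ⟩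
        fromℕ h ℚ.* recip (v * v)                   ∎
      where
      open ℚP.≤-Reasoning
      v≥1 = Box.InBox⇒≥1 (Divisors.primeDivisors-distinct d) v∈
      numerator = μ α ℤ.* (+ gcd (α * v) h)
      n = φ (d * v) * (α * v)
      n≥1 : 1 ≤ n
      n≥1 = Valuation.m*n≥1 (φ[d*v]≥1 v∈) (Valuation.m*n≥1 α≥1 v≥1)
      ∣numerator∣≤h : ℤ.∣ numerator ∣ ≤ h
      ∣numerator∣≤h = ≤-trans (≤-reflexive (ℤP.∣i*j∣≡∣i∣*∣j∣ (μ α) _))
                      (≤-trans (*-monoˡ-≤ (gcd (α * v) h) (∣μ∣≤1 α))
                      (≤-trans (≤-reflexive (*-identityˡ _)) (gcd[m,n]≤n (α * v) h {{ℕ.>-nonZero h≥1}})))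
      v²≤n : v * v ≤ n
      v²≤n = subst (λ z → v * v ≤ z * (α * v)) (sym (φ[d*v]≡φ[d]*v v∈))
                   (*-mono-≤ (m≤n*m v (φ d) {{ℕ.>-nonZero (φ≥1 d≥1)}}) (m≤n*m v α {{ℕ.>-nonZero α≥1}}))

    ∣αSum∣≤ : ∀ {J v} → InBox ps J v ≡ true → ℚ.∣ αSum d h D v ∣ ℚ.≤ fromℕ (d * h) ℚ.* recip (v * v)
    ∣αSum∣≤ {J} {v} v∈ = begin
        ℚ.∣ αSum d h D v ∣                                     ≤⟨ ∣sumℚ∣≤length* _ (fromℕ h ℚ.* recip (v * v)) (divisors d) each-term ⟩
        fromℕ (length (divisors d)) ℚ.* (fromℕ h ℚ.* recip (v * v)) ≤⟨ ℚP.*-monoʳ-≤-nonNeg (fromℕ h ℚ.* recip (v * v)) {{ℚ.nonNegative (h*recip[v²]-nonNeg v)}}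
                                                                    (fromℕ-mono-≤ _ _ (length-divisors≤ d)) ⟩
        fromℕ d ℚ.* (fromℕ h ℚ.* recip (v * v))                 ≡⟨ sym (ℚP.*-assoc (fromℕ d) (fromℕ h) _) ⟩
        fromℕ d ℚ.* fromℕ h ℚ.* recip (v * v)                   ≡⟨ cong (ℚ._* recip (v * v)) (sym (fromℕ-* d h)) ⟩
        fromℕ (d * h) ℚ.* recip (v * v)                         ∎
      where
      open ℚP.≤-Reasoning
      each-term : ∀ α → α ∈ divisors d → ℚ.∣ [ condB d h D v α ]· term d h v α ∣ ℚ.≤ fromℕ h ℚ.* recip (v * v)
      each-term α α∈ = ∣[b]·x∣≤ (condB d h D v α) (term d h v α) _ (h*recip[v²]-nonNeg v)
        (λ _ → ∣term∣≤ v∈ (proj₁ (∈-range1⁻ (proj₁ (∈-filter⁻ (λ a → a ∣? d) {xs = range1 d} α∈)))))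


module Factorisation (d h : ℕ) (D : ℤ) (d≥1 : 1 ℕ.≤ d) (h≥1 : 1 ℕ.≤ h) (2∣d : 2 ∣ d) (D∣4d : ℤ.∣ D ∣ ∣ 4 ℕ.* d) where

  open import Data.Bool using (Bool; true; false; if_then_else_; _∨_; not)
  open import Data.Nat as ℕ using (zero; suc; _≤_; _<_; _^_; _*_; _+_; _≟_; _≤?_)
  open import Data.Nat.Properties
  open import Data.Nat.Primality using (prime[2])
  open import Data.Nat.GCD using (gcd)
  open import Data.Integer as ℤ using (+_)
  open import Data.Rational as ℚ using (ℚ; 0ℚ; 1ℚ)
  import Data.Rational.Properties as ℚP
  open import Data.Rational.Solver using (module +-*-Solver)
  open import Data.List using (map)
  open import Data.List.Membership.Propositional using (_∈_)
  open import Data.Product using (proj₁)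
  open import Relation.Nullary using (Dec; yes; no)
  open import Relation.Nullary.Decidable using (⌊_⌋)
  open import Relation.Binary.PropositionalEquality hiding (J)
  open import Defs
  open Booleans
  open FiniteSums
  open Valuation
  open Box
  open Embedding
  open Divisors
  open Mobius using (μ≡0-outside-box; sum-divisors≡boxSum)
  open Totient using (eulerProduct; φ≥1)
  open ProductLemmas
  open Condition using (cond₂; module TwoAdic)
  open TwoAdic d h D d≥1 h≥1 D∣4d using (condB≡cond₂)
  open RationalBounds
  open Convergence
  open LocalSeries
  open Summand d h d≥1 h≥1
  open PartialSums

  private variable J v : ℕ

  cond : ℕ → ℕ → Bool
  cond = cond₂ (ν₂ d) (ν₂ h) (ν₂ ℤ.∣ D ∣)

  -- The summation condition only constrains the 2-adic valuations, so it is imposed on the factor at p = 2 alone.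
  guardedTerm : ℕ → ℕ → ℕ → ℚ
  guardedTerm p j e = [ not ⌊ p ≟ 2 ⌋ ∨ cond j e ]· localTerm p (β p) j e

  localSum : ℕ → ℕ → ℚ
  localSum p j = Σ< 2 (guardedTerm p j)

  boxTerm : ℕ → ℚ
  boxTerm v = recip (φ d) ℚ.* prodℚ (map (λ p → localSum p (ν p v)) ps)

  private
    ps-distinct : DistinctPrimes ps
    ps-distinct = primeDivisors-distinct d

    2∈ps : 2 ∈ ps
    2∈ps = ∈-primeDivisors⁺ d≥1 prime[2] 2∣d

  summand≡∏guardedTerm : InBox ps J v ≡ true → ∀ α → InBox ps 1 α ≡ true →
    [ condB d h D v α ]· term d h v α ≡ recip (φ d) ℚ.* prodℚ (map (λ p → guardedTerm p (ν p v) (ν p α)) ps)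
  summand≡∏guardedTerm {J} {v} v∈ α α∈ = begin
      [ condB d h D v α ]· term d h v α
        ≡⟨ cong (λ b → [ b ]· term d h v α) (condB≡cond₂ (InBox⇒≥1 ps-distinct v∈) (InBox⇒≥1 ps-distinct α∈) (InBox-1⇒∣d {d} α∈)) ⟩
      [ cond (ν₂ v) (ν₂ α) ]· term d h v α
        ≡⟨ cong ([ cond (ν₂ v) (ν₂ α) ]·_) (term≡∏localTerm v∈ α∈) ⟩
      [ cond (ν₂ v) (ν₂ α) ]· (recip (φ d) ℚ.* prodℚ (map (λ p → localTerm p (β p) (ν p v) (ν p α)) ps))
        ≡⟨ [b]·-*ˡ _ (recip (φ d)) _ ⟩
      recip (φ d) ℚ.* [ cond (ν₂ v) (ν₂ α) ]· prodℚ (map (λ p → localTerm p (β p) (ν p v) (ν p α)) ps)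
        ≡⟨ cong (recip (φ d) ℚ.*_) ([c]·prodℚ≡prodℚ[c]· ps ps-distinct 2∈ps (λ p → cond (ν p v) (ν p α)) (λ p → localTerm p (β p) (ν p v) (ν p α))) ⟩
      recip (φ d) ℚ.* prodℚ (map (λ p → guardedTerm p (ν p v) (ν p α)) ps) ∎
    where open ≡-Reasoning

  αSum≡boxTerm : InBox ps J v ≡ true → αSum d h D v ≡ boxTerm v
  αSum≡boxTerm {J} {v} v∈ = begin
      αSum d h D v
        ≡⟨ sum-divisors≡boxSum d summand d≥1 summand-outside-box ⟩
      boxSum ps 1 summand
        ≡⟨ boxSum-cong 1 ps-distinct (summand≡∏guardedTerm v∈) ⟩
      boxSum ps 1 (λ α → recip (φ d) ℚ.* prodℚ (map (λ p → guardedTerm p (ν p v) (ν p α)) ps))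
        ≡⟨ boxSum-*ˡ ps 1 (recip (φ d)) _ ⟩
      recip (φ d) ℚ.* boxSum ps 1 (λ α → prodℚ (map (λ p → guardedTerm p (ν p v) (ν p α)) ps))
        ≡⟨ cong (recip (φ d) ℚ.*_) (boxSum-multiplicative ps 1 (λ p e → guardedTerm p (ν p v) e) ps-distinct) ⟩
      boxTerm v ∎
    where
    open ≡-Reasoning
    summand : ℕ → ℚ
    summand α = [ condB d h D v α ]· term d h v α
    summand-outside-box : ∀ α → α ∣ d → InBox ps 1 α ≡ false → summand α ≡ 0ℚ
    summand-outside-box α α∣d α∉ with condB d h D v α
    ... | false = refl
    ... | true  = trans (cong (λ z → (z ℤ.* (+ gcd (α * v) h)) // (φ (d * v) * (α * v))) (μ≡0-outside-box d≥1 α∣d α∉))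
                        (0//n≡0 (φ (d * v) * (α * v)))
      where
      0//n≡0 : ∀ n → (+ 0) // n ≡ 0ℚ
      0//n≡0 zero    = refl
      0//n≡0 (suc n) = ℚP.0/n≡0 (suc n)

  truncatedProduct : ℕ → ℚ
  truncatedProduct N = recip (φ d) ℚ.* prodℚ (map (λ p → Σ< (suc N) (localSum p)) ps)

  tail : ℕ → ℚ
  tail N = Σ< (boxBound ps N) (λ i → [ InBox ps N (suc (N + i)) ]· boxTerm (suc (N + i)))

  boxSum-boxTerm : ∀ N → boxSum ps N boxTerm ≡ truncatedProduct N
  boxSum-boxTerm N = trans (boxSum-*ˡ ps N (recip (φ d)) _) (cong (recip (φ d) ℚ.*_) (boxSum-multiplicative ps N localSum ps-distinct))

  Σ≤-dInf≡Σ≤-InBox : ∀ N → Σ≤ N (λ v → [ dInf d v ]· αSum d h D v) ≡ Σ≤ N (λ v → [ InBox ps N v ]· boxTerm v)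
  Σ≤-dInf≡Σ≤-InBox N = Σ<-cong N (λ i i<N → same (suc i) i<N)
    where
    same : ∀ v → v ≤ N → [ dInf d v ]· αSum d h D v ≡ [ InBox ps N v ]· boxTerm v
    same v v≤N rewrite dInf≡InBox {d} {v} {N} d≥1 v≤N with InBox ps N v in v∈
    ... | true  = αSum≡boxTerm v∈
    ... | false = refl

  -- Every v in the box is at most boxBound, so the box sum is the sum over v ≤ N plus the tail N < v ≤ N + boxBound.
  Σ≤-InBox≡boxSum-tail : ∀ N → Σ≤ N (λ v → [ InBox ps N v ]· boxTerm v) ≡ boxSum ps N boxTerm ℚ.- tail N
  Σ≤-InBox≡boxSum-tail N = begin
      Σ≤ N f
        ≡⟨ solve 2 (λ x y → x := x :+ y :- y) refl (Σ≤ N f) (tail N) ⟩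
      Σ≤ N f ℚ.+ tail N ℚ.- tail N
        ≡⟨ cong (ℚ._- tail N) (sym (Σ<-split N B (λ i → f (suc i)))) ⟩
      Σ≤ (N + B) f ℚ.- tail N
        ≡⟨ cong (ℚ._- tail N) (Σ≤-InBox≡boxSum ps N boxTerm (N + B) ps-distinct) ⟩
      boxSum ps N (λ w → [ ⌊ w ≤? N + B ⌋ ]· boxTerm w) ℚ.- tail N
        ≡⟨ cong (ℚ._- tail N) (boxSum-cong N ps-distinct (λ w w∈ → cong (λ b → [ b ]· boxTerm w)
             (⌊⌋≡true (w ≤? N + B) (≤-trans (InBox⇒≤boxBound ps-distinct w∈) (m≤n+m B N))))) ⟩
      boxSum ps N boxTerm ℚ.- tail N                  ∎
    where
    open ≡-Reasoning
    open +-*-Solver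
    B = boxBound ps N
    f = λ v → [ InBox ps N v ]· boxTerm v

  S₃partial≡truncatedProduct-tail : ∀ N → S₃partial d h D N ≡ truncatedProduct N ℚ.- tail N
  S₃partial≡truncatedProduct-tail N = begin
      S₃partial d h D N                               ≡⟨ S₃partial≡Σ≤ d h D N ⟩
      Σ≤ N (λ v → [ dInf d v ]· αSum d h D v)         ≡⟨ Σ≤-dInf≡Σ≤-InBox N ⟩
      Σ≤ N (λ v → [ InBox ps N v ]· boxTerm v)        ≡⟨ Σ≤-InBox≡boxSum-tail N ⟩
      boxSum ps N boxTerm ℚ.- tail N                  ≡⟨ cong (ℚ._- tail N) (boxSum-boxTerm N) ⟩
      truncatedProduct N ℚ.- tail N                   ∎
    where open ≡-Reasoning

  ∣[InBox]·boxTerm∣≤ : ∀ N v → ℚ.∣ [ InBox ps N v ]· boxTerm v ∣ ℚ.≤ fromℕ (d * h) ℚ.* recip (v * v)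
  ∣[InBox]·boxTerm∣≤ N v = ∣[b]·x∣≤ (InBox ps N v) (boxTerm v) _ (*-nonNeg (fromℕ-nonNeg (d * h)) (recip-nonNeg (v * v)))
    (λ v∈ → subst (λ z → ℚ.∣ z ∣ ℚ.≤ fromℕ (d * h) ℚ.* recip (v * v)) (αSum≡boxTerm v∈) (∣αSum∣≤ d h D d≥1 h≥1 v∈))

  tail→0 : ConvergesTo tail 0ℚ
  tail→0 = ≤C*recip⇒converges-0 (d * h) 1 λ N N≥1 → begin
      ℚ.∣ tail N ∣
        ≤⟨ ∣Σ<∣≤Σ<∣∣ (boxBound ps N) _ ⟩
      Σ< (boxBound ps N) (λ i → ℚ.∣ [ InBox ps N (suc (N + i)) ]· boxTerm (suc (N + i)) ∣)
        ≤⟨ Σ<-mono-≤ (boxBound ps N) (λ i _ → ∣[InBox]·boxTerm∣≤ N (suc (N + i))) ⟩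
      Σ< (boxBound ps N) (λ i → fromℕ (d * h) ℚ.* recip (suc (N + i) * suc (N + i)))
        ≡⟨ Σ<-*ˡ (boxBound ps N) (fromℕ (d * h)) _ ⟩
      fromℕ (d * h) ℚ.* Σ< (boxBound ps N) (λ i → recip (suc (N + i) * suc (N + i)))
        ≤⟨ ℚP.*-monoˡ-≤-nonNeg (fromℕ (d * h)) {{ℚ.nonNegative (fromℕ-nonNeg (d * h))}} (Σ<-recip-square≤recip N (boxBound ps N) N≥1) ⟩
      fromℕ (d * h) ℚ.* recip N ∎
    where open ℚP.≤-Reasoning

  localSum-odd-converges : ∀ p → p ∈ ps → p ≢ 2 → ConvergesTo (λ N → Σ< (suc N) (localSum p)) (localLimit p (β p))
  localSum-odd-converges p p∈ p≢2 =
    converges-cong (λ N → Σ<-cong (suc N) (λ j _ → localSum≡localPair j)) (localPair-converges (β p) (prime⇒≥2 (proj₁ (∈-primeDivisors⁻ {p} {d} p∈))))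
    where
    localSum≡localPair : ∀ j → localSum p j ≡ localPair p (β p) j
    localSum≡localPair j = trans (cong (λ b → (0ℚ ℚ.+ [ not b ∨ cond j 0 ]· localTerm p (β p) j 0) ℚ.+ [ not b ∨ cond j 1 ]· localTerm p (β p) j 1)
                                       (⌊⌋≡false (p ≟ 2) p≢2))
                                 (cong (ℚ._+ localTerm p (β p) j 1) (ℚP.+-identityˡ (localTerm p (β p) j 0)))

  recip[φ[d]]*∏localLimit≡Sdh : recip (φ d) ℚ.* prodℚ (map (λ p → localLimit p (β p)) ps) ≡ Sdh d h
  recip[φ[d]]*∏localLimit≡Sdh = begin
      recip (φ d) ℚ.* prodℚ (map (λ p → localLimit p (β p)) ps)
        ≡⟨ cong (recip (φ d) ℚ.*_) (trans (prodℚ-* (λ p → (1ℚ ℚ.- recip p) ℚ.* (recip p ^ℚ β p)) zeta2Factor ps)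
                                          (cong (ℚ._* Z) (prodℚ-* (λ p → 1ℚ ℚ.- recip p) (λ p → recip p ^ℚ β p) ps))) ⟩
      recip (φ d) ℚ.* ((eulerProduct ps ℚ.* prodℚ (map (λ p → recip p ^ℚ β p) ps)) ℚ.* Z)
        ≡⟨ cong (λ z → recip (φ d) ℚ.* ((eulerProduct ps ℚ.* z) ℚ.* Z)) (sym (recip-∏p^e β ps (λ p → ∈ps⇒≥1))) ⟩
      recip (φ d) ℚ.* ((eulerProduct ps ℚ.* recip H) ℚ.* Z)
        ≡⟨ solve 4 (λ a e r z → a :* ((e :* r) :* z) := (a :* e) :* r :* z) refl (recip (φ d)) (eulerProduct ps) (recip H) Z ⟩
      (recip (φ d) ℚ.* eulerProduct ps) ℚ.* recip H ℚ.* Z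
        ≡⟨ cong (λ z → z ℚ.* recip H ℚ.* Z) recip[φ[d]]*eulerProduct≡recip[d] ⟩
      recip d ℚ.* recip H ℚ.* Z
        ≡⟨ cong (ℚ._* Z) (sym (recip-* d≥1 H≥1)) ⟩
      Sdh d h ∎
    where
    open ≡-Reasoning
    open +-*-Solver
    Z = prodℚ (map zeta2Factor ps)
    H = gcdInf h d
    H≥1 : 1 ≤ H
    H≥1 = prodℕ≥1 (λ p → p ^ ν p h) ps (λ p p∈ → let instance _ = ℕ.>-nonZero (∈ps⇒≥1 p∈) in m^n>0 p (ν p h))
    recip[φ[d]]*eulerProduct≡recip[d] : recip (φ d) ℚ.* eulerProduct ps ≡ recip d
    recip[φ[d]]*eulerProduct≡recip[d] = x*n≡z⇒x≡z//n _ (+ 1) d≥1 (begin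
        recip (φ d) ℚ.* eulerProduct ps ℚ.* fromℕ d
          ≡⟨ solve 3 (λ r e n → r :* e :* n := r :* (n :* e)) refl (recip (φ d)) (eulerProduct ps) (fromℕ d) ⟩
        recip (φ d) ℚ.* (fromℕ d ℚ.* eulerProduct ps)
          ≡⟨ cong (recip (φ d) ℚ.*_) (sym (φ[d]≡d*eulerProduct d≥1 (λ q pq q∣d → ∈-primeDivisors⁺ d≥1 pq q∣d) ∣-refl)) ⟩
        recip (φ d) ℚ.* fromℕ (φ d)
          ≡⟨ trans (ℚP.*-comm (recip (φ d)) _) (n*recip[n]≡1 (φ≥1 d≥1)) ⟩
        1ℚ                                            ∎)
      where open import Data.Nat.Divisibility using (∣-refl)

  S₃partial-converges : ∀ F → ConvergesTo (λ N → Σ< (suc N) (localSum 2)) (F ℚ.* localLimit 2 (ν₂ h)) →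
    ConvergesTo (S₃partial d h D) (F ℚ.* Sdh d h)
  S₃partial-converges F two-adic-limit = converges-cong S₃partial≡truncatedProduct-tail
      (subst (ConvergesTo (λ N → truncatedProduct N ℚ.- tail N)) limit≡
        (converges-−0 {f = truncatedProduct} (converges-*ˡ {f = λ N → prodℚ (map (λ p → Σ< (suc N) (localSum p)) ps)} (recip (φ d))
          (converges-prodℚ ps (λ p N → Σ< (suc N) (localSum p)) L local-limits)) tail→0))
    where
    L : ℕ → ℚ
    L p = (if ⌊ p ≟ 2 ⌋ then F else 1ℚ) ℚ.* localLimit p (β p)
    local-limits : ∀ p → p ∈ ps → ConvergesTo (λ N → Σ< (suc N) (localSum p)) (L p)
    local-limits p p∈ = by-cases (p ≟ 2)
      where
      by-cases : Dec (p ≡ 2) → ConvergesTo (λ N → Σ< (suc N) (localSum p)) (L p)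
      by-cases (yes refl) = two-adic-limit
      by-cases (no p≢2)   = subst (ConvergesTo (λ N → Σ< (suc N) (localSum p)))
                                  (sym (trans (cong (λ b → (if b then F else 1ℚ) ℚ.* localLimit p (β p)) (⌊⌋≡false (p ≟ 2) p≢2))
                                              (ℚP.*-identityˡ _)))
                                  (localSum-odd-converges p p∈ p≢2)
    limit≡ : recip (φ d) ℚ.* prodℚ (map L ps) ≡ F ℚ.* Sdh d h
    limit≡ = begin
      recip (φ d) ℚ.* prodℚ (map L ps)
        ≡⟨ cong (recip (φ d) ℚ.*_) (trans (prodℚ-* (λ p → if ⌊ p ≟ 2 ⌋ then F else 1ℚ) (λ p → localLimit p (β p)) ps)
                                          (cong (ℚ._* prodℚ (map (λ p → localLimit p (β p)) ps)) (prodℚ-select ps ps-distinct 2∈ps F))) ⟩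
      recip (φ d) ℚ.* (F ℚ.* prodℚ (map (λ p → localLimit p (β p)) ps))
        ≡⟨ trans (sym (ℚP.*-assoc (recip (φ d)) F _)) (trans (cong (ℚ._* _) (ℚP.*-comm (recip (φ d)) F)) (ℚP.*-assoc F (recip (φ d)) _)) ⟩
      F ℚ.* (recip (φ d) ℚ.* prodℚ (map (λ p → localLimit p (β p)) ps))
        ≡⟨ cong (F ℚ.*_) recip[φ[d]]*∏localLimit≡Sdh ⟩
      F ℚ.* Sdh d h ∎
      where open ≡-Reasoning


open import Defs
open import Data.Nat using (ℕ; _≤_)
open import Data.Integer using (+_)
open import Data.Integer.Divisibility as ℤD using ()
open import Data.Rational as ℚ using (ℚ; 0ℚ; 1ℚ)
open import Data.Product using (_×_; _,_)
open import Data.Sum using (_⊎_)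
open import Relation.Nullary using (¬_)
open import Relation.Binary.PropositionalEquality using (_≡_; _≢_; subst; cong; trans; sym)
import Data.Rational.Properties as ℚP

-- Only h, d and D enter S₃(D).
lemma6 : (g g₀ : ℚ) (h d : ℕ) (D : ℤ) →
    g ≢ 0ℚ → g ≢ 1ℚ → g ≢ ℚ.- 1ℚ →
    0ℚ ℚ.< g₀ → ¬ IsExactPower g₀ → 1 ≤ h →
    (g ≡ g₀ ^ℚ h ⊎ g ≡ ℚ.- (g₀ ^ℚ h)) →
    (∀ (g₁ : ℚ) (k : ℕ) → 0ℚ ℚ.< g₁ → (g ≡ g₁ ^ℚ k ⊎ g ≡ ℚ.- (g₁ ^ℚ k)) → k ≤ h) →
    1 ≤ d → IsFundamentalDiscriminant D →
    ((2 ∣ d × D ℤD.∣ (+ (4 Data.Nat.* d)) × 1 ≤ γ d h D) →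
        ConvergesTo (S₃partial d h D) (((+ 1) // (4 Data.Nat.^ γ d h D)) ℚ.* Sdh d h))
    × ((2 ∣ d × D ℤD.∣ (+ (4 Data.Nat.* d)) × γ d h D ≡ 0) →
        ConvergesTo (S₃partial d h D) (ℚ.- (Sdh d h ℚ.* ((+ 1) // 2))))
    × (¬ (2 ∣ d × D ℤD.∣ (+ (4 Data.Nat.* d))) →
        ConvergesTo (S₃partial d h D) 0ℚ)
lemma6 _ _ h d D _ _ _ _ _ h≥1 _ _ d≥1 fundamental = γ≥1-case , γ≡0-case , vanishing-case
  where
  γ≥1-case : (2 ∣ d × D ℤD.∣ (+ (4 Data.Nat.* d)) × 1 ≤ γ d h D) →
             ConvergesTo (S₃partial d h D) (((+ 1) // (4 Data.Nat.^ γ d h D)) ℚ.* Sdh d h)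
  γ≥1-case (2∣d , D∣4d , γ≥1) = S₃partial-converges (Embedding.recip (4 Data.Nat.^ γ d h D)) (σ₂-converges-γ≥1 γ≥1)
    where
    open Factorisation d h D d≥1 h≥1 2∣d D∣4d
    open TwoLocalSeries (ν₂ d) (ν₂ h) (ν₂ ℤ.∣ D ∣)

  γ≡0-case : (2 ∣ d × D ℤD.∣ (+ (4 Data.Nat.* d)) × γ d h D ≡ 0) →
             ConvergesTo (S₃partial d h D) (ℚ.- (Sdh d h ℚ.* ((+ 1) // 2)))
  γ≡0-case (2∣d , D∣4d , γ≡0) = subst (ConvergesTo (S₃partial d h D)) -½*S≡-[S*½]
                                       (S₃partial-converges (ℚ.- ℚ.½) (σ₂-converges-γ≡0 γ≡0))
    where
    open Factorisation d h D d≥1 h≥1 2∣d D∣4d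
    open TwoLocalSeries (ν₂ d) (ν₂ h) (ν₂ ℤ.∣ D ∣)
    -½*S≡-[S*½] : (ℚ.- ℚ.½) ℚ.* Sdh d h ≡ ℚ.- (Sdh d h ℚ.* ℚ.½)
    -½*S≡-[S*½] = trans (sym (ℚP.neg-distribˡ-* ℚ.½ (Sdh d h))) (cong ℚ.-_ (ℚP.*-comm ℚ.½ (Sdh d h)))

  vanishing-case : ¬ (2 ∣ d × D ℤD.∣ (+ (4 Data.Nat.* d))) → ConvergesTo (S₃partial d h D) 0ℚ
  vanishing-case ¬2∣d×D∣4d = Convergence.converges-cong {L = 0ℚ} (PartialSums.S₃partial≡0 d h D d≥1 fundamental ¬2∣d×D∣4d)
                                                         (Convergence.converges-const 0ℚ)
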